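{- Let $w\in\mathfrak{S}_n$ be vexillary of shape $\lambda$, let $x$ be a positive integer, and let $\varphi:=\varphi(w)+(x,x,x,\dots)$. Then for every nonnegative integer $L$, $$FK(w,L)=\sum_{j=|\lambda|}^{L}\#\mathtt{SSYT}(\lambda,\varphi,j)\cdot j!\,S(L,j),$$ where $FK(w,L)$ is evaluated at this value of $x$.
   Context: The Lehmer code of $w$ is $c_i(w)=\#\{j>i:w(i)>w(j)\}$; $w$ is vexillary if it avoids $2143$; its shape $\lambda=\lambda(w)$ is the decreasing rearrangement of $c(w)$, with $\ell$ nonzero parts. The $0$-Hecke monoid has generators $T_1,\dots,T_{n-1}$ with $T_i^2=T_i$ and the braid relations; a $0$-Hecke word of length $L$ for $w$ is $(\sigma_{i_1},\dots,\sigma_{i_L})$ with $T_{i_1}\cdots T_{i_L}=T_w$. $FK(w,L):=\sum(x+i_1)(x+i_2)\cdots(x+i_L)$, summed over all $0$-Hecke words $(\sigma_{i_1},\dots,\sigma_{i_L})$ for $w$ of length $L$. The flag $\varphi(w)=(\varphi_1,\dots,\varphi_\ell)$: the Rothe diagram is $D(w)=\{(i,j)\in[n]\times[n]: w(i)>j,\ w^{ -1}(j)>i\}$ (row $i$, column $j$); $\mu(w)$ is the smallest Ferrers shape, justified at the northwest corner of the $n\times n$ square, containing $D(w)$. Place $\lambda(w)$ at the northwest corner as well; the diagonal of row $i$ is the diagonal containing the rightmost box of $\lambda(w)$ in row $i$, and $\varphi_i$ is the row number of the southeasternmost box of $\mu(w)$ on that diagonal. Adding $(x,x,\dots)$ adds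 $x$ to each $\varphi_i$. A column-strict set-valued tableau of shape $\lambda$ assigns to each cell a finite nonempty set $T(y)$ of positive integers with $\max T(y)\le\min T(y')$ for $y$ left of $y'$ in a row and $\max T(y)<\min T(y')$ for $y$ above $y'$ in a column; it is flagged by $\varphi$ if $\max T(y)\le\varphi_i$ for every cell $y$ in row $i$. $\mathtt{SSYT}(\lambda,\varphi,j)$ is the set of such tableaux flagged by $\varphi$ with total number of entries $\sum_y\#T(y)=j$. $S(L,j)$ is the Stirling number of the second kind. -}

module Defs where

open import Data.Bool using (Bool; true; false; _∧_; if_then_else_)
open import Data.Nat using (ℕ; zero; suc; _+_; _*_; _∸_; _≤_; _<_; _<ᵇ_; _≤ᵇ_; _≡ᵇ_; _⊔_; _!)
open import Data.Fin using (Fin; toℕ)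
open import Data.Fin.Permutation using (Permutation′; _⟨$⟩ʳ_; _⟨$⟩ˡ_)
open import Data.List using (List; []; _∷_; [_]; _++_; length; map; filterᵇ;
  upTo; allFin; reverse; concat; foldr; cartesianProduct)
open import Data.Nat.ListAction using (sum; product)
open import Data.Bool.ListAction using (any)
open import Data.List.Membership.Propositional using (_∈_)
open import Data.List.Relation.Unary.All using (All)
open import Data.List.Relation.Unary.Unique.Propositional using (Unique)
open import Data.List.Relation.Unary.AllPairs using (AllPairs)
open import Data.Maybe using (Maybe; just; nothing)
open import Data.Product using (Σ; _×_; _,_; ∃)
open import Relation.Binary.PropositionalEquality using (_≡_)
open import Relation.Nullary using (¬_)

record Enumerates {A : Set} (P : A → Set) (xs : List A) : Set where
  field
    unique   : Unique xs
    sound    : ∀ a → a ∈ xs → P a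
    complete : ∀ a → P a → a ∈ xs

SumOver : {A : Set} → (A → Set) → (A → ℕ) → ℕ → Set
SumOver {A} P f s = Σ (List A) λ xs → Enumerates P xs × sum (map f xs) ≡ s

CardIs : {A : Set} → (A → Set) → ℕ → Set
CardIs {A} P k = Σ (List A) λ xs → Enumerates P xs × length xs ≡ k

nth : {A : Set} → List A → ℕ → Maybe A
nth []       _       = nothing
nth (a ∷ as) zero    = just a
nth (a ∷ as) (suc i) = nth as i

S₂ : ℕ → ℕ → ℕ
S₂ zero    zero    = 1
S₂ zero    (suc k) = 0
S₂ (suc m) zero    = 0
S₂ (suc m) (suc k) = suc k * S₂ m (suc k) + S₂ m k

insertDesc : ℕ → List ℕ → List ℕ
insertDesc a []       = a ∷ []
insertDesc a (b ∷ bs) = if b ≤ᵇ a then a ∷ b ∷ bs else b ∷ insertDesc a bs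

sortDesc : List ℕ → List ℕ
sortDesc []       = []
sortDesc (a ∷ as) = insertDesc a (sortDesc as)

-- Permutations w ∈ 𝔖_n (library Permutation′ n).  Positions and values
-- are Fin n, i.e. 0-based: the 1-based value w(i+1) is 1 + toℕ (w ⟨$⟩ʳ i),
-- and w⁻¹ is w ⟨$⟩ˡ_.

module _ {n : ℕ} (w : Permutation′ n) where

  val : Fin n → ℕ
  val i = toℕ (w ⟨$⟩ʳ i)

  valInv : Fin n → ℕ
  valInv j = toℕ (w ⟨$⟩ˡ j)

  code : Fin n → ℕ
  code i = length (filterᵇ (λ j → (toℕ i <ᵇ toℕ j) ∧ (val j <ᵇ val i)) (allFin n))

  inversions : ℕ
  inversions = sum (map code (allFin n))

  Vexillary : Set
  Vexillary = ¬ (Σ (Fin n) λ a → Σ (Fin n) λ b → Σ (Fin n) λ c → Σ (Fin n) λ d →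
    toℕ a < toℕ b × toℕ b < toℕ c × toℕ c < toℕ d ×
    val b < val a × val a < val d × val d < val c)

  shape : List ℕ
  shape = sortDesc (filterᵇ (λ c → 0 <ᵇ c) (map code (allFin n)))

  inD : Fin n → Fin n → Bool
  inD i j = (toℕ j <ᵇ val i) ∧ (toℕ i <ᵇ valInv j)

  -- μ(w): smallest Ferrers shape (NW-justified) containing D(w), i.e. the
  -- set of boxes (r,c) weakly northwest of some box of D(w)  (0-based)
  inMu : ℕ → ℕ → Bool
  inMu r c = any (λ ij → inD (Data.Product.proj₁ ij) (Data.Product.proj₂ ij)
                          ∧ (r ≤ᵇ toℕ (Data.Product.proj₁ ij))
                          ∧ (c ≤ᵇ toℕ (Data.Product.proj₂ ij)))
                 (cartesianProduct (allFin n) (allFin n))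

  -- φ for the row with 0-based index k and part p = λ_{k+1} ≥ 1:
  -- the rightmost box of that row is (k, p-1) (0-based), on the diagonal
  -- c - r = (p-1) - k; φ is the 1-based row number of the southeasternmost
  -- box of μ(w) on that diagonal (0 if there is none).
  phiRow : ℕ → ℕ → ℕ
  phiRow k p = foldr _⊔_ 0
    (map (λ r → if (k ≤ᵇ r + (p ∸ 1)) ∧ inMu r (r + (p ∸ 1) ∸ k) then suc r else 0)
         (upTo n))

  phisFrom : ℕ → List ℕ → List ℕ
  phisFrom k []       = []
  phisFrom k (p ∷ ps) = phiRow k p ∷ phisFrom (suc k) ps

  flag : List ℕ
  flag = phisFrom 0 shape

shiftedFlag : {n : ℕ} → Permutation′ n → ℕ → List ℕ
shiftedFlag w x = map (x +_) (flag w)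

-- 0-Hecke monoid of 𝔖_n, by generators T_1..T_{n-1} and relations.
-- Words are lists of generator indices (ℕ, 1-based).

data HeckeRel : List ℕ → List ℕ → Set where
  idem  : ∀ i → HeckeRel (i ∷ i ∷ []) (i ∷ [])
  braid : ∀ i → HeckeRel (i ∷ suc i ∷ i ∷ []) (suc i ∷ i ∷ suc i ∷ [])
  comm  : ∀ i j → suc i < j → HeckeRel (i ∷ j ∷ []) (j ∷ i ∷ [])

data _≈H_ : List ℕ → List ℕ → Set where
  ≈refl  : ∀ {u} → u ≈H u
  ≈sym   : ∀ {u v} → u ≈H v → v ≈H u
  ≈trans : ∀ {u v t} → u ≈H v → v ≈H t → u ≈H t
  ≈step  : ∀ u v {a b} → HeckeRel a b → (u ++ a ++ v) ≈H (u ++ b ++ v)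

Letters : ℕ → List ℕ → Set
Letters n = All (λ i → 1 ≤ i × suc i ≤ n)

-- simple transposition s_i (i ≥ 1) acting on 0-based positions: swaps i-1, i
sAct : ℕ → ℕ → ℕ
sAct i k = if k ≡ᵇ (i ∸ 1) then i else (if k ≡ᵇ i then i ∸ 1 else k)

wordAct : List ℕ → ℕ → ℕ
wordAct []       k = k
wordAct (i ∷ is) k = sAct i (wordAct is k)

Reduced : {n : ℕ} → Permutation′ n → List ℕ → Set
Reduced {n} w r = Letters n r × (∀ k → wordAct r (toℕ k) ≡ val w k) × length r ≡ inversions w

-- 0-Hecke word of length L for w: T_{i_1} ⋯ T_{i_L} = T_w, where T_w is the
-- product along any reduced word of w
HeckeWord : {n : ℕ} → Permutation′ n → ℕ → List ℕ → Set
HeckeWord {n} w L a = length a ≡ L × Letters n a × Σ (List ℕ) λ r → Reduced w r × a ≈H r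

fkWeight : ℕ → List ℕ → ℕ
fkWeight x a = product (map (x +_) a)

-- Column-strict set-valued tableaux.  A tableau is a list of rows, a row a
-- list of cells, a cell the (finite nonempty) set T(y) represented as its
-- strictly increasing list of elements.

cell : List (List (List ℕ)) → ℕ → ℕ → Maybe (List ℕ)
cell T i k with nth T i
... | nothing  = nothing
... | just row = nth row k

SVT : List ℕ → List ℕ → ℕ → List (List (List ℕ)) → Set
SVT lam φ j T =
  map length T ≡ lam ×
  (∀ i k s → cell T i k ≡ just s →
     ¬ (s ≡ []) × AllPairs _<_ s × All (λ a → 1 ≤ a) s ×
     (∀ f → nth φ i ≡ just f → All (λ a → a ≤ f) s)) ×
  (∀ i k k' s s' → k < k' → cell T i k ≡ just s → cell T i k' ≡ just s' →
     ∀ a b → a ∈ s → b ∈ s' → a ≤ b) ×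
  (∀ i i' k s s' → i < i' → cell T i k ≡ just s → cell T i' k ≡ just s' →
     ∀ a b → a ∈ s → b ∈ s' → a < b) ×
  sum (map length (concat T)) ≡ j

sumFromTo : ℕ → ℕ → (ℕ → ℕ) → ℕ
sumFromTo a L g = sum (map (λ t → g (a + t)) (upTo (suc L ∸ a)))

{-# OPTIONS --safe #-}

-- Let F_L(w) be the weighted number of 0-Hecke words of length L of 1ˣ × w, where the
-- letter i has weight i, and F(w) = Σ F_L(w) t^L / L!.  Removing the last letter of a word
-- gives F′(w) = Σ i (F(w) + F(w sᵢ)) over the descents i of w.  By induction on L this
-- recursion yields the K-theoretic Monk rule for F, in which every variable is eᵗ - 1.
-- If w is vexillary and is not the identity, let r be its last descent, let v be w with the
-- letter at r exchanged with the next smaller letter to its right, and let w' be v with its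
-- letter X at r exchanged with the last letter Y < X to the left of r.  The rule becomes the
-- transition F(w) + F(v) = eᵗ (F(v) + F(w')), without w' if there is no Y.  In the Lehmer
-- code c of w, the entry c_r is lowered by one in v and exchanged with that of Y in w'.
-- The set-valued tableaux satisfy the same recursion: let the rows of length p be flagged by
-- the last position with c ≥ p, and look at the entry r in the corner at the end of the last
-- row of length c_r.  Either r is the only entry of the corner (v), or it is absent (w'), or
-- it is accompanied by other entries (w' again).  On the last row of each length this flag
-- is φ(w), by 2143-avoidance; column strictness takes care of the other rows.  The factor
-- j! S(L,j) is the coefficient of t^L / L! in (eᵗ - 1)^j.
module Submission where

open import Defs
open import Algebra.Properties.CommutativeSemigroup using (x∙yz≈y∙xz)
open import Data.Bool as Bool using (Bool; true; false; if_then_else_; _∧_; not)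
open import Data.Bool.ListAction using (any)
open import Data.Bool.Properties using (∧-conicalʳ)
open import Data.Empty using (⊥; ⊥-elim)
open import Data.Fin using (Fin; toℕ; fromℕ<)
open import Data.Fin.Permutation using (Permutation′; _⟨$⟩ʳ_; _⟨$⟩ˡ_; inverseˡ; inverseʳ)
open import Data.Fin.Properties using (toℕ-injective; toℕ<n; toℕ-fromℕ<)
open import Data.List using (List; []; _∷_; [_]; _++_; _∷ʳ_; _ʳ++_; length; map; concat; foldr; reverse; replicate; take; filterᵇ; applyUpTo; upTo; tabulate; allFin; cartesianProduct; initLast; _∷ʳ′_)
open import Data.List.Membership.DecPropositional using (_∈?_)
open import Data.List.Membership.Propositional using (_∈_; _∉_)
open import Data.List.Membership.Propositional.Properties using (∈-++⁺ˡ; ∈-++⁺ʳ; ∈-++⁻; ∈-map⁺; ∈-map⁻; ∈-upTo⁺; ∈-upTo⁻; ∈-allFin; ∈-cartesianProduct⁺)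
open import Data.List.Membership.Propositional.Properties.WithK using (unique∧set⇒bag)
open import Data.List.Properties using (++-assoc; ++-cancelʳ; ++-identityʳ; concat-++; length-++; length-applyUpTo; length-map; length-replicate; length-reverse; map-++; map-applyUpTo; map-id; map-tabulate; map-upTo; map-∘; reverse-++; reverse-involutive; reverse-map; tabulate-cong; unfold-reverse; ʳ++-defn; ∷-injectiveʳ; ∷-injectiveˡ; ∷ʳ-injectiveʳ; ∷ʳ-injectiveˡ)
open import Data.List.Relation.Binary.BagAndSetEquality using (∼bag⇒↭)
open import Data.List.Relation.Binary.Permutation.Propositional using (_↭_; prep; swap; refl; trans; ↭-refl; ↭-sym; ↭⇒↭ₛ)
open import Data.List.Relation.Binary.Permutation.Propositional.Properties using (All-resp-↭; Any-resp-↭; ++⁺; ++⁺ʳ; ++⁺ˡ; drop-∷; ↭-empty-inv; ↭-length; ↭-reverse; ∈-resp-↭) renaming (shift to ↭-shift)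
import Data.List.Relation.Binary.Permutation.Setoid.Properties as ↭ₛ
open import Data.List.Relation.Unary.All as All using (All; []; _∷_)
import Data.List.Relation.Unary.All.Properties as All
open import Data.List.Relation.Unary.AllPairs as AllPairs using (AllPairs; []; _∷_)
import Data.List.Relation.Unary.AllPairs.Properties as AllPairs
open import Data.List.Relation.Unary.Any using (Any; here; there)
open import Data.List.Relation.Unary.Unique.Propositional using (Unique)
import Data.List.Relation.Unary.Unique.Propositional.Properties as Unique
open import Data.List.Reverse using (Reverse; reverseView; []; _∶_∶ʳ_)
open import Data.Maybe using (Maybe; just; nothing)
open import Data.Maybe.Properties using (just-injective)
open import Data.Nat
open import Data.Nat.Induction using (<-wellFounded)
open import Data.Nat.ListAction using (sum; product)
open import Data.Nat.ListAction.Properties using (sum-++; product-++)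
open import Data.Nat.Properties
open import Data.Nat.Solver using (module +-*-Solver)
open import Data.Product using (Σ; ∃; _×_; _,_; proj₁; proj₂)
open import Data.Sum using (_⊎_; inj₁; inj₂)
open import Data.Unit using (⊤; tt)
open import Function using (_∘_; flip; id; mk⇔)
open import Induction.WellFounded using (Acc; acc)
open import Relation.Binary.Bundles using (Setoid)
open import Relation.Binary.Definitions using (tri<; tri≈; tri>)
open import Relation.Binary.PropositionalEquality as ≡ using (_≡_; _≢_; cong; cong₂; sym; subst; module ≡-Reasoning)
open import Relation.Nullary using (yes; no; ¬_)

-- Monk's rule is proved for all words with distinct letters, because the exchanges at descents in
-- its induction leave the class of vexillary permutations. Avoidance enters only afterwards, to
-- leave at most one nontrivial chain on the left. The exchanged letter must have a larger letter to
-- its right; this is automatic in the infinite symmetric group and an explicit hypothesis here. The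
-- tableaux depend on the Lehmer code alone. `Transition` therefore separates the two halves of the
-- proof: of the permutation it keeps only the inequalities between code entries that the corner
-- argument uses, and the one function `tableaux` on it is identified once with the coefficients of
-- F and once with the numbers of tableaux. The decisive inequality comes from 2143-avoidance: to
-- the left of `Y` no code entry exceeds that of `Y` without also exceeding `c_r`. F(v) stands on
-- both sides of the transition and all coefficients are natural numbers, so the equation is kept in
-- additive form and F(v) is cancelled.

-- Exponential generating functions and the substitution z = eᵗ - 1.

shift : (ℕ → ℕ) → ℕ → ℕ
shift N zero    = 0
shift N (suc j) = N j

-- The coefficients of (1 + z) d/dz applied to Σ N j zʲ.
euler : (ℕ → ℕ) → ℕ → ℕ
euler N j = j * N j + suc j * N (suc j)

-- The coefficient of t^L / L! in Σ N j zʲ at z = eᵗ - 1.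
egf : (ℕ → ℕ) → ℕ → ℕ
egf N zero    = N 0
egf N (suc L) = egf (euler N) L

-- Multiplication by eᵗ of exponential generating functions.
timesExp : (ℕ → ℕ) → ℕ → ℕ
timesExp G zero    = G 0
timesExp G (suc L) = timesExp G L + timesExp (G ∘ suc) L

egf-cong : ∀ {N N'} → (∀ j → N j ≡ N' j) → ∀ L → egf N L ≡ egf N' L
egf-cong h zero    = h 0
egf-cong h (suc L) = egf-cong (λ j → cong₂ _+_ (cong (j *_) (h j)) (cong (suc j *_) (h (suc j)))) L

egf-+ : ∀ N N' L → egf (λ j → N j + N' j) L ≡ egf N L + egf N' L
egf-+ N N' zero    = ≡.refl
egf-+ N N' (suc L) = ≡.trans (egf-cong pointwise L) (egf-+ (euler N) (euler N') L)
  where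
  open +-*-Solver
  pointwise : ∀ j → euler (λ j → N j + N' j) j ≡ euler N j + euler N' j
  pointwise j = solve 6 (λ j sj a b c d → j :* (a :+ b) :+ sj :* (c :+ d) := (j :* a :+ sj :* c) :+ (j :* b :+ sj :* d))
    ≡.refl j (suc j) (N j) (N' j) (N (suc j)) (N' (suc j))

timesExp-cong : ∀ {G G'} → (∀ k → G k ≡ G' k) → ∀ L → timesExp G L ≡ timesExp G' L
timesExp-cong h zero    = h 0
timesExp-cong h (suc L) = cong₂ _+_ (timesExp-cong h L) (timesExp-cong (h ∘ suc) L)

+-swap-middle : ∀ a b c d → (a + b) + (c + d) ≡ (a + c) + (b + d)
+-swap-middle = solve 4 (λ a b c d → (a :+ b) :+ (c :+ d) := (a :+ c) :+ (b :+ d)) ≡.refl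
  where open +-*-Solver

timesExp-+ : ∀ G G' L → timesExp (λ k → G k + G' k) L ≡ timesExp G L + timesExp G' L
timesExp-+ G G' zero    = ≡.refl
timesExp-+ G G' (suc L) = ≡.trans
  (cong₂ _+_ (timesExp-+ G G' L) (timesExp-+ (G ∘ suc) (G' ∘ suc) L))
  (+-swap-middle (timesExp G L) _ _ _)

timesExp-* : ∀ c G L → timesExp (λ k → c * G k) L ≡ c * timesExp G L
timesExp-* c G zero    = ≡.refl
timesExp-* c G (suc L) = ≡.trans
  (cong₂ _+_ (timesExp-* c G L) (timesExp-* c (G ∘ suc) L))
  (sym (*-distribˡ-+ c (timesExp G L) _))

timesExp-0 : ∀ L → timesExp (λ _ → 0) L ≡ 0
timesExp-0 zero    = ≡.refl
timesExp-0 (suc L) = cong₂ _+_ (timesExp-0 L) (timesExp-0 L)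

-- Product rule for the derivation `(1 + z) d/dz`, which fixes `1 + z` just as d/dt fixes eᵗ.
euler-1+z : ∀ N j → euler (λ j → N j + shift N j) j
                  ≡ (N j + shift N j) + (euler N j + shift (euler N) j)
euler-1+z N zero = solve 2 (λ a b → con 0 :* (a :+ con 0) :+ con 1 :* (b :+ a)
    := (a :+ con 0) :+ ((con 0 :* a :+ con 1 :* b) :+ con 0)) ≡.refl (N 0) (N 1)
  where open +-*-Solver
euler-1+z N (suc j) = solve 4 (λ j a b c →
    (con 1 :+ j) :* (b :+ a) :+ (con 2 :+ j) :* (c :+ b)
    := (b :+ a) :+ (((con 1 :+ j) :* b :+ (con 2 :+ j) :* c) :+ (j :* a :+ (con 1 :+ j) :* b)))
    ≡.refl j (N j) (N (suc j)) (N (suc (suc j)))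
  where open +-*-Solver

timesExp-egf : ∀ N L → timesExp (egf N) L ≡ egf (λ j → N j + shift N j) L
timesExp-egf N zero    = sym (+-identityʳ (N 0))
timesExp-egf N (suc L) = begin
  timesExp (egf N) L + timesExp (egf (euler N)) L
    ≡⟨ cong₂ _+_ (timesExp-egf N L) (timesExp-egf (euler N) L) ⟩
  egf (λ j → N j + shift N j) L + egf (λ j → euler N j + shift (euler N) j) L
    ≡⟨ egf-+ _ _ L ⟨
  egf (λ j → (N j + shift N j) + (euler N j + shift (euler N) j)) L
    ≡⟨ egf-cong (euler-1+z N) L ⟨
  egf (euler (λ j → N j + shift N j)) L ∎
  where open ≡-Reasoning

-- At `z = eᵗ - 1` the factor `1 + z` is eᵗ. The coefficients of `z N₁ + (1 + z) N₂` are those of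
-- `tableaux` at `move`, so this is the transition equation on the counting side, with `N₁` added on
-- the left instead of subtracted on the right.
egf-shift : ∀ N₁ N₂ L → egf (λ j → shift N₁ j + (N₂ j + shift N₂ j)) L + egf N₁ L
          ≡ timesExp (λ k → egf N₁ k + egf N₂ k) L
egf-shift N₁ N₂ L = begin
  egf (λ j → shift N₁ j + (N₂ j + shift N₂ j)) L + egf N₁ L ≡⟨ egf-+ _ N₁ L ⟨
  egf (λ j → (shift N₁ j + (N₂ j + shift N₂ j)) + N₁ j) L
    ≡⟨ egf-cong (λ j → rearrange (shift N₁ j) _ (N₁ j)) L ⟩
  egf (λ j → (N₁ j + shift N₁ j) + (N₂ j + shift N₂ j)) L ≡⟨ egf-+ _ _ L ⟩
  egf (λ j → N₁ j + shift N₁ j) L + egf (λ j → N₂ j + shift N₂ j) L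
    ≡⟨ cong₂ _+_ (timesExp-egf N₁ L) (timesExp-egf N₂ L) ⟨
  timesExp (egf N₁) L + timesExp (egf N₂) L ≡⟨ timesExp-+ (egf N₁) (egf N₂) L ⟨
  timesExp (λ k → egf N₁ k + egf N₂ k) L ∎
  where
  open ≡-Reasoning
  rearrange : ∀ a b c → (a + b) + c ≡ (c + a) + b
  rearrange = solve 3 (λ a b c → (a :+ b) :+ c := (c :+ a) :+ b) ≡.refl
    where open +-*-Solver

egf-0 : ∀ L → egf (λ _ → 0) L ≡ 0
egf-0 zero    = ≡.refl
egf-0 (suc L) = ≡.trans (egf-cong (λ j → cong₂ _+_ (*-zeroʳ j) (*-zeroʳ j)) L) (egf-0 L)

∑< : ℕ → (ℕ → ℕ) → ℕ
∑< zero    f = 0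
∑< (suc n) f = f n + ∑< n f

∑<-cong : ∀ n {f g} → (∀ i → i < n → f i ≡ g i) → ∑< n f ≡ ∑< n g
∑<-cong zero    h = ≡.refl
∑<-cong (suc n) h = cong₂ _+_ (h n ≤-refl) (∑<-cong n (λ i i<n → h i (m≤n⇒m≤1+n i<n)))

∑<-+ : ∀ n f g → ∑< n (λ i → f i + g i) ≡ ∑< n f + ∑< n g
∑<-+ zero    f g = ≡.refl
∑<-+ (suc n) f g = ≡.trans (cong (f n + g n +_) (∑<-+ n f g)) (+-swap-middle (f n) _ _ _)

∑<-suc : ∀ n f → ∑< (suc n) f ≡ f 0 + ∑< n (f ∘ suc)
∑<-suc zero    f = ≡.refl
∑<-suc (suc n) f = ≡.trans (cong (f (suc n) +_) (∑<-suc n f))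
  (x∙yz≈y∙xz +-commutativeSemigroup (f (suc n)) (f 0) _)

S₂-above : ∀ L k → L < k → S₂ L k ≡ 0
S₂-above zero    (suc k) _         = ≡.refl
S₂-above (suc L) (suc k) (s≤s L<k) = cong₂ _+_
  (≡.trans (cong (suc k *_) (S₂-above L (suc k) (m≤n⇒m≤1+n L<k))) (*-zeroʳ k))
  (S₂-above L k L<k)

-- After one application of `euler`, the coefficient of `N j` in the sum for `L` is j! (j S(L,j) +
-- S(L,j-1)), which is the Stirling recurrence.
egf-Stirling : ∀ L N → egf N L ≡ ∑< (suc L) (λ j → N j * j ! * S₂ L j)
egf-Stirling zero N = solve 1 (λ a → a := a :* con 1 :* con 1 :+ con 0) ≡.refl (N 0)
  where open +-*-Solver
egf-Stirling (suc L) N = begin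
  egf (euler N) L
    ≡⟨ egf-Stirling L (euler N) ⟩
  ∑< (suc L) (λ j → euler N j * j ! * S₂ L j)
    ≡⟨ ∑<-cong (suc L) (λ j _ → split j) ⟩
  ∑< (suc L) (λ j → g j + h j)
    ≡⟨ ∑<-+ (suc L) g h ⟩
  ∑< (suc L) g + ∑< (suc L) h
    -- The index moves by one: `g 0` vanishes because of its factor 0, and the top term that is
    -- added vanishes because `S₂ L (suc L)` does.
    ≡⟨ cong (_+ ∑< (suc L) h) (≡.trans (∑<-suc L g) (sym (cong₂ _+_ ≡.refl (∑<-extend)))) ⟩
  ∑< (suc L) (g ∘ suc) + ∑< (suc L) h
    ≡⟨ ∑<-+ (suc L) (g ∘ suc) h ⟨
  ∑< (suc L) (λ j → g (suc j) + h j)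
    ≡⟨ ∑<-cong (suc L) (λ j _ → merge j) ⟩
  ∑< (suc L) (λ j → N (suc j) * suc j ! * S₂ (suc L) (suc j))
    ≡⟨ cong (_+ ∑< (suc L) (λ j → N (suc j) * suc j ! * S₂ (suc L) (suc j))) (*-zeroʳ (N 0 * 1)) ⟨
  N 0 * 1 * 0 + ∑< (suc L) (λ j → N (suc j) * suc j ! * S₂ (suc L) (suc j))
    ≡⟨ ∑<-suc (suc L) (λ j → N j * j ! * S₂ (suc L) j) ⟨
  ∑< (suc (suc L)) (λ j → N j * j ! * S₂ (suc L) j) ∎
  where
  open ≡-Reasoning
  open +-*-Solver
  g h : ℕ → ℕ
  g j = j * N j * j ! * S₂ L j
  h j = suc j * N (suc j) * j ! * S₂ L j
  split : ∀ j → euler N j * j ! * S₂ L j ≡ g j + h j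
  split j = solve 4 (λ a b c d → (a :+ b) :* c :* d := a :* c :* d :+ b :* c :* d) ≡.refl
    (j * N j) (suc j * N (suc j)) (j !) (S₂ L j)
  merge : ∀ j → g (suc j) + h j ≡ N (suc j) * suc j ! * S₂ (suc L) (suc j)
  merge j = solve 5 (λ sj n f s s' → (sj :* n :* (sj :* f) :* s) :+ (sj :* n :* f :* s')
      := n :* (sj :* f) :* (sj :* s :+ s')) ≡.refl
    (suc j) (N (suc j)) (j !) (S₂ L (suc j)) (S₂ L j)
  ∑<-extend : ∑< (suc L) (g ∘ suc) ≡ ∑< L (g ∘ suc)
  ∑<-extend = cong (_+ ∑< L (g ∘ suc)) (≡.trans
    (cong (suc L * N (suc L) * suc L ! *_) (S₂-above L (suc L) ≤-refl))
    (*-zeroʳ (suc L * N (suc L) * suc L !)))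

-- Monk's rule

true≢false : ∀ {b : Bool} → b ≡ true → b ≡ false → ∀ {A : Set} → A
true≢false ≡.refl ()

open import Data.Nat.Solver using (module +-*-Solver)

-- The sums over shifts on either side and `timesExp` at a fixed exponent are all functionals of
-- this kind. A sum over the descents of a fixed word can be exchanged with each of them, so that
-- the induction hypothesis of `monk` becomes applicable below such a sum.
record Linear {I : Set} (Φ : (I → ℕ) → ℕ) : Set where
  field
    null  : Φ (λ _ → 0) ≡ 0
    plus  : ∀ G G' → Φ (λ i → G i + G' i) ≡ Φ G + Φ G'
    times : ∀ c G → Φ (λ i → c * G i) ≡ c * Φ G

timesExp-linear : ∀ L → Linear (λ G → timesExp G L)
timesExp-linear L = record
  { null  = timesExp-0 L
  ; plus  = λ G G' → timesExp-+ G G' L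
  ; times = λ c G → timesExp-* c G L
  }

module StrictOrder
  (lt : ℕ → ℕ → Bool)
  (transitive : ∀ a b c → lt a b ≡ true → lt b c ≡ true → lt a c ≡ true)
  (asymmetric : ∀ a b → lt a b ≡ true → lt b a ≡ false)
  (connex : ∀ a b → a ≢ b → lt a b ≡ false → lt b a ≡ true)
  where

  lt-trans : ∀ {a b c} → lt a b ≡ true → lt b c ≡ true → lt a c ≡ true
  lt-trans = transitive _ _ _

  lt-asym : ∀ {a b} → lt a b ≡ true → lt b a ≡ false
  lt-asym = asymmetric _ _

  lt-connex : ∀ {a b} → a ≢ b → lt a b ≡ false → lt b a ≡ true
  lt-connex = connex _ _

  ≤-lt-trans : ∀ {a b c} → lt b a ≡ false → lt b c ≡ true → lt a c ≡ true
  ≤-lt-trans {a} {b} {c} b≮a b<c with a ≟ b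
  ... | yes ≡.refl = b<c
  ... | no a≢b   = lt-trans (lt-connex (a≢b ∘ sym) b≮a) b<c

  ≤-trans′ : ∀ {a b c} → lt b a ≡ false → lt c b ≡ false → lt c a ≡ false
  ≤-trans′ {a} {b} {c} b≮a c≮b with lt c a in c<a
  ... | false = ≡.refl
  ... | true  = true≢false (≤-lt-trans c≮b c<a) b≮a

  <-≤-trans′ : ∀ {a b c} → lt a b ≡ true → lt c b ≡ false → lt a c ≡ true
  <-≤-trans′ {a} {b} {c} a<b b≤c with lt a c in a<c
  ... | true  = ≡.refl
  ... | false = true≢false (≤-lt-trans a<c a<b) b≤c

  below : ℕ → Maybe ℕ → Bool
  below y nothing  = true
  below y (just u) = lt y u

  below-trans : ∀ {a b} ub → lt a b ≡ true → below b ub ≡ true → below a ub ≡ true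
  below-trans nothing  _   _   = ≡.refl
  below-trans (just u) a<b b<u = lt-trans a<b b<u

  record? : ℕ → Maybe ℕ → ℕ → Bool
  record? X ub Y = lt X Y ∧ below Y ub

  record?-true : ∀ X ub Y → record? X ub Y ≡ true → lt X Y ≡ true × below Y ub ≡ true
  record?-true X ub Y r with lt X Y
  ... | true = ≡.refl , r

  true-record? : ∀ {X Y} ub → lt X Y ≡ true → below Y ub ≡ true → record? X ub Y ≡ true
  true-record? {X} {Y} ub p q rewrite p = q

  ≮-record? : ∀ {X Y} ub → lt X Y ≡ false → record? X ub Y ≡ false
  ≮-record? ub p rewrite p = ≡.refl

  record?-≮ : ∀ {X Y} ub → record? X ub Y ≡ false → below Y ub ≡ true → lt X Y ≡ false
  record?-≮ {X} {Y} ub r b with lt X Y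
  ... | true  = true≢false b r
  ... | false = ≡.refl

  not-below-record? : ∀ {X Y} ub → below Y ub ≡ false → record? X ub Y ≡ false
  not-below-record? {X} {Y} ub p with lt X Y
  ... | true  = p
  ... | false = ≡.refl

  opaque
    -- The letters Y of s with X < Y < ub that are smaller than all previous such
    -- letters are the records.  For every subset Y₁ > Y₂ > ... > Yₖ of them, X Y₁ ... Yₖ
    -- is shifted cyclically, so that the word X ∷ s becomes h ∷ t with h = Y₁ (or h = X for
    -- the empty subset); sumShifts adds up G h t over all subsets.  In the strong
    -- Bruhat order these are the chains v ⋖ v t_{rb} ⋖ ... of Monk's rule.
    sumShifts : ℕ → Maybe ℕ → List ℕ → (ℕ → List ℕ → ℕ) → ℕ
    sumShifts X ub []      G = G X []
    sumShifts X ub (Y ∷ s) G =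
      if record? X ub Y then sumShifts X (just Y) s (λ h t → G h (Y ∷ t) + G Y (h ∷ t))
                        else sumShifts X ub s (λ h t → G h (Y ∷ t))

    shifts-[] : ∀ {X ub G} → sumShifts X ub [] G ≡ G X []
    shifts-[] = ≡.refl

    shifts-record : ∀ {X ub Y} s {G} → record? X ub Y ≡ true →
      sumShifts X ub (Y ∷ s) G ≡ sumShifts X (just Y) s (λ h t → G h (Y ∷ t) + G Y (h ∷ t))
    shifts-record s r rewrite r = ≡.refl

    shifts-skip : ∀ {X ub Y} s {G} → record? X ub Y ≡ false →
      sumShifts X ub (Y ∷ s) G ≡ sumShifts X ub s (λ h t → G h (Y ∷ t))
    shifts-skip s r rewrite r = ≡.refl

    -- Every head that occurs is `X` or a record, hence lies in the interval from `X` up to `ub`.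
    -- Knowing this decides whether `h` forms a descent with a neighbouring letter.
    shifts-cong : ∀ X ub s {G G'} → below X ub ≡ true →
      (∀ h t → lt h X ≡ false → below h ub ≡ true → G h t ≡ G' h t) →
      sumShifts X ub s G ≡ sumShifts X ub s G'
    shifts-cong X ub [] b e with lt X X in X<X
    ... | false = e X [] X<X b
    ... | true  = true≢false X<X (lt-asym X<X)
    shifts-cong X ub (Y ∷ s) b e with record? X ub Y in r
    ... | false = shifts-cong X ub s b (λ h t h≥X h<u → e h (Y ∷ t) h≥X h<u)
    ... | true  = let X<Y , Y<u = record?-true X ub Y r in
      shifts-cong X (just Y) s X<Y (λ h t h≥X h<Y →
        cong₂ _+_ (e h (Y ∷ t) h≥X (below-trans ub h<Y Y<u)) (e Y (h ∷ t) (lt-asym X<Y) Y<u))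

    shifts-ext : ∀ X ub s {G G'} → (∀ h t → G h t ≡ G' h t) → sumShifts X ub s G ≡ sumShifts X ub s G'
    shifts-ext X ub [] e = e X []
    shifts-ext X ub (Y ∷ s) e with record? X ub Y
    ... | false = shifts-ext X ub s (λ h t → e h (Y ∷ t))
    ... | true  = shifts-ext X (just Y) s (λ h t → cong₂ _+_ (e h (Y ∷ t)) (e Y (h ∷ t)))

    shifts-0 : ∀ X ub s → sumShifts X ub s (λ _ _ → 0) ≡ 0
    shifts-0 X ub [] = ≡.refl
    shifts-0 X ub (Y ∷ s) with record? X ub Y
    ... | false = shifts-0 X ub s
    ... | true  = shifts-0 X (just Y) s

    shifts-+ : ∀ X ub s G G' →
      sumShifts X ub s (λ h t → G h t + G' h t) ≡ sumShifts X ub s G + sumShifts X ub s G'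
    shifts-+ X ub [] G G' = ≡.refl
    shifts-+ X ub (Y ∷ s) G G' with record? X ub Y
    ... | false = shifts-+ X ub s _ _
    ... | true  = ≡.trans (shifts-ext X (just Y) s (λ h t → +-swap-middle (G h (Y ∷ t)) _ _ _))
                        (shifts-+ X (just Y) s _ _)

    shifts-* : ∀ c X ub s G → sumShifts X ub s (λ h t → c * G h t) ≡ c * sumShifts X ub s G
    shifts-* c X ub [] G = ≡.refl
    shifts-* c X ub (Y ∷ s) G with record? X ub Y
    ... | false = shifts-* c X ub s _
    ... | true  = ≡.trans (shifts-ext X (just Y) s (λ h t → sym (*-distribˡ-+ c (G h (Y ∷ t)) _)))
                        (shifts-* c X (just Y) s _)

    shifts-ext-length : ∀ X ub s {G G'} → (∀ h t → length t ≡ length s → G h t ≡ G' h t) →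
      sumShifts X ub s G ≡ sumShifts X ub s G'
    shifts-ext-length X ub [] e = e X [] ≡.refl
    shifts-ext-length X ub (Y ∷ s) e with record? X ub Y
    ... | false = shifts-ext-length X ub s (λ h t p → e h (Y ∷ t) (cong suc p))
    ... | true  = shifts-ext-length X (just Y) s
      (λ h t p → cong₂ _+_ (e h (Y ∷ t) (cong suc p)) (e Y (h ∷ t) (cong suc p)))

  shifts-linear : ∀ X ub s → Linear (λ G → sumShifts X ub s (λ h t → G (h , t)))
  shifts-linear X ub s = record
    { null  = shifts-0 X ub s
    ; plus  = λ G G' → shifts-+ X ub s _ _
    ; times = λ c G → shifts-* c X ub s _
    }

  opaque
    atDescent : (List ℕ → ℕ) → List ℕ → ℕ
    atDescent G (x ∷ y ∷ t) = if lt y x then G (x ∷ y ∷ t) + G (y ∷ x ∷ t) else 0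
    atDescent G _           = 0

    atDescent-yes : ∀ {G x y} t → lt y x ≡ true → atDescent G (x ∷ y ∷ t) ≡ G (x ∷ y ∷ t) + G (y ∷ x ∷ t)
    atDescent-yes t e rewrite e = ≡.refl

    atDescent-no : ∀ {G x y} t → lt y x ≡ false → atDescent G (x ∷ y ∷ t) ≡ 0
    atDescent-no t e rewrite e = ≡.refl

    atDescent-[] : ∀ {G} → atDescent G [] ≡ 0
    atDescent-[] = ≡.refl

    atDescent-[-] : ∀ {G} x → atDescent G (x ∷ []) ≡ 0
    atDescent-[-] x = ≡.refl

    atDescent-cong : ∀ {G G'} l → (∀ q → q ↭ l → G q ≡ G' q) → atDescent G l ≡ atDescent G' l
    atDescent-cong []          e = ≡.refl
    atDescent-cong (x ∷ [])    e = ≡.refl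
    atDescent-cong (x ∷ y ∷ t) e with lt y x
    ... | false = ≡.refl
    ... | true  = cong₂ _+_ (e _ ↭-refl) (e _ (swap y x ↭-refl))

    atDescent-+ : ∀ G G' l → atDescent (λ u → G u + G' u) l ≡ atDescent G l + atDescent G' l
    atDescent-+ G G' []          = ≡.refl
    atDescent-+ G G' (x ∷ [])    = ≡.refl
    atDescent-+ G G' (x ∷ y ∷ t) with lt y x
    ... | false = ≡.refl
    ... | true  = +-swap-middle (G (x ∷ y ∷ t)) _ _ _

    atDescent-linear : ∀ {I} {Φ : (I → ℕ) → ℕ} → Linear Φ → ∀ (G : List ℕ → I → ℕ) l →
      Φ (λ i → atDescent (λ u → G u i) l) ≡ atDescent (λ u → Φ (G u)) l
    atDescent-linear lin G []          = Linear.null lin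
    atDescent-linear lin G (x ∷ [])    = Linear.null lin
    atDescent-linear lin G (x ∷ y ∷ t) with lt y x
    ... | false = Linear.null lin
    ... | true  = Linear.plus lin _ _

  descents : (ℕ → ℕ) → (List ℕ → ℕ) → List ℕ → ℕ
  descents w G []      = 0
  descents w G (x ∷ t) = w 0 * atDescent G (x ∷ t) + descents (w ∘ suc) (λ u → G (x ∷ u)) t

  descents-cong : ∀ w {G G'} l → (∀ q → q ↭ l → G q ≡ G' q) → descents w G l ≡ descents w G' l
  descents-cong w []      e = ≡.refl
  descents-cong w (x ∷ t) e = cong₂ _+_ (cong (w 0 *_) (atDescent-cong (x ∷ t) e))
    (descents-cong (w ∘ suc) t (λ q q↭t → e (x ∷ q) (prep x q↭t)))

  descents-weights : ∀ {w w'} G l → (∀ k → w k ≡ w' k) → descents w G l ≡ descents w' G l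
  descents-weights G []      e = ≡.refl
  descents-weights G (x ∷ t) e = cong₂ _+_ (cong (_* atDescent G (x ∷ t)) (e 0))
    (descents-weights _ t (e ∘ suc))

  descents-+ : ∀ w G G' l → descents w (λ u → G u + G' u) l ≡ descents w G l + descents w G' l
  descents-+ w G G' []      = ≡.refl
  descents-+ w G G' (x ∷ t) = ≡.trans
    (cong₂ _+_ (≡.trans (cong (w 0 *_) (atDescent-+ G G' (x ∷ t))) (*-distribˡ-+ (w 0) _ _))
               (descents-+ (w ∘ suc) _ _ t))
    (+-swap-middle (w 0 * atDescent G (x ∷ t)) _ _ _)

  descents-linear : ∀ {I} {Φ : (I → ℕ) → ℕ} → Linear Φ → ∀ w (G : List ℕ → I → ℕ) l →
    Φ (λ i → descents w (λ u → G u i) l) ≡ descents w (λ u → Φ (G u)) l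
  descents-linear lin w G []      = Linear.null lin
  descents-linear lin w G (x ∷ l) = ≡.trans (Linear.plus lin _ _)
    (cong₂ _+_ (≡.trans (Linear.times lin (w 0) _) (cong (w 0 *_) (atDescent-linear lin G (x ∷ l))))
               (descents-linear lin (w ∘ suc) _ l))

  -- Exchanging two adjacent letters within the scanned word commutes with the shifts. At an ascent
  -- no shift can produce a descent in these two places; at a descent the shifts of both orders
  -- account for the same terms, though not subset by subset.
  shifts-atDescent : ∀ X ub s G → All (X ≢_) s → below X ub ≡ true →
    sumShifts X ub s (λ h t → atDescent (G h) t) ≡ atDescent (λ t → sumShifts X ub t G) s
  shifts-atDescent X ub []       G _ b = ≡.trans shifts-[] (≡.trans atDescent-[] (sym atDescent-[]))
  shifts-atDescent X ub (Y ∷ []) G _ b = ≡.trans (lhs _ ≡.refl) (sym (atDescent-[-] Y))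
    where
    lhs : ∀ r → record? X ub Y ≡ r → sumShifts X ub (Y ∷ []) (λ h t → atDescent (G h) t) ≡ 0
    lhs true  r = ≡.trans (shifts-record [] r) (≡.trans shifts-[] (cong₂ _+_ (atDescent-[-] Y) (atDescent-[-] X)))
    lhs false r = ≡.trans (shifts-skip [] r) (≡.trans shifts-[] (atDescent-[-] Y))
  shifts-atDescent X ub (Y ∷ Y' ∷ s) G (X≢Y ∷ X≢Y' ∷ _) b = by-cases _ ≡.refl _ ≡.refl
    where
    S : List ℕ → ℕ
    S t = sumShifts X ub t G
    S↓ : ℕ
    S↓ = sumShifts X ub (Y ∷ Y' ∷ s) (λ h t → atDescent (G h) t)

    ascent : lt Y' Y ≡ false → ∀ r → record? X ub Y ≡ r → ∀ r' → record? X ub Y' ≡ r' → S↓ ≡ 0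
    ascent Y≤Y' true r _ _ = let X<Y , _ = record?-true X ub Y r in
      ≡.trans (shifts-record (Y' ∷ s) r)
      (≡.trans (shifts-skip s (not-below-record? {X} (just Y) Y≤Y'))
      (≡.trans (shifts-cong X (just Y) s X<Y (λ h t h≥X h<Y → cong₂ _+_ (atDescent-no t Y≤Y')
          (atDescent-no t (≤-trans′ (lt-asym h<Y) Y≤Y'))))
        (shifts-0 X (just Y) s)))
    ascent Y≤Y' false r false r' = ≡.trans (shifts-skip (Y' ∷ s) r) (≡.trans (shifts-skip s r')
      (≡.trans (shifts-ext X ub s (λ h t → atDescent-no t Y≤Y')) (shifts-0 X ub s)))
    -- `Y` is below `ub` because `Y'` is, so it can fail to be a record only by not exceeding `X`;
    -- hence no head `h` is smaller than `Y`.
    ascent Y≤Y' false r true r' = let X<Y' , Y'<u = record?-true X ub Y' r' in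
      ≡.trans (shifts-skip (Y' ∷ s) r) (≡.trans (shifts-record s r')
      (≡.trans (shifts-cong X (just Y') s X<Y' (λ h t h≥X h<Y' → cong₂ _+_ (atDescent-no t Y≤Y')
          (atDescent-no t (h≮Y Y'<u h h≥X))))
        (shifts-0 X (just Y') s)))
      where
      below-≤ : ∀ ub → below Y' ub ≡ true → below Y ub ≡ true
      below-≤ nothing  _    = ≡.refl
      below-≤ (just u) Y'<u = ≤-lt-trans Y≤Y' Y'<u
      h≮Y : below Y' ub ≡ true → ∀ h → lt h X ≡ false → lt h Y ≡ false
      h≮Y Y'<u h h≥X = ≤-trans′ (record?-≮ ub r (below-≤ ub Y'<u)) h≥X

    descent : lt Y' Y ≡ true → ∀ r → record? X ub Y ≡ r → ∀ r' → record? X ub Y' ≡ r' →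
      ∀ b' → lt X Y' ≡ b' → S↓ ≡ S (Y ∷ Y' ∷ s) + S (Y' ∷ Y ∷ s)
    -- Both letters are records. The subset with `Y` but not `Y'` leaves the ascent `h < Y'` and
    -- contributes nothing on the left; its term arises from exchanging `Y'` and `h` for the subset
    -- that contains both.
    descent Y'<Y true r _ _ true X<Y' = let X<Y , Y<u = record?-true X ub Y r
                                            r″ = true-record? (just Y) X<Y' Y'<Y in
      ≡.trans (shifts-record (Y' ∷ s) r)
      (≡.trans (shifts-record s r″)
      (≡.trans (shifts-cong X (just Y') s X<Y' λ h t h≥X h<Y' → ≡.trans
          (cong₂ _+_ (cong₂ _+_ (atDescent-yes t Y'<Y) (atDescent-no t (lt-asym h<Y')))
                     (cong₂ _+_ (atDescent-yes t (lt-trans h<Y' Y'<Y)) (atDescent-yes t h<Y')))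
          (regroup (G h (Y ∷ Y' ∷ t)) _ (G Y' (Y ∷ h ∷ t)) _ (G Y (Y' ∷ h ∷ t)) _))
      (≡.trans (shifts-+ X (just Y') s _ _)
      (sym (cong₂ _+_
        (≡.trans (shifts-record (Y' ∷ s) r) (shifts-record s r″))
        (≡.trans (shifts-record (Y ∷ s) (true-record? ub X<Y' (below-trans ub Y'<Y Y<u)))
               (shifts-skip s (not-below-record? {X} (just Y') (lt-asym Y'<Y)))))))))
      where
      open +-*-Solver
      regroup : ∀ a b c d e f → ((a + b) + 0) + ((c + d) + (e + f)) ≡ ((a + f) + (c + e)) + (b + d)
      regroup = solve 6 (λ a b c d e f → ((a :+ b) :+ con 0) :+ ((c :+ d) :+ (e :+ f))
        := ((a :+ f) :+ (c :+ e)) :+ (b :+ d)) ≡.refl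
    descent Y'<Y true r _ _ false X≮Y' = let X<Y , Y<u = record?-true X ub Y r
                                             Y'<X = lt-connex X≢Y' X≮Y' in
      ≡.trans (shifts-record (Y' ∷ s) r)
      (≡.trans (shifts-skip s (≮-record? (just Y) X≮Y'))
      (≡.trans (shifts-cong X (just Y) s X<Y λ h t h≥X h<Y → ≡.trans
          (cong₂ _+_ (atDescent-yes t Y'<Y) (atDescent-yes t (<-≤-trans′ Y'<X h≥X)))
          (+-swap-middle (G h (Y ∷ Y' ∷ t)) _ _ _))
      (≡.trans (shifts-+ X (just Y) s _ _)
      (sym (cong₂ _+_ (≡.trans (shifts-record (Y' ∷ s) r) (shifts-skip s (≮-record? (just Y) X≮Y')))
        (≡.trans (shifts-skip (Y ∷ s) (≮-record? ub X≮Y')) (shifts-record s r)))))))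
    descent Y'<Y false r false r' _ _ =
      ≡.trans (shifts-skip (Y' ∷ s) r) (≡.trans (shifts-skip s r')
      (≡.trans (shifts-ext X ub s (λ h t → atDescent-yes t Y'<Y))
      (≡.trans (shifts-+ X ub s _ _)
      (sym (cong₂ _+_ (≡.trans (shifts-skip (Y' ∷ s) r) (shifts-skip s r'))
                      (≡.trans (shifts-skip (Y ∷ s) r') (shifts-skip s r)))))))
    descent Y'<Y false r true r' _ _ = let X<Y' , Y'<u = record?-true X ub Y' r' in
      ≡.trans (shifts-skip (Y' ∷ s) r) (≡.trans (shifts-record s r')
      (≡.trans (shifts-cong X (just Y') s X<Y' λ h t h≥X h<Y' → ≡.trans
          (cong₂ _+_ (atDescent-yes t Y'<Y) (atDescent-yes t (lt-trans h<Y' Y'<Y)))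
          (regroup (G h (Y ∷ Y' ∷ t)) _ _ _))
      (≡.trans (shifts-+ X (just Y') s _ _)
      (sym (cong₂ _+_ (≡.trans (shifts-skip (Y' ∷ s) r) (shifts-record s r'))
        (≡.trans (shifts-record (Y ∷ s) r')
               (shifts-skip s (not-below-record? {X} (just Y') (lt-asym Y'<Y)))))))))
      where
      regroup : ∀ a b c d → (a + b) + (c + d) ≡ (a + c) + (b + d)
      regroup = +-swap-middle

    by-cases : ∀ c → lt Y' Y ≡ c → ∀ b' → lt X Y' ≡ b' → S↓ ≡ atDescent S (Y ∷ Y' ∷ s)
    by-cases false Y≤Y' _ _ = ≡.trans (ascent Y≤Y' _ ≡.refl _ ≡.refl) (sym (atDescent-no s Y≤Y'))
    by-cases true Y'<Y _ e  = ≡.trans (descent Y'<Y _ ≡.refl _ ≡.refl _ e) (sym (atDescent-yes s Y'<Y))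

  shifts-descents : ∀ X ub s w G → All (X ≢_) s → below X ub ≡ true →
    sumShifts X ub s (λ h t → descents w (G h) t) ≡ descents w (λ t → sumShifts X ub t G) s
  shifts-descents X ub [] w G _ b = shifts-[]
  shifts-descents X ub (Y ∷ s) w G X≢Ys@(_ ∷ X≢s) b = ≡.trans split
    (≡.trans (shifts-+ X ub (Y ∷ s) _ _)
    (cong₂ _+_ (≡.trans (shifts-* (w 0) X ub (Y ∷ s) _)
                      (cong (w 0 *_) (shifts-atDescent X ub (Y ∷ s) G X≢Ys b)))
               rest))
    where
    inner : (ℕ → List ℕ → ℕ) → ℕ → List ℕ → ℕ
    inner K h []      = 0
    inner K h (y ∷ t) = descents (w ∘ suc) (λ u → K h (y ∷ u)) t
    split-at : ∀ h t → descents w (G h) t ≡ w 0 * atDescent (G h) t + inner G h t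
    split-at h []      = sym (≡.trans (+-identityʳ _) (≡.trans (cong (w 0 *_) atDescent-[]) (*-zeroʳ (w 0))))
    split-at h (y ∷ t) = ≡.refl
    split : sumShifts X ub (Y ∷ s) (λ h t → descents w (G h) t)
      ≡ sumShifts X ub (Y ∷ s) (λ h t → w 0 * atDescent (G h) t + inner G h t)
    split = shifts-ext X ub (Y ∷ s) split-at
    rest : sumShifts X ub (Y ∷ s) (inner G) ≡ descents (w ∘ suc) (λ u → sumShifts X ub (Y ∷ u) G) s
    rest = by-cases _ ≡.refl
      where
      by-cases : ∀ r → record? X ub Y ≡ r →
        sumShifts X ub (Y ∷ s) (inner G) ≡ descents (w ∘ suc) (λ u → sumShifts X ub (Y ∷ u) G) s
      by-cases false r = ≡.trans (shifts-skip s r) (≡.trans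
        (shifts-descents X ub s (w ∘ suc) (λ h u → G h (Y ∷ u)) X≢s b)
        (descents-cong (w ∘ suc) s (λ u _ → sym (shifts-skip u r))))
      by-cases true r = ≡.trans (shifts-record s r) (≡.trans (shifts-ext X (just Y) s
          (λ h t → sym (descents-+ (w ∘ suc) (λ u → G h (Y ∷ u)) (λ u → G Y (h ∷ u)) t)))
        (≡.trans (shifts-descents X (just Y) s (w ∘ suc) (λ h u → G h (Y ∷ u) + G Y (h ∷ u)) X≢s
          (proj₁ (record?-true X ub Y r)))
        (descents-cong (w ∘ suc) s (λ u _ → sym (shifts-record u r)))))

  -- Choosing `Z` gives the descent from `Z` to `h`, not choosing it gives the ascent from `h` to
  -- `Z`, and exchanging these two letters turns one into the other. The descent terms therefore run
  -- through every shift exactly once.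
  shifts-head-ascent : ∀ X ub Z s K → record? X ub Z ≡ true →
    sumShifts X ub (Z ∷ s) (λ h t → atDescent K (h ∷ t)) ≡ sumShifts X ub (Z ∷ s) (λ h t → K (h ∷ t))
  shifts-head-ascent X ub Z s K r = let X<Z , Z<u = record?-true X ub Z r in ≡.trans (shifts-record s r)
    (≡.trans (shifts-cong X (just Z) s X<Z (λ h t h≥X h<Z → ≡.trans
        (cong₂ _+_ (atDescent-no t (lt-asym h<Z)) (atDescent-yes t h<Z))
        (+-comm (K (Z ∷ h ∷ t)) _)))
    (sym (shifts-record s r)))

  -- `Z` is never chosen and lies below every head, so the boundary is a descent in every shift.
  shifts-head-descent : ∀ X ub Z s K → lt Z X ≡ true → below X ub ≡ true →
    sumShifts X ub (Z ∷ s) (λ h t → atDescent K (h ∷ t))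
    ≡ sumShifts X ub (Z ∷ s) (λ h t → K (h ∷ t)) + sumShifts X ub s (λ h t → K (Z ∷ h ∷ t))
  shifts-head-descent X ub Z s K Z<X b = ≡.trans (shifts-skip s skip)
    (≡.trans (shifts-cong X ub s b (λ h t h≥X _ → atDescent-yes t (<-≤-trans′ Z<X h≥X)))
    (≡.trans (shifts-+ X ub s _ _) (cong₂ _+_ (sym (shifts-skip s skip)) ≡.refl)))
    where
    skip : record? X ub Z ≡ false
    skip = ≮-record? {X} {Z} ub (lt-asym Z<X)

  -- The head is `X` or the largest chosen letter, so `h < y` restricts the choice to letters below
  -- `y`. A record for the bound `y` is also a record for `ub`, as the earlier letters that are not
  -- below `y` are larger anyway.
  shifts-restrict : ∀ X ub s y g → lt X y ≡ true → (∀ {z} → lt z y ≡ true → below z ub ≡ true) →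
    sumShifts X ub s (λ h t → if lt h y then g h t else 0) ≡ sumShifts X (just y) s g
  shifts-restrict X ub [] y g X<y y≤u = ≡.trans shifts-[]
    (≡.trans (cong (λ b → if b then g X [] else 0) X<y) (sym shifts-[]))
  shifts-restrict X ub (Z ∷ s) y g X<y y≤u = by-cases _ ≡.refl _ ≡.refl
    where
    g' : ℕ → List ℕ → ℕ
    g' h t = if lt h y then g h t else 0
    by-cases : ∀ r → record? X ub Z ≡ r → ∀ b → lt Z y ≡ b →
      sumShifts X ub (Z ∷ s) g' ≡ sumShifts X (just y) (Z ∷ s) g
    by-cases true r true Z<y = let X<Z , Z<u = record?-true X ub Z r in ≡.trans (shifts-record s r)
      (≡.trans (shifts-cong X (just Z) s X<Z (λ h t _ h<Z → cong₂ _+_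
        (cong (λ b → if b then g h (Z ∷ t) else 0) (lt-trans h<Z Z<y))
        (cong (λ b → if b then g Z (h ∷ t) else 0) Z<y)))
      (sym (shifts-record s (true-record? (just y) X<Z Z<y))))
    by-cases true r false Z≮y = let X<Z , Z<u = record?-true X ub Z r in ≡.trans (shifts-record s r)
      (≡.trans (shifts-ext X (just Z) s (λ h t → ≡.trans
        (cong (g' h (Z ∷ t) +_) (cong (λ b → if b then g Z (h ∷ t) else 0) Z≮y)) (+-identityʳ _)))
      (≡.trans (shifts-restrict X (just Z) s y (λ h t → g h (Z ∷ t)) X<y (λ z<y → <-≤-trans′ z<y Z≮y))
      (sym (shifts-skip s (not-below-record? {X} (just y) Z≮y)))))
    by-cases false r true Z<y = ≡.trans (shifts-skip s r)
      (≡.trans (shifts-restrict X ub s y _ X<y y≤u) (sym (shifts-skip s (≮-record? (just y) X≮Z))))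
      where
      X≮Z : lt X Z ≡ false
      X≮Z = record?-≮ ub r (y≤u Z<y)
    by-cases false r false Z≮y = ≡.trans (shifts-skip s r)
      (≡.trans (shifts-restrict X ub s y _ X<y y≤u) (sym (shifts-skip s (not-below-record? {X} (just y) Z≮y))))

  shifts-restrict-0 : ∀ X ub s y (g : ℕ → List ℕ → ℕ) → lt X y ≡ false → below X ub ≡ true →
    sumShifts X ub s (λ h t → if lt h y then g h t else 0) ≡ 0
  shifts-restrict-0 X ub s y g X≮y b = ≡.trans
    (shifts-cong X ub s b (λ h t h≥X _ → cong (λ b → if b then g h t else 0) (≤-trans′ X≮y h≥X)))
    (shifts-0 X ub s)

  sorted : List ℕ → Bool
  sorted (x ∷ y ∷ l) = not (lt y x) ∧ sorted (y ∷ l)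
  sorted _           = true

  sorted-∷⁻ : ∀ x l → sorted (x ∷ l) ≡ true → sorted l ≡ true
  sorted-∷⁻ x []      _ = ≡.refl
  sorted-∷⁻ x (y ∷ l) p with lt y x
  ... | false = p

  sorted-head : ∀ x y l → sorted (x ∷ y ∷ l) ≡ true → lt y x ≡ false
  sorted-head x y l p with lt y x
  ... | false = ≡.refl

  sorted-∷⁺ : ∀ x y l → lt y x ≡ false → sorted (y ∷ l) ≡ true → sorted (x ∷ y ∷ l) ≡ true
  sorted-∷⁺ x y l e p rewrite e = p

  sorted-drop : ∀ x y l → sorted (x ∷ y ∷ l) ≡ true → sorted (x ∷ l) ≡ true
  sorted-drop x y []      _ = ≡.refl
  sorted-drop x y (z ∷ l) p = let q = sorted-∷⁻ x (y ∷ z ∷ l) p in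
    sorted-∷⁺ x z l (≤-trans′ (sorted-head x y (z ∷ l) p) (sorted-head y z l q)) (sorted-∷⁻ y (z ∷ l) q)

  -- A chosen record stands in front of a smaller letter, so only the empty choice can leave a
  -- sorted word. This serves the words of length 0, where only the identity counts.
  shifts-sorted : ∀ X ub s G → below X ub ≡ true →
    (∀ h t → sorted (h ∷ t) ≡ false → G h t ≡ 0) → sumShifts X ub s G ≡ G X s
  shifts-sorted X ub [] G b G≡0 = shifts-[]
  shifts-sorted X ub (Y ∷ s) G b G≡0 = by-cases _ ≡.refl
    where
    unsorted : ∀ h t → sorted (h ∷ t) ≡ false → sorted (h ∷ Y ∷ t) ≡ false
    unsorted h t e with sorted (h ∷ Y ∷ t) in e'
    ... | false = ≡.refl
    ... | true  = true≢false (sorted-drop h Y t e') e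
    desc-unsorted : ∀ h t → lt h Y ≡ true → sorted (Y ∷ h ∷ t) ≡ false
    desc-unsorted h t e rewrite e = ≡.refl
    by-cases : ∀ r → record? X ub Y ≡ r → sumShifts X ub (Y ∷ s) G ≡ G X (Y ∷ s)
    by-cases false r = ≡.trans (shifts-skip s r)
      (shifts-sorted X ub s _ b (λ h t e → G≡0 h (Y ∷ t) (unsorted h t e)))
    by-cases true r = let X<Y , _ = record?-true X ub Y r in ≡.trans (shifts-record s r)
      (≡.trans (shifts-cong X (just Y) s X<Y (λ h t _ h<Y →
        ≡.trans (cong (G h (Y ∷ t) +_) (G≡0 Y (h ∷ t) (desc-unsorted h t h<Y))) (+-identityʳ _)))
      (shifts-sorted X (just Y) s (λ h t → G h (Y ∷ t)) X<Y (λ h t e → G≡0 h (Y ∷ t) (unsorted h t e))))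

  shifts-skip-all : ∀ {X ub G} s → All (λ Y → record? X ub Y ≡ false) s → sumShifts X ub s G ≡ G X s
  shifts-skip-all []      []       = shifts-[]
  shifts-skip-all (Y ∷ s) (r ∷ rs) = ≡.trans (shifts-skip s r) (shifts-skip-all s rs)

  shifts-skip-++ : ∀ {X ub G} s s' → All (λ Y → record? X ub Y ≡ false) s →
    sumShifts X ub (s ++ s') G ≡ sumShifts X ub s' (λ h t → G h (s ++ t))
  shifts-skip-++ []      s' []       = ≡.refl
  shifts-skip-++ (Y ∷ s) s' (r ∷ rs) = ≡.trans (shifts-skip (s ++ s') r) (shifts-skip-++ s s' rs)

  shifts-single : ∀ {X G} s Y s' → All (λ Z → record? X nothing Z ≡ false) s →
    record? X nothing Y ≡ true → All (λ Z → record? X (just Y) Z ≡ false) s' →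
    sumShifts X nothing (s ++ Y ∷ s') G ≡ G X (s ++ Y ∷ s') + G Y (s ++ X ∷ s')
  shifts-single s Y s' rs r rs' = ≡.trans (shifts-skip-++ s (Y ∷ s') rs)
    (≡.trans (shifts-record s' r) (shifts-skip-all s' rs'))

<ᵇ-true⇒< : ∀ {a b} → (a <ᵇ b) ≡ true → a < b
<ᵇ-true⇒< {a} {b} e = <ᵇ⇒< a b (subst Bool.T (sym e) tt)

<⇒<ᵇ-true : ∀ {a b} → a < b → (a <ᵇ b) ≡ true
<⇒<ᵇ-true {a} {b} a<b with a <ᵇ b | <⇒<ᵇ a<b
... | true | _ = ≡.refl

≥⇒<ᵇ-false : ∀ {a b} → b ≤ a → (a <ᵇ b) ≡ false
≥⇒<ᵇ-false {a} {b} b≤a with a <ᵇ b in e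
... | false = ≡.refl
... | true  = ⊥-elim (<⇒≱ (<ᵇ-true⇒< e) b≤a)

<ᵇ-false⇒≥ : ∀ {a b} → (a <ᵇ b) ≡ false → b ≤ a
<ᵇ-false⇒≥ {a} {b} e = ≮⇒≥ (λ a<b → true≢false (<⇒<ᵇ-true a<b) e)

<ᵇ-trans : ∀ a b c → (a <ᵇ b) ≡ true → (b <ᵇ c) ≡ true → (a <ᵇ c) ≡ true
<ᵇ-trans a b c p q = <⇒<ᵇ-true (<-trans (<ᵇ-true⇒< {a} {b} p) (<ᵇ-true⇒< {b} {c} q))

<ᵇ-asym : ∀ a b → (a <ᵇ b) ≡ true → (b <ᵇ a) ≡ false
<ᵇ-asym a b p = ≥⇒<ᵇ-false (<⇒≤ (<ᵇ-true⇒< {a} {b} p))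

<ᵇ-connex : ∀ a b → a ≢ b → (a <ᵇ b) ≡ false → (b <ᵇ a) ≡ true
<ᵇ-connex a b a≢b p = <⇒<ᵇ-true (≤∧≢⇒< (<ᵇ-false⇒≥ p) (a≢b ∘ sym))

>ᵇ-trans : ∀ a b c → (b <ᵇ a) ≡ true → (c <ᵇ b) ≡ true → (c <ᵇ a) ≡ true
>ᵇ-trans a b c p q = <ᵇ-trans c b a q p

>ᵇ-asym : ∀ a b → (b <ᵇ a) ≡ true → (a <ᵇ b) ≡ false
>ᵇ-asym a b = <ᵇ-asym b a

>ᵇ-connex : ∀ a b → a ≢ b → (b <ᵇ a) ≡ false → (a <ᵇ b) ≡ true
>ᵇ-connex a b a≢b = <ᵇ-connex b a (a≢b ∘ sym)

-- Read to the left of a position, from the nearest letter outwards, a word is compared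
-- in the opposite order.
module Right = StrictOrder _<ᵇ_ <ᵇ-trans <ᵇ-asym <ᵇ-connex
module Left = StrictOrder (flip _<ᵇ_) >ᵇ-trans >ᵇ-asym >ᵇ-connex

-- The sum of w i₁ ⋯ w i_L over the 0-Hecke words of length L of the permutation l in
-- one-line notation, where the letters are counted from 0.
heckeSum : (ℕ → ℕ) → ℕ → List ℕ → ℕ
heckeSum w zero    l = if Right.sorted l then 1 else 0
heckeSum w (suc L) l = Right.descents w (heckeSum w L) l

opaque
  unfolding StrictOrder.atDescent

  atDescent-reverse : ∀ (G : List ℕ → ℕ) h y q s →
    Left.atDescent (λ u → G (u ʳ++ s)) (h ∷ y ∷ q) ≡ Right.atDescent (λ u → G (q ʳ++ u)) (y ∷ h ∷ s)
  atDescent-reverse G h y q s = ≡.refl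

  Right-atDescent-if : ∀ (G : List ℕ → ℕ) x y t →
    Right.atDescent G (x ∷ y ∷ t) ≡ (if y <ᵇ x then G (x ∷ y ∷ t) + G (y ∷ x ∷ t) else 0)
  Right-atDescent-if G x y t = ≡.refl

-- Places to the left of `h` are counted outwards from `h`, so the weights on that side run
-- backwards. The descent between `h` and the letter before it is assigned to the left part.
descents-ʳ++ : ∀ w G p h t → Right.descents w G (p ʳ++ (h ∷ t))
  ≡ Left.descents (λ k → w (length p ∸ suc k)) (λ q → G (q ʳ++ t)) (h ∷ p)
    + Right.descents (λ k → w (length p + k)) (λ u → G (p ʳ++ u)) (h ∷ t)
descents-ʳ++ w G [] h t = cong (_+ Right.descents w G (h ∷ t))
  (sym (≡.trans (+-identityʳ _) (≡.trans (cong (w 0 *_) (Left.atDescent-[-] h)) (*-zeroʳ (w 0)))))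
descents-ʳ++ w G (y ∷ p) h t = begin
  Right.descents w G (p ʳ++ (y ∷ h ∷ t))
    ≡⟨ descents-ʳ++ w G p y (h ∷ t) ⟩
  l + (w (n + 0) * a + Right.descents (λ k → w (n + suc k)) (λ u → G ((y ∷ p) ʳ++ u)) (h ∷ t))
    ≡⟨ cong (l +_) (cong₂ _+_ (cong₂ _*_ (cong w (+-identityʳ n)) (sym (atDescent-reverse G h y p t)))
         (Right.descents-weights _ (h ∷ t) (λ k → cong w (+-suc n k)))) ⟩
  l + (w n * a' + r)
    ≡⟨ rearrange l (w n * a') r ⟩
  (w n * a' + l) + r ∎
  where
  open ≡-Reasoning
  n = length p
  l = Left.descents (λ k → w (n ∸ suc k)) (λ q → G (q ʳ++ (h ∷ t))) (y ∷ p)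
  a = Right.atDescent (λ u → G (p ʳ++ u)) (y ∷ h ∷ t)
  a' = Left.atDescent (λ u → G (u ʳ++ t)) (h ∷ y ∷ p)
  r = Right.descents (λ k → w (suc n + k)) (λ u → G ((y ∷ p) ʳ++ u)) (h ∷ t)
  rearrange : ∀ a b c → a + (b + c) ≡ (b + a) + c
  rearrange a b c = ≡.trans (sym (+-assoc a b c)) (cong (_+ c) (+-comm a b))

sorted-ʳ++⁻ʳ : ∀ p l → Right.sorted (p ʳ++ l) ≡ true → Right.sorted l ≡ true
sorted-ʳ++⁻ʳ []      l e = e
sorted-ʳ++⁻ʳ (y ∷ p) l e = Right.sorted-∷⁻ y l (sorted-ʳ++⁻ʳ p (y ∷ l) e)

sorted-ʳ++⁻ˡ : ∀ p l → Right.sorted (p ʳ++ l) ≡ true → Left.sorted p ≡ true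
sorted-ʳ++⁻ˡ []           l e = ≡.refl
sorted-ʳ++⁻ˡ (y ∷ [])     l e = ≡.refl
sorted-ʳ++⁻ˡ (y ∷ y' ∷ p) l e = Left.sorted-∷⁺ y y' p
  (Right.sorted-head y' y l (sorted-ʳ++⁻ʳ p (y' ∷ y ∷ l) e)) (sorted-ʳ++⁻ˡ (y' ∷ p) (y ∷ l) e)

-- Both sums run over chains that go up in the strong Bruhat order. The names refer to the letter
-- between `p` and `s`, which rises in the first sum and falls in the second.
shiftsUp shiftsDown : (List ℕ → ℕ) → List ℕ → ℕ → List ℕ → ℕ
shiftsUp   G p X s = Right.sumShifts X nothing s (λ h t → G (p ʳ++ (h ∷ t)))
shiftsDown G p X s = Left.sumShifts X nothing p (λ h q → G (q ʳ++ (h ∷ s)))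

private
  F : ℕ → List ℕ → ℕ
  F = heckeSum suc

Monk : ℕ → List ℕ → ℕ → List ℕ → Set
Monk L p X s = shiftsUp (F L) p X s ≡ timesExp (λ k → shiftsDown (F k) p X s) L

monk-zero : ∀ p X s → Monk 0 p X s
monk-zero p X s = ≡.trans
  (Right.shifts-sorted X nothing s _ ≡.refl (λ h t e → unsorted (p ʳ++ (h ∷ t))
    (λ e' → true≢false (sorted-ʳ++⁻ʳ p (h ∷ t) e') e)))
  (sym (Left.shifts-sorted X nothing p _ ≡.refl (λ h q e → unsorted (q ʳ++ (h ∷ s))
    (λ e' → true≢false (sorted-ʳ++⁻ˡ (h ∷ q) s e') e))))
  where
  unsorted : ∀ l → (Right.sorted l ≡ true → F 0 l ≡ 0) → F 0 l ≡ 0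
  unsorted l k with Right.sorted l
  ... | false = ≡.refl
  ... | true  = k ≡.refl

-- For `X < y` the boundary descents in the first sum are the shifts with head below `y`. With both
-- orders of `y` and the head they make up the shifts over `y ∷ s`, and Monk's rule with `y` on the
-- other side applies. For `y < X` there are no such descents, and on the right-hand side `y` is a
-- record, so that the boundary terms add up to all shifts.
monk-boundary-left : ∀ L p y X s → y ≢ X → Monk L (y ∷ p) X s → Monk L p X (y ∷ s) →
  Right.sumShifts X nothing s (λ h t → Left.atDescent (λ u → F L (u ʳ++ t)) (h ∷ y ∷ p))
    + timesExp (λ k → shiftsDown (F k) (y ∷ p) X s) L
  ≡ timesExp (λ k → Left.sumShifts X nothing (y ∷ p) (λ h q → Left.atDescent (λ u → F k (u ʳ++ s)) (h ∷ q))) L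
monk-boundary-left L p y X s y≢X here′ there′ = by-cases _ ≡.refl
  where
  G : ℕ → List ℕ → ℕ
  G h t = F L (p ʳ++ (y ∷ h ∷ t)) + F L (p ʳ++ (h ∷ y ∷ t))
  up : Right.sumShifts X nothing s (λ h t → Left.atDescent (λ u → F L (u ʳ++ t)) (h ∷ y ∷ p))
     ≡ Right.sumShifts X nothing s (λ h t → if h <ᵇ y then G h t else 0)
  up = Right.shifts-ext X nothing s (λ h t →
    ≡.trans (atDescent-reverse (F L) h y p t) (Right-atDescent-if _ y h t))
  by-cases : ∀ b → (X <ᵇ y) ≡ b →
    Right.sumShifts X nothing s (λ h t → Left.atDescent (λ u → F L (u ʳ++ t)) (h ∷ y ∷ p))
      + timesExp (λ k → shiftsDown (F k) (y ∷ p) X s) L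
    ≡ timesExp (λ k → Left.sumShifts X nothing (y ∷ p) (λ h q → Left.atDescent (λ u → F k (u ʳ++ s)) (h ∷ q))) L
  by-cases true X<y = begin
    _ ≡⟨ cong₂ _+_ (≡.trans up (Right.shifts-restrict X nothing s y G X<y (λ _ → ≡.refl))) ≡.refl ⟩
    Right.sumShifts X (just y) s G + Dn
      ≡⟨ cong (_+ Dn) (Right.shifts-ext X (just y) s (λ h t → +-comm (F L (p ʳ++ (y ∷ h ∷ t))) _)) ⟩
    Right.sumShifts X (just y) s (λ h t → F L (p ʳ++ (h ∷ y ∷ t)) + F L (p ʳ++ (y ∷ h ∷ t))) + Dn
      ≡⟨ cong (_+ Dn) (Right.shifts-record s (Right.true-record? {X} {y} nothing X<y ≡.refl)) ⟨
    shiftsUp (F L) p X (y ∷ s) + Dn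
      ≡⟨ cong (_+ Dn) there′ ⟩
    timesExp (λ k → shiftsDown (F k) p X (y ∷ s)) L + Dn
      ≡⟨ +-comm _ Dn ⟩
    Dn + timesExp (λ k → shiftsDown (F k) p X (y ∷ s)) L
      ≡⟨ timesExp-+ _ _ L ⟨
    timesExp (λ k → shiftsDown (F k) (y ∷ p) X s + shiftsDown (F k) p X (y ∷ s)) L
      ≡⟨ timesExp-cong (λ k → Left.shifts-head-descent X nothing y p (λ u → F k (u ʳ++ s)) X<y ≡.refl) L ⟨
    _ ∎
    where
    open ≡-Reasoning
    Dn = timesExp (λ k → shiftsDown (F k) (y ∷ p) X s) L
  by-cases false X≮y = ≡.trans
    (cong₂ _+_ (≡.trans up (Right.shifts-restrict-0 X nothing s y G X≮y ≡.refl)) ≡.refl)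
    (timesExp-cong (λ k → sym (Left.shifts-head-ascent X nothing y p (λ u → F k (u ʳ++ s))
      (Left.true-record? {X} {y} nothing (<ᵇ-connex X y (y≢X ∘ sym) X≮y) ≡.refl))) L)

-- This mirrors the left boundary, with the excess on the other side of the equation. The second
-- instance of Monk's rule is requested for `z < X` only: moving `z` to the left must not take away
-- the only letter larger than `X`.
monk-boundary-right : ∀ L p X z s → z ≢ X → Monk L p X (z ∷ s) → (z < X → Monk L (z ∷ p) X s) →
  Right.sumShifts X nothing (z ∷ s) (λ h t → Right.atDescent (λ u → F L (p ʳ++ u)) (h ∷ t))
  ≡ timesExp (λ k → Left.sumShifts X nothing p (λ h q → Right.atDescent (λ u → F k (q ʳ++ u)) (h ∷ z ∷ s))) L
    + timesExp (λ k → shiftsDown (F k) p X (z ∷ s)) L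
monk-boundary-right L p X z s z≢X here′ there′ = by-cases _ ≡.refl
  where
  G : ℕ → ℕ → List ℕ → ℕ
  G k h q = F k (q ʳ++ (h ∷ z ∷ s)) + F k (q ʳ++ (z ∷ h ∷ s))
  down : ∀ k → Left.sumShifts X nothing p (λ h q → Right.atDescent (λ u → F k (q ʳ++ u)) (h ∷ z ∷ s))
       ≡ Left.sumShifts X nothing p (λ h q → if z <ᵇ h then G k h q else 0)
  down k = Left.shifts-ext X nothing p (λ h q → Right-atDescent-if _ h z s)
  by-cases : ∀ b → (z <ᵇ X) ≡ b →
    Right.sumShifts X nothing (z ∷ s) (λ h t → Right.atDescent (λ u → F L (p ʳ++ u)) (h ∷ t))
    ≡ timesExp (λ k → Left.sumShifts X nothing p (λ h q → Right.atDescent (λ u → F k (q ʳ++ u)) (h ∷ z ∷ s))) L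
      + timesExp (λ k → shiftsDown (F k) p X (z ∷ s)) L
  by-cases true z<X = begin
    _ ≡⟨ Right.shifts-head-descent X nothing z s (λ u → F L (p ʳ++ u)) z<X ≡.refl ⟩
    shiftsUp (F L) p X (z ∷ s) + shiftsUp (F L) (z ∷ p) X s
      ≡⟨ cong₂ _+_ here′ (there′ (<ᵇ-true⇒< z<X)) ⟩
    timesExp (λ k → shiftsDown (F k) p X (z ∷ s)) L + timesExp (λ k → shiftsDown (F k) (z ∷ p) X s) L
      ≡⟨ +-comm (timesExp (λ k → shiftsDown (F k) p X (z ∷ s)) L) _ ⟩
    timesExp (λ k → shiftsDown (F k) (z ∷ p) X s) L + timesExp (λ k → shiftsDown (F k) p X (z ∷ s)) L
      ≡⟨ cong₂ _+_ (timesExp-cong (λ k → ≡.trans (down k) (≡.trans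
           (≡.trans (Left.shifts-restrict X nothing p z (G k) z<X (λ _ → ≡.refl))
             (Left.shifts-ext X (just z) p (λ h q → +-comm (F k (q ʳ++ (h ∷ z ∷ s))) _)))
           (sym (Left.shifts-record p (Left.true-record? {X} {z} nothing z<X ≡.refl))))) L) ≡.refl ⟨
    _ ∎
    where open ≡-Reasoning
  by-cases false z≮X = begin
    _ ≡⟨ Right.shifts-head-ascent X nothing z s (λ u → F L (p ʳ++ u))
           (Right.true-record? {X} {z} nothing (<ᵇ-connex z X z≢X z≮X) ≡.refl) ⟩
    shiftsUp (F L) p X (z ∷ s) ≡⟨ here′ ⟩
    timesExp (λ k → shiftsDown (F k) p X (z ∷ s)) L
      ≡⟨ cong₂ _+_ (≡.trans (timesExp-cong (λ k → ≡.trans (down k)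
           (Left.shifts-restrict-0 X nothing p z (G k) z≮X ≡.refl)) L) (timesExp-0 L)) ≡.refl ⟨
    _ ∎
    where open ≡-Reasoning

module Expand (m : ℕ) where
  leftPart leftBoundary rightBoundary rightPart : (List ℕ → ℕ) → List ℕ → ℕ → List ℕ → ℕ
  leftPart G q h t      = Left.descents (λ k → suc (m ∸ suc (suc k))) (λ u → G (u ʳ++ (h ∷ t))) q
  leftBoundary G q h t  = Left.atDescent (λ u → G (u ʳ++ t)) (h ∷ q)
  rightBoundary G q h t = Right.atDescent (λ u → G (q ʳ++ u)) (h ∷ t)
  rightPart G q h t     = Right.descents (λ k → suc (m + suc k)) (λ u → G (q ʳ++ (h ∷ u))) t

  expand : ∀ G q h t → length q ≡ m → Right.descents suc G (q ʳ++ (h ∷ t))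
    ≡ (m * leftBoundary G q h t + leftPart G q h t) + (suc m * rightBoundary G q h t + rightPart G q h t)
  expand G q h t ≡.refl = ≡.trans (descents-ʳ++ suc G q h t)
    (cong₂ _+_ (cong (_+ leftPart G q h t) (boundary q))
               (cong (λ n → suc n * rightBoundary G q h t + rightPart G q h t) (+-identityʳ (length q))))
    where
    -- For empty `q` the truncated difference gives the weight 1 instead of 0, but then there is no
    -- boundary descent.
    boundary : ∀ q → suc (length q ∸ 1) * Left.atDescent (λ u → G (u ʳ++ t)) (h ∷ q)
             ≡ length q * Left.atDescent (λ u → G (u ʳ++ t)) (h ∷ q)
    boundary []      = cong (1 *_) (Left.atDescent-[-] h)
    boundary (y ∷ q) = ≡.refl

-- K-theoretic Monk rule: in terms of the generating function F(w) = Σ F_L(w) t^L / L!,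
-- the sum over the upward chains w t_{rb₁} t_{rb₂} ⋯ with b's > r is eᵗ times the sum over the
-- upward chains with all other positions < r.  In the inductive step the two
-- boundary terms, at the descents r-1 and r, fail to match by multiples (r-1) and r
-- of the same quantity, and the excess is exactly the derivative of the factor eᵗ.
monk : ∀ L p X s → All (X ≢_) p → All (X ≢_) s → Any (X <_) s → Monk L p X s
monk zero    p X s X∉p X∉s X<s = monk-zero p X s
monk (suc L) p X s X∉p X∉s X<s = begin
  shiftsUp (F (suc L)) p X s
    ≡⟨ Right.shifts-ext X nothing s (λ h t → expand (F L) p h t ≡.refl) ⟩
  up (λ h t → (m * leftBoundary (F L) p h t + leftPart (F L) p h t)
            + (suc m * rightBoundary (F L) p h t + rightPart (F L) p h t))
    ≡⟨ linear4 (Right.shifts-linear X nothing s) m _ _ _ _ ⟩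
  (m * up (leftBoundary (F L) p) + up (leftPart (F L) p))
    + (suc m * up (rightBoundary (F L) p) + up (rightPart (F L) p))
    ≡⟨ cong₂ _+_ (cong (m * up (leftBoundary (F L) p) +_) leftPart≡)
                 (cong₂ (λ a b → suc m * a + b) (rightBoundary≡ s X∉s X<s) rightPart≡) ⟩
  (m * up (leftBoundary (F L) p) + E (λ k → down (λ h q → leftPart (F k) q h s)))
    + (suc m * (E (λ k → down (λ h q → rightBoundary (F k) q h s)) + D)
      + E (λ k → down (λ h q → rightPart (F k) q h s)))
    ≡⟨ regroup m (up (leftBoundary (F L) p)) _ (E (λ k → down (λ h q → rightBoundary (F k) q h s))) D _ ⟩
  D + ((m * (up (leftBoundary (F L) p) + D) + E (λ k → down (λ h q → leftPart (F k) q h s)))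
    + (suc m * E (λ k → down (λ h q → rightBoundary (F k) q h s))
      + E (λ k → down (λ h q → rightPart (F k) q h s))))
    ≡⟨ cong (D +_) (cong₂ _+_ (cong₂ _+_ (leftBoundary≡ p ≡.refl X∉p) ≡.refl) ≡.refl) ⟩
  D + ((m * E (λ k → down (λ h q → leftBoundary (F k) q h s)) + E (λ k → down (λ h q → leftPart (F k) q h s)))
    + (suc m * E (λ k → down (λ h q → rightBoundary (F k) q h s))
      + E (λ k → down (λ h q → rightPart (F k) q h s))))
    ≡⟨ cong (D +_) (linear4 (timesExp-linear L) m _ _ _ _) ⟨
  D + E (λ k → (m * down (λ h q → leftBoundary (F k) q h s) + down (λ h q → leftPart (F k) q h s))
             + (suc m * down (λ h q → rightBoundary (F k) q h s) + down (λ h q → rightPart (F k) q h s)))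
    ≡⟨ cong (D +_) (timesExp-cong (λ k → ≡.trans
         (Left.shifts-ext-length X nothing p (λ h q e → expand (F k) q h s e))
         (linear4 (Left.shifts-linear X nothing p) m _ _ _ _)) L) ⟨
  D + E (λ k → shiftsDown (F (suc k)) p X s) ∎
  where
  open ≡-Reasoning
  m = length p
  open Expand m
  E : (ℕ → ℕ) → ℕ
  E G = timesExp G L
  D : ℕ
  D = E (λ k → shiftsDown (F k) p X s)
  up down : (ℕ → List ℕ → ℕ) → ℕ
  up   G = Right.sumShifts X nothing s G
  down G = Left.sumShifts X nothing p G
  linear4 : ∀ {I} {Φ : (I → ℕ) → ℕ} → Linear Φ → ∀ m a b c d →
    Φ (λ i → (m * a i + b i) + (suc m * c i + d i)) ≡ (m * Φ a + Φ b) + (suc m * Φ c + Φ d)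
  linear4 lin m a b c d = ≡.trans (Linear.plus lin _ _) (cong₂ _+_
    (≡.trans (Linear.plus lin _ _) (cong₂ _+_ (Linear.times lin m a) ≡.refl))
    (≡.trans (Linear.plus lin _ _) (cong₂ _+_ (Linear.times lin (suc m) c) ≡.refl)))
  regroup : ∀ m a b c D e →
    (m * a + b) + (suc m * (c + D) + e) ≡ D + ((m * (a + D) + b) + (suc m * c + e))
  regroup = solve 6 (λ m a b c D e → (m :* a :+ b) :+ ((con 1 :+ m) :* (c :+ D) :+ e)
    := D :+ ((m :* (a :+ D) :+ b) :+ ((con 1 :+ m) :* c :+ e))) ≡.refl
    where open +-*-Solver
  leftPart≡ : up (leftPart (F L) p) ≡ E (λ k → down (λ h q → leftPart (F k) q h s))
  leftPart≡ = begin
    up (leftPart (F L) p)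
      ≡⟨ Left.descents-linear (Right.shifts-linear X nothing s) _ _ p ⟩
    Left.descents _ (λ q → shiftsUp (F L) q X s) p
      ≡⟨ Left.descents-cong _ p (λ q q↭p → monk L q X s (All-resp-↭ (↭-sym q↭p) X∉p) X∉s X<s) ⟩
    Left.descents _ (λ q → E (λ k → shiftsDown (F k) q X s)) p
      ≡⟨ Left.descents-linear (timesExp-linear L) _ _ p ⟨
    E (λ k → Left.descents _ (λ q → shiftsDown (F k) q X s) p)
      ≡⟨ timesExp-cong (λ k → Left.shifts-descents X nothing p _ _ X∉p ≡.refl) L ⟨
    _ ∎
  rightPart≡ : up (rightPart (F L) p) ≡ E (λ k → down (λ h q → rightPart (F k) q h s))
  rightPart≡ = begin
    up (rightPart (F L) p)
      ≡⟨ Right.shifts-descents X nothing s _ _ X∉s ≡.refl ⟩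
    Right.descents _ (λ t → shiftsUp (F L) p X t) s
      ≡⟨ Right.descents-cong _ s (λ t t↭s → monk L p X t X∉p (All-resp-↭ (↭-sym t↭s) X∉s) (Any-resp-↭ (↭-sym t↭s) X<s)) ⟩
    Right.descents _ (λ t → E (λ k → shiftsDown (F k) p X t)) s
      ≡⟨ Right.descents-linear (timesExp-linear L) _ _ s ⟨
    E (λ k → Right.descents _ (λ t → shiftsDown (F k) p X t) s)
      ≡⟨ timesExp-cong (λ k → Right.descents-linear (Left.shifts-linear X nothing p) _ _ s) L ⟨
    _ ∎
  rightBoundary≡ : ∀ s → All (X ≢_) s → Any (X <_) s →
    Right.sumShifts X nothing s (rightBoundary (F L) p)
    ≡ E (λ k → down (λ h q → rightBoundary (F k) q h s)) + E (λ k → shiftsDown (F k) p X s)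
  -- The larger letter guarantees that `s` is not empty; without a right neighbour of `X` nothing
  -- would produce the excess `D`.
  rightBoundary≡ (z ∷ s) X∉s@(X≢z ∷ X∉s') X<s = monk-boundary-right L p X z s (X≢z ∘ sym)
    (monk L p X (z ∷ s) X∉p X∉s X<s)
    (λ z<X → monk L (z ∷ p) X s (X≢z ∷ X∉p) X∉s' (tail z<X X<s))
    where
    tail : z < X → Any (X <_) (z ∷ s) → Any (X <_) s
    tail z<X (here X<z)  = ⊥-elim (<-asym z<X X<z)
    tail z<X (there X<s) = X<s
  -- The factor `length p'` belongs to the claim: for empty `p'` there is no left boundary, and
  -- without the factor the excess would remain unmatched.
  leftBoundary≡ : ∀ p' → p' ≡ p → All (X ≢_) p' →
    length p' * (up (leftBoundary (F L) p') + E (λ k → shiftsDown (F k) p' X s))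
    ≡ length p' * E (λ k → Left.sumShifts X nothing p' (λ h q → leftBoundary (F k) q h s))
  leftBoundary≡ []      _ _ = ≡.refl
  leftBoundary≡ (y ∷ p') e X∉p'@(X≢y ∷ X∉p″) = cong (suc (length p') *_)
    (monk-boundary-left L p' y X s (X≢y ∘ sym) (monk L (y ∷ p') X s X∉p' X∉s X<s)
      (monk L p' X (y ∷ s) X∉p″ (X≢y ∷ X∉s) (there X<s)))

-- Transitions of vexillary permutations

Unique-resp-↭ : ∀ {xs ys : List ℕ} → xs ↭ ys → Unique xs → Unique ys
Unique-resp-↭ p = ↭ₛ.Unique-resp-↭ (≡.setoid ℕ) (↭⇒↭ₛ p)

count : {A : Set} → (A → Bool) → List A → ℕ
count P xs = length (filterᵇ P xs)

module _ {A : Set} {P : A → Bool} where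

  count-yes : ∀ {x} xs → P x ≡ true → count P (x ∷ xs) ≡ suc (count P xs)
  count-yes xs e rewrite e = ≡.refl

  count-no : ∀ {x} xs → P x ≡ false → count P (x ∷ xs) ≡ count P xs
  count-no xs e rewrite e = ≡.refl

  count-++ : ∀ xs ys → count P (xs ++ ys) ≡ count P xs + count P ys
  count-++ []       ys = ≡.refl
  count-++ (x ∷ xs) ys with P x
  ... | true  = cong suc (count-++ xs ys)
  ... | false = count-++ xs ys

  count-∷ : ∀ x xs → count P (x ∷ xs) ≡ (if P x then 1 else 0) + count P xs
  count-∷ x xs with P x
  ... | true  = ≡.refl
  ... | false = ≡.refl

  count-↭ : ∀ {xs ys} → xs ↭ ys → count P xs ≡ count P ys
  count-↭ refl = ≡.refl
  count-↭ {x ∷ xs} {_ ∷ ys} (prep x p) = ≡.trans (count-∷ x xs)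
    (≡.trans (cong (_ +_) (count-↭ p)) (sym (count-∷ x ys)))
  count-↭ {x ∷ y ∷ xs} {_ ∷ _ ∷ ys} (swap x y p) = begin
    count P (x ∷ y ∷ xs)   ≡⟨ ≡.trans (count-∷ x (y ∷ xs)) (cong (bit x +_) (count-∷ y xs)) ⟩
    bit x + (bit y + count P xs) ≡⟨ cong (λ c → bit x + (bit y + c)) (count-↭ p) ⟩
    bit x + (bit y + count P ys) ≡⟨ +-assoc (bit x) (bit y) _ ⟨
    (bit x + bit y) + count P ys ≡⟨ cong (_+ count P ys) (+-comm (bit x) (bit y)) ⟩
    (bit y + bit x) + count P ys ≡⟨ +-assoc (bit y) (bit x) _ ⟩
    bit y + (bit x + count P ys) ≡⟨ ≡.trans (count-∷ y (x ∷ ys)) (cong (bit y +_) (count-∷ x ys)) ⟨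
    count P (y ∷ x ∷ ys)   ∎
    where
    open ≡-Reasoning
    bit : A → ℕ
    bit x = if P x then 1 else 0
  count-↭ (trans p q) = ≡.trans (count-↭ p) (count-↭ q)

  count-all : ∀ {xs} → All (λ x → P x ≡ true) xs → count P xs ≡ length xs
  count-all []       = ≡.refl
  count-all (e ∷ es) = ≡.trans (count-yes _ e) (cong suc (count-all es))

  count-none : ∀ {xs} → All (λ x → P x ≡ false) xs → count P xs ≡ 0
  count-none []       = ≡.refl
  count-none (e ∷ es) = ≡.trans (count-no _ e) (count-none es)

  count-∷-≥ : ∀ x xs → count P xs ≤ count P (x ∷ xs)
  count-∷-≥ x xs with P x
  ... | true  = n≤1+n _
  ... | false = ≤-refl

count-mono : ∀ {A : Set} {P Q : A → Bool} xs → (∀ x → x ∈ xs → P x ≡ true → Q x ≡ true) → count P xs ≤ count Q xs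
count-mono []       h = z≤n
count-mono {P = P} {Q} (x ∷ xs) h with P x in p | Q x in q
... | true  | true  = s≤s (count-mono xs (λ y y∈xs → h y (there y∈xs)))
... | true  | false = true≢false (h x (here ≡.refl) p) q
... | false | true  = m≤n⇒m≤1+n (count-mono xs (λ y y∈xs → h y (there y∈xs)))
... | false | false = count-mono xs (λ y y∈xs → h y (there y∈xs))

smaller : ℕ → List ℕ → ℕ
smaller C A = count (_<ᵇ C) A

smaller-< : ∀ {C D} A → D < C → smaller C (D ∷ A) ≡ suc (smaller C A)
smaller-< A D<C = count-yes A (<⇒<ᵇ-true D<C)

smaller-≥ : ∀ {C D} A → C ≤ D → smaller C (D ∷ A) ≡ smaller C A
smaller-≥ A C≤D = count-no A (≥⇒<ᵇ-false C≤D)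

smaller-all : ∀ {C A} → All (_< C) A → smaller C A ≡ length A
smaller-all A<C = count-all (All.map <⇒<ᵇ-true A<C)

smaller-none : ∀ {C A} → All (C ≤_) A → smaller C A ≡ 0
smaller-none C≤A = count-none (All.map ≥⇒<ᵇ-false C≤A)

smaller-mono : ∀ {C D} A → C ≤ D → smaller C A ≤ smaller D A
smaller-mono A C≤D = count-mono A (λ x _ e → <⇒<ᵇ-true (<-≤-trans (<ᵇ-true⇒< e) C≤D))

-- The Lehmer code of the letters of the reversed word p, followed by the letters A;
-- like p it is listed from right to left.
codeʳ : List ℕ → List ℕ → List ℕ
codeʳ []      A = []
codeʳ (C ∷ p) A = smaller C A ∷ codeʳ p (C ∷ A)

codeʳ-++ : ∀ p q A → codeʳ (p ++ q) A ≡ codeʳ p A ++ codeʳ q (p ʳ++ A)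
codeʳ-++ []      q A = ≡.refl
codeʳ-++ (C ∷ p) q A = cong (smaller C A ∷_) (codeʳ-++ p q (C ∷ A))

codeʳ-↭ : ∀ p {A A'} → A ↭ A' → codeʳ p A ≡ codeʳ p A'
codeʳ-↭ []      e = ≡.refl
codeʳ-↭ (C ∷ p) e = cong₂ _∷_ (count-↭ e) (codeʳ-↭ p (prep C e))

codeʳ-replace : ∀ p {X Y A A' B} → All (X <_) p → All (Y <_) p → A ↭ X ∷ B → A' ↭ Y ∷ B →
  codeʳ p A ≡ codeʳ p A'
codeʳ-replace []      _ _ _ _ = ≡.refl
codeʳ-replace (C ∷ p) {B = B} (X<C ∷ X<p) (Y<C ∷ Y<p) e e' = cong₂ _∷_
  (≡.trans (≡.trans (count-↭ e) (smaller-< B X<C)) (sym (≡.trans (count-↭ e') (smaller-< B Y<C))))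
  (codeʳ-replace p X<p Y<p (front e) (front e'))
  where
  front : ∀ {A Z} → A ↭ Z ∷ B → C ∷ A ↭ Z ∷ C ∷ B
  front {A} {Z} e = trans (prep C e) (swap C Z refl)

codeʳ-≥ : ∀ p {A X m} → (∀ {Z} → X < Z → m ≤ smaller Z A) → All (X <_) p → All (m ≤_) (codeʳ p A)
codeʳ-≥ []      h _           = []
codeʳ-≥ (C ∷ p) {A} h (X<C ∷ X<p) = h X<C ∷ codeʳ-≥ p (λ {Z} X<Z → ≤-trans (h X<Z) (count-∷-≥ {P = _<ᵇ Z} C A)) X<p

-- The word p is reversed: b stands to the left of a.
IncreasingBelow : ℕ → List ℕ → Set
IncreasingBelow D = AllPairs (λ a b → a < D → b < D → b < a)

-- 2143-avoidance, with the letter C in the role of 4 and D in the role of 3.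
Avoids2143 : List ℕ → List ℕ → Set
Avoids2143 []      A = ⊤
Avoids2143 (C ∷ p) A = (∀ {D} → D ∈ A → D < C → IncreasingBelow D p) × Avoids2143 p (C ∷ A)

avoids-⊆ : ∀ p {A A'} → (∀ {D} → D ∈ A' → D ∈ A) → Avoids2143 p A → Avoids2143 p A'
avoids-⊆ []      s _       = tt
avoids-⊆ (C ∷ p) s (h , v) = (λ D∈A' → h (s D∈A')) , avoids-⊆ p cons v
  where
  cons : ∀ {D} → D ∈ C ∷ _ → D ∈ C ∷ _
  cons (here e)  = here e
  cons (there i) = there (s i)

increasing-mono : ∀ {D E p} → D ≤ E → IncreasingBelow E p → IncreasingBelow D p
increasing-mono D≤E = AllPairs.map (λ h a<D b<D → h (<-≤-trans a<D D≤E) (<-≤-trans b<D D≤E))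

AllPairs-++⁻ : ∀ {R : ℕ → ℕ → Set} xs {ys} → AllPairs R (xs ++ ys) →
  AllPairs R xs × AllPairs R ys × All (λ x → All (R x) ys) xs
AllPairs-++⁻ []       ps       = [] , ps , []
AllPairs-++⁻ (x ∷ xs) (p ∷ ps) = let qs , rs , cs = AllPairs-++⁻ xs ps in
  (All.++⁻ˡ xs p ∷ qs) , rs , (All.++⁻ʳ xs p ∷ cs)

module _ {X Y : ℕ} {p₁ : List ℕ} (Y<X : Y < X) (incX : IncreasingBelow X (Y ∷ p₁)) where

  increasing-replace : ∀ {D} p₂ → All (X <_) p₂ →
    IncreasingBelow D (p₂ ++ Y ∷ p₁) → IncreasingBelow D (p₂ ++ X ∷ p₁)
  increasing-replace {D} p₂ X<p₂ inc with AllPairs-++⁻ p₂ inc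
  ... | inc₂ , (incY ∷ inc₁) , cross = AllPairs.++⁺ inc₂ (All.tabulate below ∷ inc₁)
    (All.zipWith (λ where (X<u , h ∷ hs) → (λ _ _ → X<u) ∷ hs) (X<p₂ , cross))
    where
    below : ∀ {v} → v ∈ p₁ → X < D → v < D → v < X
    below v∈p₁ X<D v<D = <-trans (All.lookup incY v∈p₁ (<-trans Y<X X<D) v<D) Y<X

  increasing-below : ∀ {D} p₂ → All (X <_) p₂ → D ≤ X → IncreasingBelow D (p₂ ++ X ∷ p₁)
  increasing-below p₂ X<p₂ D≤X = AllPairs.++⁺ (vacuous X<p₂)
    (All.tabulate (λ _ X<D → ⊥-elim (<⇒≱ X<D D≤X)) ∷ increasing-mono D≤X (AllPairs.tail incX))
    (All.map (λ X<u → All.tabulate (λ _ u<D → ⊥-elim (<⇒≱ u<D (≤-trans D≤X (<⇒≤ X<u))))) X<p₂)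
    where
    vacuous : ∀ {p} → All (X <_) p → IncreasingBelow _ p
    vacuous []           = []
    vacuous (X<u ∷ X<p) = All.tabulate (λ _ u<D → ⊥-elim (<⇒≱ u<D (≤-trans D≤X (<⇒≤ X<u)))) ∷ vacuous X<p

  -- Let `D` play the role of 3. If `D ≤ X`, the letters of `p₂` are too large to matter, and those
  -- of `p₁` below `D` increase by `incX`. If `D > X`, then `D` was to the right before; `X` may
  -- take the place of `Y`, since the letters of `p₁` below `D` are below `Y` and those of `p₂`
  -- exceed `X`.
  avoids-replace : ∀ p₂ {A A'} → All (X <_) p₂ → X ∈ A → (∀ {D} → D ∈ A' → D ∈ Y ∷ A) →
    Avoids2143 (p₂ ++ Y ∷ p₁) A → Avoids2143 (p₂ ++ X ∷ p₁) A'
  avoids-replace [] _ X∈A s (_ , v) =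
    (λ _ D<X → increasing-mono (<⇒≤ D<X) (AllPairs.tail incX)) , avoids-⊆ p₁ s' v
    where
    s' : ∀ {D} → D ∈ X ∷ _ → D ∈ Y ∷ _
    s' (here ≡.refl) = there X∈A
    s' (there i)     = s i
  avoids-replace (C ∷ p₂) {A} {A'} (X<C ∷ X<p₂) X∈A s (h , v) =
    head , avoids-replace p₂ X<p₂ (there X∈A) s' v
    where
    s' : ∀ {D} → D ∈ C ∷ A' → D ∈ Y ∷ C ∷ A
    s' (here e) = there (here e)
    s' (there i) with s i
    ... | here e   = here e
    ... | there i′ = there (there i′)
    head : ∀ {D} → D ∈ A' → D < C → IncreasingBelow D (p₂ ++ X ∷ p₁)
    head {D} D∈A' D<C with D ≤? X
    ... | yes D≤X = increasing-below p₂ X<p₂ D≤X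
    ... | no D≰X with s D∈A'
    ...   | here ≡.refl = ⊥-elim (D≰X (<⇒≤ Y<X))
    ...   | there D∈A   = increasing-replace p₂ X<p₂ (h D∈A D<C)

-- The transition tree of a vexillary permutation in terms of its reversed code.
data Transition : List ℕ → Set where
  done   : Transition []
  drop0  : ∀ {ρ} → Transition ρ → Transition (0 ∷ ρ)
  corner : ∀ {a ρ} → All (suc a ≤_) ρ → Transition (a ∷ ρ) → Transition (suc a ∷ ρ)
  move   : ∀ {a b} ρ₂ {ρ₁} → All (suc a ≤_) ρ₂ → b ≤ a → All (λ d → d ≤ b ⊎ suc a < d) ρ₁ →
           Transition (a ∷ ρ₂ ++ b ∷ ρ₁) → Transition (b ∷ ρ₂ ++ suc a ∷ ρ₁) →
           Transition (suc a ∷ ρ₂ ++ b ∷ ρ₁)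

[0] : ℕ → ℕ
[0] zero    = 1
[0] (suc _) = 0

-- Solving F(w) + F(v) = (1 + z)(F(v) + F(w')) for F(w) gives z F(v) + (1 + z) F(w'), and z F(v)
-- alone if there is no w'.
tableaux : ∀ {ρ} → Transition ρ → ℕ → ℕ
tableaux done               = [0]
tableaux (drop0 τ)          = tableaux τ
tableaux (corner _ τ)       = shift (tableaux τ)
tableaux (move _ _ _ _ τ τ') j = shift (tableaux τ) j + (tableaux τ' j + shift (tableaux τ') j)

-- The sum of the entries, weighted more heavily further to the right in the word, plus the length.
-- `corner` and the first branch of `move` lower an entry, the second branch of `move` carries the
-- larger of two entries to a lighter place, and `drop0` shortens the list.
measure : List ℕ → ℕ
measure []      = 0
measure (c ∷ ρ) = suc (suc (length ρ) * c + measure ρ)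

measure-pos : ∀ ρ₂ {b c ρ₁} → b ≤ c → measure (ρ₂ ++ c ∷ ρ₁) ≡ measure (ρ₂ ++ b ∷ ρ₁) + suc (length ρ₁) * (c ∸ b)
measure-pos [] {b} {c} {ρ₁} b≤c = cong suc (begin
  suc l * c + measure ρ₁ ≡⟨ cong (λ c → suc l * c + measure ρ₁) (m+[n∸m]≡n b≤c) ⟨
  suc l * (b + (c ∸ b)) + measure ρ₁ ≡⟨ solve 4 (λ l b d m → l :* (b :+ d) :+ m := l :* b :+ m :+ l :* d) ≡.refl (suc l) b (c ∸ b) (measure ρ₁) ⟩
  suc l * b + measure ρ₁ + suc l * (c ∸ b) ∎)
  where
  open ≡-Reasoning
  open +-*-Solver
  l = length ρ₁
measure-pos (d ∷ ρ₂) {b} {c} {ρ₁} b≤c = cong suc (≡.trans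
  (cong₂ (λ l m → suc l * d + m) length≡ (measure-pos ρ₂ b≤c))
  (sym (+-assoc (suc (length (ρ₂ ++ b ∷ ρ₁)) * d) _ _)))
  where
  length≡ : length (ρ₂ ++ c ∷ ρ₁) ≡ length (ρ₂ ++ b ∷ ρ₁)
  length≡ = ≡.trans (length-++ ρ₂) (sym (length-++ ρ₂))

measure-corner : ∀ a ρ → measure (a ∷ ρ) < measure (suc a ∷ ρ)
measure-corner a ρ = s≤s (+-monoˡ-< (measure ρ) (*-monoʳ-< (suc (length ρ)) (n<1+n a)))

measure-move : ∀ ρ₂ {a b ρ₁} → b ≤ a → measure (b ∷ ρ₂ ++ suc a ∷ ρ₁) < measure (suc a ∷ ρ₂ ++ b ∷ ρ₁)
measure-move ρ₂ {a} {b} {ρ₁} b≤a = s≤s (begin-strict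
  suc (length (ρ₂ ++ suc a ∷ ρ₁)) * b + measure (ρ₂ ++ suc a ∷ ρ₁)
    ≡⟨ cong₂ (λ l m → suc l * b + m) length≡ (measure-pos ρ₂ (m≤n⇒m≤1+n b≤a)) ⟩
  n * b + (m + suc l * d)
    ≡⟨ solve 4 (λ x m l d → x :+ (m :+ l :* d) := (x :+ m) :+ l :* d) ≡.refl (n * b) m (suc l) d ⟩
  (n * b + m) + suc l * d
    <⟨ +-monoʳ-< (n * b + m) (*-monoˡ-< d {{>-nonZero d>0}} l<n) ⟩
  (n * b + m) + n * d
    ≡⟨ solve 4 (λ n b d m → n :* b :+ m :+ n :* d := n :* (b :+ d) :+ m) ≡.refl n b d m ⟩
  n * (b + d) + m
    ≡⟨ cong (λ c → n * c + m) (m+[n∸m]≡n (m≤n⇒m≤1+n b≤a)) ⟩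
  n * suc a + m ∎)
  where
  open ≤-Reasoning
  open +-*-Solver
  l = length ρ₁
  d = suc a ∸ b
  n = suc (length (ρ₂ ++ b ∷ ρ₁))
  m = measure (ρ₂ ++ b ∷ ρ₁)
  length≡ : length (ρ₂ ++ suc a ∷ ρ₁) ≡ length (ρ₂ ++ b ∷ ρ₁)
  length≡ = ≡.trans (length-++ ρ₂) (sym (length-++ ρ₂))
  d>0 : 0 < d
  d>0 = m<n⇒0<n∸m (s≤s b≤a)
  l<n : suc l < n
  l<n = s≤s (≤-trans (m≤n+m (suc l) (length ρ₂)) (≤-reflexive (sym (length-++ ρ₂))))

descents-sorted : ∀ w G l → AllPairs _<_ l → Right.descents w G l ≡ 0
descents-sorted w G []          _ = ≡.refl
descents-sorted w G (x ∷ [])    _ = ≡.trans (+-identityʳ _)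
  (≡.trans (cong (w 0 *_) (Right.atDescent-[-] x)) (*-zeroʳ (w 0)))
descents-sorted w G (x ∷ y ∷ l) ((x<y ∷ _) ∷ l↗) = cong₂ _+_
  (≡.trans (cong (w 0 *_) (Right.atDescent-no l (≥⇒<ᵇ-false (<⇒≤ x<y)))) (*-zeroʳ (w 0)))
  (descents-sorted (w ∘ suc) (λ u → G (x ∷ u)) (y ∷ l) l↗)

sorted-↗ : ∀ l → AllPairs _<_ l → Right.sorted l ≡ true
sorted-↗ []          _ = ≡.refl
sorted-↗ (x ∷ [])    _ = ≡.refl
sorted-↗ (x ∷ y ∷ l) ((x<y ∷ _) ∷ l↗) = Right.sorted-∷⁺ x y l (≥⇒<ᵇ-false (<⇒≤ x<y)) (sorted-↗ (y ∷ l) l↗)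

heckeSum-sorted : ∀ L l → AllPairs _<_ l → heckeSum suc L l ≡ egf [0] L
heckeSum-sorted zero    l l↗ = cong (λ b → if b then 1 else 0) (sorted-↗ l l↗)
heckeSum-sorted (suc L) l l↗ = ≡.trans (descents-sorted suc _ l l↗)
  (sym (≡.trans (egf-cong euler≡0 L) (egf-0 L)))
  where
  euler≡0 : ∀ j → euler [0] j ≡ 0
  euler≡0 zero    = ≡.refl
  euler≡0 (suc j) = cong₂ _+_ (*-zeroʳ j) (*-zeroʳ j)

data SplitSorted (C : ℕ) : List ℕ → Set where
  aboveAll  : ∀ {t} → All (C <_) t → SplitSorted C t
  splitBy : ∀ t₁ X t₂ → All (_< X) t₁ → X < C → All (C <_) t₂ → SplitSorted C (t₁ ++ X ∷ t₂)

splitSorted : ∀ C t → AllPairs _<_ t → All (C ≢_) t → SplitSorted C t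
splitSorted C []      _ _ = aboveAll []
splitSorted C (y ∷ t) (y<t ∷ t↗) (C≢y ∷ C∉t) with <-cmp C y
... | tri≈ _ C≡y _ = ⊥-elim (C≢y C≡y)
... | tri< C<y _ _ = aboveAll (C<y ∷ All.map (<-trans C<y) y<t)
... | tri> _ _ y<C with splitSorted C t t↗ C∉t
...   | aboveAll C<t                    = splitBy [] y t [] y<C C<t
...   | splitBy t₁ X t₂ t₁<X X<C C<t₂ = splitBy (y ∷ t₁) X t₂ (All.head (All.++⁻ʳ t₁ y<t) ∷ t₁<X) X<C C<t₂

data FirstBelow (X : ℕ) : List ℕ → Set where
  noneBelow  : ∀ {p} → All (X <_) p → FirstBelow X p
  firstAt : ∀ p₂ Y p₁ → All (X <_) p₂ → Y < X → FirstBelow X (p₂ ++ Y ∷ p₁)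

firstBelow : ∀ X p → All (X ≢_) p → FirstBelow X p
firstBelow X []      _ = noneBelow []
firstBelow X (y ∷ p) (X≢y ∷ X∉p) with <-cmp X y
... | tri≈ _ X≡y _ = ⊥-elim (X≢y X≡y)
... | tri> _ _ y<X = firstAt [] y p [] y<X
... | tri< X<y _ _ with firstBelow X p X∉p
...   | noneBelow X<p             = noneBelow (X<y ∷ X<p)
...   | firstAt p₂ Y p₁ X<p₂ Y<X = firstAt (y ∷ p₂) Y p₁ (X<y ∷ X<p₂) Y<X

shiftsUp-single : ∀ G p X t₁ C t₂ → All (_< X) t₁ → X < C → All (C <_) t₂ →
  shiftsUp G p X (t₁ ++ C ∷ t₂) ≡ G (p ʳ++ (X ∷ t₁ ++ C ∷ t₂)) + G (p ʳ++ (C ∷ t₁ ++ X ∷ t₂))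
shiftsUp-single G p X t₁ C t₂ t₁<X X<C C<t₂ = Right.shifts-single t₁ C t₂
  (All.map (λ {Z} Z<X → Right.≮-record? {X} {Z} nothing (≥⇒<ᵇ-false (<⇒≤ Z<X))) t₁<X)
  (Right.true-record? {X} {C} nothing (<⇒<ᵇ-true X<C) ≡.refl)
  (All.map (λ {Z} C<Z → Right.not-below-record? {X} {Z} (just C) (≥⇒<ᵇ-false (<⇒≤ C<Z))) C<t₂)

shiftsDown-none : ∀ G p X s → All (X <_) p → shiftsDown G p X s ≡ G (p ʳ++ (X ∷ s))
shiftsDown-none G p X s X<p = Left.shifts-skip-all p
  (All.map (λ {Z} X<Z → Left.≮-record? {X} {Z} nothing (≥⇒<ᵇ-false (<⇒≤ X<Z))) X<p)

-- After `Y` a further record would have to lie strictly between `Y` and `X`. In the application,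
-- 2143-avoidance supplies the hypothesis that excludes this.
shiftsDown-single : ∀ G p₂ Y p₁ X s → All (X <_) p₂ → Y < X → All (λ Z → Z < X → Z < Y) p₁ →
  shiftsDown G (p₂ ++ Y ∷ p₁) X s
  ≡ G ((p₂ ++ Y ∷ p₁) ʳ++ (X ∷ s)) + G ((p₂ ++ X ∷ p₁) ʳ++ (Y ∷ s))
shiftsDown-single G p₂ Y p₁ X s X<p₂ Y<X h = Left.shifts-single p₂ Y p₁
  (All.map (λ {Z} X<Z → Left.≮-record? {X} {Z} nothing (≥⇒<ᵇ-false (<⇒≤ X<Z))) X<p₂)
  (Left.true-record? {X} {Y} nothing (<⇒<ᵇ-true Y<X) ≡.refl)
  (All.map (λ {Z} → no-record Z) h)
  where
  no-record : ∀ Z → (Z < X → Z < Y) → Left.record? X (just Y) Z ≡ false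
  no-record Z h with Z <? X
  ... | yes Z<X = Left.not-below-record? {X} {Z} (just Y) (≥⇒<ᵇ-false (<⇒≤ (h Z<X)))
  ... | no  Z≮X = Left.≮-record? {X} {Z} (just Y) (≥⇒<ᵇ-false (≮⇒≥ Z≮X))

Result : List ℕ → List ℕ → Set
Result p t = Σ (Transition (codeʳ p t)) λ τ → ∀ L → heckeSum suc L (p ʳ++ t) ≡ egf (tableaux τ) L

record State (p t : List ℕ) : Set where
  constructor state
  field
    increasing : AllPairs _<_ t
    unique     : Unique (p ++ t)
    avoids     : Avoids2143 p t

-- The transition is built over an expression `ρ` in which its constructor is visible, so that
-- `tableaux` reduces, and is only then transported to the code.
result : ∀ {p t ρ} → codeʳ p t ≡ ρ → (τ : Transition ρ) →
  (∀ L → heckeSum suc L (p ʳ++ t) ≡ egf (tableaux τ) L) → Result p t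
result ≡.refl τ e = τ , e

result⁻¹ : ∀ {p t ρ} → codeʳ p t ≡ ρ → Result p t →
  Σ (Transition ρ) λ τ → ∀ L → heckeSum suc L (p ʳ++ t) ≡ egf (tableaux τ) L
result⁻¹ ≡.refl r = r

smaller-split : ∀ {C} t₁ D t₂ → All (C ≤_) t₂ → smaller C (t₁ ++ D ∷ t₂) ≡ smaller C (D ∷ t₁)
smaller-split {C} t₁ D t₂ C≤t₂ = ≡.trans (count-↭ (↭-shift D t₁ t₂)) (≡.trans
  (count-++ (D ∷ t₁) t₂) (≡.trans (cong (smaller C (D ∷ t₁) +_) (smaller-none C≤t₂)) (+-identityʳ _)))

-- An entry of the code to the left of Y belongs to a letter Z < Y, or to a letter
-- Z > X, which has many smaller letters to its right.
codeʳ-gap : ∀ p {X Y m t} A → Y < X → IncreasingBelow X (Y ∷ p) → All (X ≢_) p →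
  (∀ {Z} → X < Z → m ≤ smaller Z (A ++ t)) → All (λ u → ∀ Z → Z ∈ p → Z < X → Z < u) A →
  All (λ d → d ≤ smaller Y t ⊎ m ≤ d) (codeʳ p (A ++ t))
codeʳ-gap []      A _ _ _ _ _ = []
codeʳ-gap (Z ∷ p) {X} {Y} {m} {t} A Y<X ((Z<Y ∷ p<Y) ∷ (p<Z ∷ inc)) (X≢Z ∷ X∉p) many low =
  entry ∷ codeʳ-gap p (Z ∷ A) Y<X (p<Y ∷ inc) X∉p
    (λ {W} X<W → ≤-trans (many X<W) (count-∷-≥ {P = _<ᵇ W} Z (A ++ t)))
    (p<Z′ ∷ All.map (λ h W W∈p → h W (there W∈p)) low)
  where
  p<Z′ : ∀ W → W ∈ p → W < X → W < Z
  p<Z′ W W∈p W<X with Z <? X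
  ... | yes Z<X = All.lookup p<Z W∈p Z<X W<X
  ... | no Z≮X  = <-≤-trans W<X (≮⇒≥ Z≮X)
  entry : smaller Z (A ++ t) ≤ smaller Y t ⊎ m ≤ smaller Z (A ++ t)
  entry with <-cmp X Z
  ... | tri≈ _ X≡Z _ = ⊥-elim (X≢Z X≡Z)
  ... | tri< X<Z _ _ = inj₂ (many X<Z)
  ... | tri> _ _ Z<X = inj₁ (begin
    smaller Z (A ++ t)          ≡⟨ count-++ A t ⟩
    smaller Z A + smaller Z t   ≡⟨ cong (_+ smaller Z t) (smaller-none (All.map (λ h → <⇒≤ (h Z (here ≡.refl) Z<X)) low)) ⟩
    smaller Z t                 ≤⟨ smaller-mono t (<⇒≤ (Z<Y Y<X Z<X)) ⟩
    smaller Y t                 ∎)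
    where open ≤-Reasoning

module Step {C p t₁ X t₂} (S : State (C ∷ p) (t₁ ++ X ∷ t₂))
  (t₁<X : All (_< X) t₁) (X<C : X < C) (C<t₂ : All (C <_) t₂) where
  open State S

  t t' : List ℕ
  t  = t₁ ++ X ∷ t₂
  t' = t₁ ++ C ∷ t₂

  exchanged : X ∷ t' ↭ C ∷ t
  exchanged = trans (prep X (↭-shift C t₁ t₂)) (trans (swap X C refl) (prep C (↭-sym (↭-shift X t₁ t₂))))

  letters : (X ∷ p) ++ t' ↭ (C ∷ p) ++ t
  letters = trans (↭-sym (↭-shift X p t')) (trans (++⁺ˡ p exchanged) (↭-shift C p t))

  uniqueX : Unique (X ∷ p ++ t')
  uniqueX = Unique-resp-↭ (↭-sym letters) unique

  X∉p : All (X ≢_) p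
  X∉p = All.++⁻ˡ p (AllPairs.head uniqueX)

  X∉t' : All (X ≢_) t'
  X∉t' = All.++⁻ʳ p (AllPairs.head uniqueX)

  X<t₂ : All (X <_) t₂
  X<t₂ = All.map (<-trans X<C) C<t₂

  t₁<C : All (_< C) t₁
  t₁<C = All.map (λ Z<X → <-trans Z<X X<C) t₁<X

  X∈t : X ∈ t
  X∈t = ∈-++⁺ʳ t₁ (here ≡.refl)

  incX : IncreasingBelow X p
  incX = proj₁ avoids X∈t X<C

  increasing' : AllPairs _<_ t'
  increasing' with AllPairs-++⁻ t₁ increasing
  ... | t₁↗ , (_ ∷ t₂↗) , cross = AllPairs.++⁺ t₁↗ (C<t₂ ∷ t₂↗)
    (All.zipWith (λ where (Z<C , _ ∷ Z<t₂) → Z<C ∷ Z<t₂) (t₁<C , cross))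

  smaller-X-t' : smaller X t' ≡ length t₁
  smaller-X-t' = ≡.trans (smaller-split t₁ C t₂ (All.map <⇒≤ X<t₂))
    (≡.trans (smaller-≥ t₁ (<⇒≤ X<C)) (smaller-all t₁<X))

  smaller-C-t : smaller C t ≡ suc (length t₁)
  smaller-C-t = ≡.trans (smaller-split t₁ X t₂ (All.map <⇒≤ C<t₂))
    (≡.trans (smaller-< t₁ X<C) (cong suc (smaller-all t₁<C)))

  smaller-t' : ∀ {D} → D ∈ t' → D < X → D ∈ t
  smaller-t' D∈t' D<X with ∈-resp-↭ exchanged (there D∈t')
  ... | here ≡.refl = ⊥-elim (<-asym X<C D<X)
  ... | there D∈t   = D∈t

  stateX : State (X ∷ p) t'
  stateX = state increasing' uniqueX
    ( (λ D∈t' D<X → proj₁ avoids (smaller-t' D∈t' D<X) (<-trans D<X X<C))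
    , avoids-⊆ p (∈-resp-↭ exchanged) (proj₂ avoids))

  codeC : codeʳ (C ∷ p) t ≡ suc (length t₁) ∷ codeʳ p (C ∷ t)
  codeC = cong (_∷ codeʳ p (C ∷ t)) smaller-C-t

  codeX : codeʳ (X ∷ p) t' ≡ length t₁ ∷ codeʳ p (C ∷ t)
  codeX = cong₂ _∷_ smaller-X-t' (codeʳ-↭ p exchanged)

  many-smaller : ∀ {Z} → X < Z → suc (length t₁) ≤ smaller Z t
  many-smaller {Z} X<Z = begin
    suc (length t₁) ≡⟨ cong suc (smaller-all (All.map (λ D<X → <-trans D<X X<Z) t₁<X)) ⟨
    suc (smaller Z t₁) ≡⟨ smaller-< t₁ X<Z ⟨
    smaller Z (X ∷ t₁) ≤⟨ m≤m+n _ _ ⟩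
    smaller Z (X ∷ t₁) + smaller Z t₂ ≡⟨ count-++ (X ∷ t₁) t₂ ⟨
    smaller Z (X ∷ t₁ ++ t₂) ≡⟨ count-↭ (↭-shift X t₁ t₂) ⟨
    smaller Z t ∎
    where open ≤-Reasoning

  many-smaller-C : ∀ {Z} → X < Z → suc (length t₁) ≤ smaller Z (C ∷ t)
  many-smaller-C {Z} X<Z = ≤-trans (many-smaller X<Z) (count-∷-≥ {P = _<ᵇ Z} C t)

  monk-up : ∀ L → heckeSum suc L ((C ∷ p) ʳ++ t) + heckeSum suc L ((X ∷ p) ʳ++ t')
    ≡ timesExp (λ k → shiftsDown (heckeSum suc k) p X t') L
  monk-up L = ≡.trans (+-comm (heckeSum suc L ((C ∷ p) ʳ++ t)) _) (≡.trans
    (sym (shiftsUp-single (heckeSum suc L) p X t₁ C t₂ t₁<X X<C C<t₂))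
    (monk L p X t' X∉p X∉t' (Any-resp-↭ (↭-sym (↭-shift C t₁ t₂)) (here X<C))))

  corner-case : All (X <_) p → Result (X ∷ p) t' → Result (C ∷ p) t
  corner-case X<p r with result⁻¹ codeX r
  ... | τ , e = result codeC (corner (codeʳ-≥ p many-smaller-C X<p) τ) (λ L →
      +-cancelʳ-≡ (egf (tableaux τ) L) _ _ (begin
        heckeSum suc L ((C ∷ p) ʳ++ t) + egf (tableaux τ) L ≡⟨ cong (_ +_) (e L) ⟨
        heckeSum suc L ((C ∷ p) ʳ++ t) + heckeSum suc L ((X ∷ p) ʳ++ t') ≡⟨ monk-up L ⟩
        timesExp (λ k → shiftsDown (heckeSum suc k) p X t') L
          ≡⟨ timesExp-cong (λ k → ≡.trans (shiftsDown-none (heckeSum suc k) p X t' X<p) (e k)) L ⟩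
        timesExp (egf (tableaux τ)) L ≡⟨ timesExp-egf (tableaux τ) L ⟩
        egf (λ j → tableaux τ j + shift (tableaux τ) j) L ≡⟨ egf-+ (tableaux τ) _ L ⟩
        egf (tableaux τ) L + egf (shift (tableaux τ)) L ≡⟨ +-comm (egf (tableaux τ) L) _ ⟩
        egf (shift (tableaux τ)) L + egf (tableaux τ) L ∎))
    where open ≡-Reasoning

module MoveStep {C p₂ Y p₁ t₁ X t₂} (S : State (C ∷ p₂ ++ Y ∷ p₁) (t₁ ++ X ∷ t₂))
  (t₁<X : All (_< X) t₁) (X<C : X < C) (C<t₂ : All (C <_) t₂)
  (X<p₂ : All (X <_) p₂) (Y<X : Y < X) where
  open State S
  open Step S t₁<X X<C C<t₂

  Y<p₂ : All (Y <_) p₂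
  Y<p₂ = All.map (<-trans Y<X) X<p₂

  Y<C : Y < C
  Y<C = <-trans Y<X X<C

  incXY : IncreasingBelow X (Y ∷ p₁)
  incXY = proj₁ (proj₂ (AllPairs-++⁻ p₂ incX))

  low : All (λ Z → Z < X → Z < Y) p₁
  low = All.map (λ h → h Y<X) (AllPairs.head incXY)

  b : ℕ
  b = smaller Y t

  A : List ℕ
  A = Y ∷ (p₂ ʳ++ (C ∷ []))

  reverse-append : ∀ p (l : List ℕ) → p ʳ++ (C ∷ l) ≡ (p ʳ++ (C ∷ [])) ++ l
  reverse-append p l = go p (C ∷ [])
    where
    go : ∀ p q → p ʳ++ (q ++ l) ≡ (p ʳ++ q) ++ l
    go []      q = ≡.refl
    go (x ∷ p) q = go p (x ∷ q)

  ρ₁ ρ₂ : List ℕ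
  ρ₂ = codeʳ p₂ (C ∷ t)
  ρ₁ = codeʳ p₁ (A ++ t)

  All-ʳ++ : ∀ {P : ℕ → Set} p {l} → All P p → All P l → All P (p ʳ++ l)
  All-ʳ++ []      _          ql = ql
  All-ʳ++ (x ∷ p) (px ∷ ps) ql = All-ʳ++ p ps (px ∷ ql)

  smaller-Y-left : ∀ l → smaller Y (p₂ ʳ++ (C ∷ l)) ≡ smaller Y l
  smaller-Y-left l = ≡.trans (cong (smaller Y) (reverse-append p₂ l)) (≡.trans
    (count-++ (p₂ ʳ++ (C ∷ [])) l)
    (cong (_+ smaller Y l) (smaller-none (All-ʳ++ p₂ (All.map <⇒≤ Y<p₂) (<⇒≤ Y<C ∷ [])))))

  codeA : codeʳ (p₂ ++ Y ∷ p₁) (C ∷ t) ≡ ρ₂ ++ b ∷ ρ₁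
  codeA = ≡.trans (codeʳ-++ p₂ (Y ∷ p₁) (C ∷ t)) (cong (ρ₂ ++_)
    (cong₂ _∷_ (smaller-Y-left t) (cong (λ l → codeʳ p₁ (Y ∷ l)) (reverse-append p₂ t))))

  ʳ++-↭ : ∀ p {l l' : List ℕ} → l ↭ l' → p ʳ++ l ↭ p ʳ++ l'
  ʳ++-↭ []      e = e
  ʳ++-↭ (x ∷ p) e = ʳ++-↭ p (prep x e)

  ∷-ʳ++ : ∀ x p (l : List ℕ) → x ∷ (p ʳ++ l) ↭ p ʳ++ (x ∷ l)
  ∷-ʳ++ x []      l = refl
  ∷-ʳ++ x (y ∷ p) l = trans (∷-ʳ++ x p (y ∷ l)) (ʳ++-↭ p (swap x y refl))

  smaller-Y-t' : smaller Y t' ≡ b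
  smaller-Y-t' = ≡.trans (sym (smaller-≥ t' (<⇒≤ Y<X)))
    (≡.trans (count-↭ {P = _<ᵇ Y} exchanged) (smaller-≥ t (<⇒≤ Y<C)))

  smaller-X-moved : smaller X (p₂ ʳ++ (Y ∷ t')) ≡ suc (length t₁)
  smaller-X-moved = begin
    smaller X (p₂ ʳ++ (Y ∷ t')) ≡⟨ go p₂ (Y ∷ t') X<p₂ ⟩
    smaller X (Y ∷ t')          ≡⟨ smaller-< t' Y<X ⟩
    suc (smaller X t')          ≡⟨ cong suc smaller-X-t' ⟩
    suc (length t₁) ∎
    where
    open ≡-Reasoning
    go : ∀ p l → All (X <_) p → smaller X (p ʳ++ l) ≡ smaller X l
    go []      l []          = ≡.refl
    go (x ∷ p) l (X<x ∷ X<p) = ≡.trans (go p (x ∷ l) X<p) (smaller-≥ l (<⇒≤ X<x))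

  rest-↭ : X ∷ (p₂ ʳ++ (Y ∷ t')) ↭ A ++ t
  rest-↭ = trans (∷-ʳ++ X p₂ (Y ∷ t')) (trans (ʳ++-↭ p₂ (trans (swap X Y refl) (prep Y exchanged)))
    (trans (↭-sym (∷-ʳ++ Y p₂ (C ∷ t))) (prep Y (subst (p₂ ʳ++ (C ∷ t) ↭_) (reverse-append p₂ t) refl))))

  codeY : codeʳ (Y ∷ p₂ ++ X ∷ p₁) t' ≡ b ∷ ρ₂ ++ suc (length t₁) ∷ ρ₁
  codeY = cong₂ _∷_ smaller-Y-t' (≡.trans (codeʳ-++ p₂ (X ∷ p₁) (Y ∷ t')) (cong₂ _++_
    (sym (codeʳ-replace p₂ X<p₂ Y<p₂ (↭-sym exchanged) refl))
    (cong₂ _∷_ smaller-X-moved (codeʳ-↭ p₁ rest-↭))))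

  b≤ : b ≤ length t₁
  b≤ = begin
    smaller Y t ≡⟨ smaller-split t₁ X t₂ (All.map (λ C<Z → <⇒≤ (<-trans Y<C C<Z)) C<t₂) ⟩
    smaller Y (X ∷ t₁) ≡⟨ smaller-≥ t₁ (<⇒≤ Y<X) ⟩
    smaller Y t₁ ≤⟨ smaller-mono t₁ (<⇒≤ Y<X) ⟩
    smaller X t₁ ≡⟨ smaller-all t₁<X ⟩
    length t₁ ∎
    where open ≤-Reasoning

  gap : All (λ d → d ≤ b ⊎ suc (length t₁) < d) ρ₁
  gap = codeʳ-gap p₁ A Y<X incXY (All.tail (All.++⁻ʳ p₂ X∉p))
    -- Besides `X` and the letters of `t₁`, the letter `Y` too is smaller than `Z` and to its right;
    -- this additional one makes the inequality of the gap strict.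
    (λ {Z} X<Z → begin
      suc (suc (length t₁))  ≤⟨ s≤s (many-smaller X<Z) ⟩
      suc (smaller Z t)      ≤⟨ s≤s (m≤n+m _ (smaller Z (p₂ ʳ++ (C ∷ [])))) ⟩
      suc (smaller Z (p₂ ʳ++ (C ∷ [])) + smaller Z t) ≡⟨ cong suc (count-++ (p₂ ʳ++ (C ∷ [])) t) ⟨
      suc (smaller Z ((p₂ ʳ++ (C ∷ [])) ++ t))        ≡⟨ smaller-< _ (<-trans Y<X X<Z) ⟨
      smaller Z (A ++ t) ∎)
    ((λ _ Z∈p₁ Z<X → All.lookup low Z∈p₁ Z<X) ∷
     All-ʳ++ p₂ (All.map (λ X<u _ _ Z<X → <-trans Z<X X<u) X<p₂) ((λ _ _ Z<X → <-trans Z<X X<C) ∷ []))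
    where open ≤-Reasoning

  letters-Y : (Y ∷ p₂ ++ X ∷ p₁) ++ t' ↭ (C ∷ p₂ ++ Y ∷ p₁) ++ t
  letters-Y = trans (++⁺ʳ t' (trans (prep Y (↭-shift X p₂ p₁))
    (trans (swap Y X refl) (prep X (↭-sym (↭-shift Y p₂ p₁)))))) letters

  stateY : State (Y ∷ p₂ ++ X ∷ p₁) t'
  stateY = state increasing' (Unique-resp-↭ (↭-sym letters-Y) unique)
    ( (λ D∈t' D<Y → increasing-below Y<X incXY p₂ X<p₂ (<⇒≤ (<-trans D<Y Y<X)))
    , avoids-replace Y<X incXY p₂ X<p₂ (there X∈t) ⊆ (proj₂ avoids))
    where
    ⊆ : ∀ {D} → D ∈ Y ∷ t' → D ∈ Y ∷ C ∷ t
    ⊆ (here e)  = here e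
    ⊆ (there i) = there (∈-resp-↭ exchanged (there i))

  codeC′ : codeʳ (C ∷ p₂ ++ Y ∷ p₁) t ≡ suc (length t₁) ∷ ρ₂ ++ b ∷ ρ₁
  codeC′ = ≡.trans codeC (cong (suc (length t₁) ∷_) codeA)

  codeX′ : codeʳ (X ∷ p₂ ++ Y ∷ p₁) t' ≡ length t₁ ∷ ρ₂ ++ b ∷ ρ₁
  codeX′ = ≡.trans codeX (cong (length t₁ ∷_) codeA)

  move-case : Result (X ∷ p₂ ++ Y ∷ p₁) t' → Result (Y ∷ p₂ ++ X ∷ p₁) t' → Result (C ∷ p₂ ++ Y ∷ p₁) t
  move-case r r' with result⁻¹ codeX′ r | result⁻¹ codeY r'
  ... | τ , e | τ' , e' = result codeC′ (move ρ₂ (codeʳ-≥ p₂ many-smaller-C X<p₂) b≤ gap τ τ') (λ L →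
      +-cancelʳ-≡ (egf (tableaux τ) L) _ _ (begin
        _ ≡⟨ cong (_ +_) (e L) ⟨
        heckeSum suc L ((C ∷ p₂ ++ Y ∷ p₁) ʳ++ t) + heckeSum suc L ((X ∷ p₂ ++ Y ∷ p₁) ʳ++ t') ≡⟨ monk-up L ⟩
        timesExp (λ k → shiftsDown (heckeSum suc k) (p₂ ++ Y ∷ p₁) X t') L
          ≡⟨ timesExp-cong (λ k → ≡.trans
               (shiftsDown-single (heckeSum suc k) p₂ Y p₁ X t' X<p₂ Y<X low) (cong₂ _+_ (e k) (e' k))) L ⟩
        timesExp (λ k → egf (tableaux τ) k + egf (tableaux τ') k) L ≡⟨ egf-shift (tableaux τ) (tableaux τ') L ⟨
        _ ∎))
    where open ≡-Reasoning

-- The increasing end `t` grows to the left as long as there is no descent, each letter so absorbed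
-- having code entry 0. Once `C` exceeds a letter of `t`, its place is the last descent, and the two
-- remaining cases depend on whether a letter smaller than `X` stands to the left.
transitions : ∀ p t → State p t → Acc _<_ (measure (codeʳ p t)) → Result p t
transitions []      t S _ = done , λ L → heckeSum-sorted L t (State.increasing S)
transitions (C ∷ p) t S (acc rec)
  with splitSorted C t (State.increasing S) (All.++⁻ʳ p (AllPairs.head (State.unique S)))
... | aboveAll C<t = let τ , e = transitions p (C ∷ t) S' (rec smaller-measure) in
  result code≡ (drop0 τ) e
  where
  open State S
  code≡ : codeʳ (C ∷ p) t ≡ 0 ∷ codeʳ p (C ∷ t)
  code≡ = cong (_∷ codeʳ p (C ∷ t)) (smaller-none (All.map <⇒≤ C<t))
  S' : State p (C ∷ t)
  S' = state (C<t ∷ increasing) (Unique-resp-↭ (↭-sym (↭-shift C p t)) unique) (proj₂ avoids)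
  smaller-measure : measure (codeʳ p (C ∷ t)) < measure (codeʳ (C ∷ p) t)
  smaller-measure = s≤s (m≤n+m _ _)
... | splitBy t₁ X t₂ t₁<X X<C C<t₂ with firstBelow X p (Step.X∉p S t₁<X X<C C<t₂)
...   | noneBelow X<p = corner-case X<p (transitions (X ∷ p) t' stateX (rec smaller-measure))
  where
  open Step S t₁<X X<C C<t₂ hiding (t)
  smaller-measure : measure (codeʳ (X ∷ p) t') < measure (codeʳ (C ∷ p) t)
  smaller-measure = ≡.subst₂ (λ ρ ρ' → measure ρ < measure ρ') (sym codeX) (sym codeC) (measure-corner (length t₁) (codeʳ p (C ∷ t)))
...   | firstAt p₂ Y p₁ X<p₂ Y<X = move-case
    (transitions (X ∷ p₂ ++ Y ∷ p₁) t' stateX (rec smaller-measure))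
    (transitions (Y ∷ p₂ ++ X ∷ p₁) t' stateY (rec smaller-measure'))
  where
  open Step S t₁<X X<C C<t₂ hiding (t)
  open MoveStep {p₂ = p₂} S t₁<X X<C C<t₂ X<p₂ Y<X
  smaller-measure : measure (codeʳ (X ∷ p₂ ++ Y ∷ p₁) t') < measure (codeʳ (C ∷ p₂ ++ Y ∷ p₁) t)
  smaller-measure = ≡.subst₂ (λ ρ ρ' → measure ρ < measure ρ') (sym codeX) (sym codeC) (measure-corner (length t₁) (codeʳ (p₂ ++ Y ∷ p₁) (C ∷ t)))
  smaller-measure' : measure (codeʳ (Y ∷ p₂ ++ X ∷ p₁) t') < measure (codeʳ (C ∷ p₂ ++ Y ∷ p₁) t)
  smaller-measure' = ≡.subst₂ (λ ρ ρ' → measure ρ < measure ρ') (sym codeY) (sym codeC′) (measure-move ρ₂ b≤)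

-- Counting by enumeration.

module _ {A : Set} where

  Enumerates-⇔ : ∀ {P Q : A → Set} {xs} → (∀ a → P a → Q a) → (∀ a → Q a → P a) → Enumerates P xs → Enumerates Q xs
  Enumerates-⇔ f g E = record
    { unique   = Enumerates.unique E
    ; sound    = λ a a∈ → f a (Enumerates.sound E a a∈)
    ; complete = λ a q → Enumerates.complete E a (g a q)
    }

  Enumerates-∅ : ∀ {P : A → Set} → (∀ a → ¬ P a) → Enumerates P []
  Enumerates-∅ ¬P = record { unique = [] ; sound = λ _ () ; complete = λ a p → ⊥-elim (¬P a p) }

  Enumerates-++ : ∀ {P Q : A → Set} {xs ys} → (∀ a → P a → Q a → ⊥) →
    Enumerates P xs → Enumerates Q ys → Enumerates (λ a → P a ⊎ Q a) (xs ++ ys)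
  Enumerates-++ {P} {Q} {xs} {ys} disjoint E F = record
    { unique   = Unique.++⁺ (Enumerates.unique E) (Enumerates.unique F)
        (λ where (p , q) → disjoint _ (Enumerates.sound E _ p) (Enumerates.sound F _ q))
    ; sound    = sound
    ; complete = λ where
        a (inj₁ p) → ∈-++⁺ˡ (Enumerates.complete E a p)
        a (inj₂ q) → ∈-++⁺ʳ xs (Enumerates.complete F a q)
    }
    where
    sound : ∀ a → a ∈ xs ++ ys → P a ⊎ Q a
    sound a a∈ with ∈-++⁻ xs a∈
    ... | inj₁ p = inj₁ (Enumerates.sound E a p)
    ... | inj₂ q = inj₂ (Enumerates.sound F a q)

  Image : {B : Set} → (A → B) → (A → Set) → B → Set
  Image f P b = Σ A λ a → P a × b ≡ f a

  Enumerates-map : ∀ {B : Set} {P : A → Set} {xs} (f : A → B) → (∀ {a a'} → f a ≡ f a' → a ≡ a') →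
    Enumerates P xs → Enumerates (Image f P) (map f xs)
  Enumerates-map f f-inj E = record
    { unique   = Unique.map⁺ f-inj (Enumerates.unique E)
    ; sound    = λ b b∈ → let a , a∈ , e = ∈-map⁻ f b∈ in a , Enumerates.sound E a a∈ , e
    ; complete = λ where _ (a , p , ≡.refl) → ∈-map⁺ f (Enumerates.complete E a p)
    }

Counted : {A : Set} → (ℕ → A → Set) → (ℕ → ℕ) → Set
Counted P N = ∀ j → CardIs (P j) (N j)

Later : {A : Set} → (ℕ → A → Set) → ℕ → A → Set
Later P zero    a = ⊥
Later P (suc j) a = P j a

Counted-shift : ∀ {A : Set} {P : ℕ → A → Set} {N} → Counted P N → Counted (Later P) (shift N)
Counted-shift c zero    = [] , Enumerates-∅ (λ _ ()) , ≡.refl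
Counted-shift c (suc j) = c j

Counted-⇔ : ∀ {A : Set} {P Q : ℕ → A → Set} {N} → (∀ j a → P j a → Q j a) → (∀ j a → Q j a → P j a) →
  Counted P N → Counted Q N
Counted-⇔ f g c j = let xs , E , l = c j in xs , Enumerates-⇔ (f j) (g j) E , l

Counted-map : ∀ {A B : Set} {P : ℕ → A → Set} {N} (f : A → B) → (∀ {a a'} → f a ≡ f a' → a ≡ a') →
  Counted P N → Counted (λ j → Image f (P j)) N
Counted-map f f-inj c j = let xs , E , l = c j in map f xs , Enumerates-map f f-inj E , ≡.trans (length-map f xs) l

Counted-+ : ∀ {A : Set} {P Q : ℕ → A → Set} {N M} → (∀ j a → P j a → Q j a → ⊥) →
  Counted P N → Counted Q M → Counted (λ j a → P j a ⊎ Q j a) (λ j → N j + M j)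
Counted-+ disjoint c d j = let xs , E , l = c j ; ys , F , m = d j in
  xs ++ ys , Enumerates-++ (disjoint j) E F , ≡.trans (length-++ xs) (cong₂ _+_ l m)

-- The enumeration of the images is pulled back by `g`. Duplicates are excluded because mapping `f`
-- over the result recovers the original list.
Counted-preimage : ∀ {A B : Set} {P : ℕ → B → Set} {Q : ℕ → A → Set} {N} (f : A → B) (g : B → A) →
  (∀ j a → Q j a → g (f a) ≡ a) → (∀ j a → Q j a → P j (f a)) → (∀ j b → P j b → Image f (Q j) b) →
  Counted P N → Counted Q N
Counted-preimage {A} {B} {P} {Q} f g gf to from c j with c j
... | xs , E , l = map g xs , record
  { unique   = Unique.map⁻ (subst Unique (fg xs (Enumerates.sound E)) (Enumerates.unique E))
  ; sound    = sound
  ; complete = λ a q → subst (_∈ map g xs) (gf j a q) (∈-map⁺ g (Enumerates.complete E (f a) (to j a q)))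
  } , ≡.trans (length-map g xs) l
  where
  fg : ∀ xs → (∀ b → b ∈ xs → P j b) → xs ≡ map f (map g xs)
  fg []       _ = ≡.refl
  fg (b ∷ xs) s with from j b (s b (here ≡.refl))
  ... | a , q , ≡.refl = cong₂ _∷_ (cong f (sym (gf j a q))) (fg xs (λ b b∈ → s b (there b∈)))
  sound : ∀ a → a ∈ map g xs → Q j a
  sound a a∈ with ∈-map⁻ g a∈
  ... | b , b∈ , ≡.refl with from j b (Enumerates.sound E b b∈)
  ...   | a' , q , ≡.refl = subst (Q j) (sym (gf j a' q)) q

-- Set-valued tableaux

Cell Row Filling : Set
Cell = List ℕ
Row = List Cell
Filling = List Row

at : Filling → ℕ → ℕ → Maybe Cell
at []      i       k = nothing
at (r ∷ T) zero    k = nth r k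
at (r ∷ T) (suc i) k = at T i k

size : Filling → ℕ
size T = sum (map length (concat T))

CellOK : Cell → Set
CellOK s = s ≢ [] × AllPairs _<_ s × All (1 ≤_) s

Bounded : (ℕ → ℕ) → Row → Set
Bounded f r = All (All (_≤ f (length r))) r

RowsWeak ColsStrict : Filling → Set
RowsWeak T   = ∀ {i k k' s s'} → k < k' → at T i k ≡ just s → at T i k' ≡ just s' → ∀ {x y} → x ∈ s → y ∈ s' → x ≤ y
ColsStrict T = ∀ {i i' k s s'} → i < i' → at T i k ≡ just s → at T i' k ≡ just s' → ∀ {x y} → x ∈ s → y ∈ s' → x < y

-- The flag f p of a row depends only on its length p.
record Flagged (f : ℕ → ℕ) (lam : List ℕ) (T : Filling) : Set where
  constructor flagged
  field
    shape≡   : map length T ≡ lam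
    cells    : All (All CellOK) T
    bounded  : All (Bounded f) T
    rowsWeak : RowsWeak T
    colsStrict : ColsStrict T

FlaggedOfSize : (ℕ → ℕ) → List ℕ → ℕ → Filling → Set
FlaggedOfSize f lam j T = Flagged f lam T × size T ≡ j

nth-++ˡ : ∀ {A : Set} (xs ys : List A) {k x} → nth xs k ≡ just x → nth (xs ++ ys) k ≡ just x
nth-++ˡ (x ∷ xs) ys {zero}  e = e
nth-++ˡ (x ∷ xs) ys {suc k} e = nth-++ˡ xs ys e

nth-length : ∀ {A : Set} (xs : List A) {y} → nth (xs ++ [ y ]) (length xs) ≡ just y
nth-length []       = ≡.refl
nth-length (x ∷ xs) = nth-length xs

nth-∷ʳ⁻ : ∀ {A : Set} (xs : List A) {y k x} → nth (xs ++ [ y ]) k ≡ just x →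
  (k ≡ length xs × x ≡ y) ⊎ nth xs k ≡ just x
nth-∷ʳ⁻ []       {k = zero} e = inj₁ (≡.refl , sym (just-injective e))
nth-∷ʳ⁻ (x ∷ xs) {k = zero} e = inj₂ e
nth-∷ʳ⁻ (x ∷ xs) {k = suc k} e with nth-∷ʳ⁻ xs {k = k} e
... | inj₁ (k≡ , x≡) = inj₁ (cong suc k≡ , x≡)
... | inj₂ e′        = inj₂ e′

nth-< : ∀ {A : Set} (xs : List A) {k x} → nth xs k ≡ just x → k < length xs
nth-< (x ∷ xs) {zero}  e = s≤s z≤n
nth-< (x ∷ xs) {suc k} e = s≤s (nth-< xs e)

nth-∈ : ∀ {A : Set} (xs : List A) {k x} → nth xs k ≡ just x → x ∈ xs
nth-∈ (x ∷ xs) {zero}  e = here (sym (just-injective e))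
nth-∈ (x ∷ xs) {suc k} e = there (nth-∈ xs e)

nth-just : ∀ {A : Set} (xs : List A) {k} → k < length xs → ∃ λ x → nth xs k ≡ just x
nth-just (x ∷ xs) {zero}  _         = x , ≡.refl
nth-just (x ∷ xs) {suc k} (s≤s k<n) = nth-just xs k<n

∈-nth : ∀ {A : Set} {xs : List A} {x} → x ∈ xs → ∃ λ k → nth xs k ≡ just x
∈-nth (here ≡.refl) = 0 , ≡.refl
∈-nth (there x∈) = let k , e = ∈-nth x∈ in suc k , e

at-nth : ∀ T {i k s} → at T i k ≡ just s → ∃ λ r → nth T i ≡ just r × nth r k ≡ just s
at-nth (r ∷ T) {zero}  e = r , ≡.refl , e
at-nth (r ∷ T) {suc i} e = at-nth T e

nth-at : ∀ T {i k r s} → nth T i ≡ just r → nth r k ≡ just s → at T i k ≡ just s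
nth-at (r ∷ T) {zero}  ≡.refl e′ = e′
nth-at (r ∷ T) {suc i} e e′      = nth-at T e e′

at-∈ : ∀ T {i k s} → at T i k ≡ just s → ∃ λ r → r ∈ T × s ∈ r
at-∈ T e = let r , e₁ , e₂ = at-nth T e in r , nth-∈ T e₁ , nth-∈ r e₂

nonempty : ∀ {s : Cell} → CellOK s → ∃ λ x → x ∈ s
nonempty {[]}    (s≢[] , _) = ⊥-elim (s≢[] ≡.refl)
nonempty {x ∷ s} _          = x , here ≡.refl

sum-lengths-++ : ∀ (xs ys : Row) → sum (map length (xs ++ ys)) ≡ sum (map length xs) + sum (map length ys)
sum-lengths-++ xs ys = ≡.trans (cong sum (map-++ length xs ys)) (sum-++ (map length xs) (map length ys))

size-++ : ∀ T U → size (T ++ U) ≡ size T + size U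
size-++ T U = ≡.trans (cong (sum ∘ map length) (sym (concat-++ T U))) (sum-lengths-++ (concat T) (concat U))

size-∷ : ∀ r T → size (r ∷ T) ≡ sum (map length r) + size T
size-∷ r T = sum-lengths-++ r (concat T)

withCorner : Filling → Row → Cell → Filling → Filling
withCorner T₁ r S T₂ = T₁ ++ (r ++ [ S ]) ∷ T₂

module _ (r : Row) (S : Cell) (T₂ : Filling) where

  at-corner : ∀ T₁ → at (withCorner T₁ r S T₂) (length T₁) (length r) ≡ just S
  at-corner []       = nth-length r
  at-corner (_ ∷ T₁) = at-corner T₁

  at-corner⁺ : ∀ T₁ {i k s} → at (T₁ ++ r ∷ T₂) i k ≡ just s → at (withCorner T₁ r S T₂) i k ≡ just s
  at-corner⁺ []       {zero}  e = nth-++ˡ r [ S ] e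
  at-corner⁺ []       {suc i} e = e
  at-corner⁺ (_ ∷ T₁) {zero}  e = e
  at-corner⁺ (_ ∷ T₁) {suc i} e = at-corner⁺ T₁ e

  at-corner⁻ : ∀ T₁ {i k s} → at (withCorner T₁ r S T₂) i k ≡ just s →
    (i ≡ length T₁ × k ≡ length r × s ≡ S) ⊎ at (T₁ ++ r ∷ T₂) i k ≡ just s
  at-corner⁻ []       {zero} e with nth-∷ʳ⁻ r e
  ... | inj₁ (k≡ , s≡) = inj₁ (≡.refl , k≡ , s≡)
  ... | inj₂ e′        = inj₂ e′
  at-corner⁻ []       {suc i} e = inj₂ e
  at-corner⁻ (_ ∷ T₁) {zero}  e = inj₂ e
  at-corner⁻ (_ ∷ T₁) {suc i} e with at-corner⁻ T₁ {i} e
  ... | inj₁ (i≡ , ks≡) = inj₁ (cong suc i≡ , ks≡)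
  ... | inj₂ e′         = inj₂ e′

  size-corner : ∀ T₁ → size (withCorner T₁ r S T₂) ≡ length S + size (T₁ ++ r ∷ T₂)
  size-corner T₁ = begin
    size (T₁ ++ (r ++ [ S ]) ∷ T₂)
      ≡⟨ ≡.trans (size-++ T₁ _) (cong (size T₁ +_) (≡.trans (size-∷ (r ++ [ S ]) T₂) (cong (_+ size T₂) (sum-lengths-++ r [ S ])))) ⟩
    size T₁ + (sum (map length r) + (length S + 0) + size T₂)
      ≡⟨ solve 4 (λ a b c d → a :+ (b :+ (c :+ con 0) :+ d) := c :+ (a :+ (b :+ d))) ≡.refl (size T₁) (sum (map length r)) (length S) (size T₂) ⟩
    length S + (size T₁ + (sum (map length r) + size T₂))
      ≡⟨ cong (length S +_) (≡.trans (size-++ T₁ _) (cong (size T₁ +_) (size-∷ r T₂))) ⟨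
    length S + size (T₁ ++ r ∷ T₂) ∎
    where
    open ≡-Reasoning
    open +-*-Solver

at-row : ∀ T₁ (r : Row) T₂ {k s} → at (T₁ ++ r ∷ T₂) (length T₁) k ≡ just s → nth r k ≡ just s
at-row []       r T₂ e = e
at-row (_ ∷ T₁) r T₂ e = at-row T₁ r T₂ e

at-row⁺ : ∀ T₁ (r : Row) T₂ {k s} → nth r k ≡ just s → at (T₁ ++ r ∷ T₂) (length T₁) k ≡ just s
at-row⁺ []       r T₂ e = e
at-row⁺ (_ ∷ T₁) r T₂ e = at-row⁺ T₁ r T₂ e

at-below : ∀ T₁ (r : Row) T₂ {i k s} → length T₁ < i → at (T₁ ++ r ∷ T₂) i k ≡ just s →
  ∃ λ r' → r' ∈ T₂ × nth r' k ≡ just s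
at-below []       r T₂ {suc i} _ e        = let r' , e₁ , e₂ = at-nth T₂ e in r' , nth-∈ T₂ e₁ , e₂
at-below (_ ∷ T₁) r T₂ {suc i} (s≤s <i) e = at-below T₁ r T₂ <i e

at-above : ∀ T₁ (r : Row) T₂ {i k s} → i < length T₁ → at (T₁ ++ r ∷ T₂) i k ≡ just s →
  ∃ λ r' → r' ∈ T₁ × nth r' k ≡ just s
at-above (r' ∷ T₁) r T₂ {zero}  _         e = r' , here ≡.refl , e
at-above (_ ∷ T₁)  r T₂ {suc i} (s≤s <n) e = let r' , r'∈ , e' = at-above T₁ r T₂ <n e in r' , there r'∈ , e'

-- No row of `T₂` is longer than `r`, so nothing stands below the cell appended to `r`; its only
-- constraints come from the cells to its left and above it.
module Corner (T₁ : Filling) (r : Row) (T₂ : Filling) (short : All (λ r' → length r' ≤ length r) T₂) where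

  B : Filling
  B = T₁ ++ r ∷ T₂

  LeftOf AboveOf : Cell → Set
  LeftOf S  = ∀ {k s x y} → nth r k ≡ just s → x ∈ s → y ∈ S → x ≤ y
  AboveOf S = ∀ {i s x y} → i < length T₁ → at B i (length r) ≡ just s → x ∈ s → y ∈ S → x < y

  module _ (S : Cell) where

    T : Filling
    T = withCorner T₁ r S T₂

    rowsWeak⁺ : RowsWeak B → LeftOf S → RowsWeak T
    rowsWeak⁺ rw left {i} {k} {k'} k<k' e e' with at-corner⁻ r S T₂ T₁ e | at-corner⁻ r S T₂ T₁ e'
    ... | inj₂ b | inj₂ b' = rw k<k' b b'
    ... | inj₂ b | inj₁ (≡.refl , ≡.refl , ≡.refl) = left (at-row T₁ r T₂ b)
    ... | inj₁ (≡.refl , ≡.refl , ≡.refl) | inj₂ b = ⊥-elim (<-asym k<k' (nth-< r (at-row T₁ r T₂ b)))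
    ... | inj₁ (≡.refl , ≡.refl , ≡.refl) | inj₁ (_ , k'≡ , _) = ⊥-elim (<-irrefl (sym k'≡) k<k')

    colsStrict⁺ : ColsStrict B → AboveOf S → ColsStrict T
    colsStrict⁺ cs above {i} {i'} i<i' e e' with at-corner⁻ r S T₂ T₁ e | at-corner⁻ r S T₂ T₁ e'
    ... | inj₂ b | inj₂ b' = cs i<i' b b'
    ... | inj₂ b | inj₁ (≡.refl , ≡.refl , ≡.refl) = above i<i' b
    ... | inj₁ (≡.refl , ≡.refl , ≡.refl) | inj₂ b = let r' , r'∈ , e″ = at-below T₁ r T₂ i<i' b in
      ⊥-elim (<⇒≱ (nth-< r' e″) (All.lookup short r'∈))
    ... | inj₁ (≡.refl , ≡.refl , ≡.refl) | inj₁ (i'≡ , _) = ⊥-elim (<-irrefl (sym i'≡) i<i')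

    rowsWeak⁻ : RowsWeak T → RowsWeak B
    rowsWeak⁻ rw k<k' e e' = rw k<k' (at-corner⁺ r S T₂ T₁ e) (at-corner⁺ r S T₂ T₁ e')

    colsStrict⁻ : ColsStrict T → ColsStrict B
    colsStrict⁻ cs i<i' e e' = cs i<i' (at-corner⁺ r S T₂ T₁ e) (at-corner⁺ r S T₂ T₁ e')

    leftOf : RowsWeak T → LeftOf S
    leftOf rw e = rw (nth-< r e) (at-corner⁺ r S T₂ T₁ (at-row⁺ T₁ r T₂ e)) (at-corner r S T₂ T₁)

    aboveOf : ColsStrict T → AboveOf S
    aboveOf cs i< e = cs i< (at-corner⁺ r S T₂ T₁ e) (at-corner r S T₂ T₁)

-- Corner cells are added or enlarged by total functions on fillings, because `Counted-map` asks for
-- injectivity without reference to a shape.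
module _ {A : Set} (f : A → A) where

  modify : ℕ → List A → List A
  modify i       []       = []
  modify zero    (x ∷ xs) = f x ∷ xs
  modify (suc i) (x ∷ xs) = x ∷ modify i xs

  modify-injective : (∀ {x y} → f x ≡ f y → x ≡ y) → ∀ i {xs ys} → modify i xs ≡ modify i ys → xs ≡ ys
  modify-injective f-inj i       {[]}     {[]}     e = ≡.refl
  modify-injective f-inj zero    {x ∷ xs} {y ∷ ys} e = cong₂ _∷_ (f-inj (∷-injectiveˡ e)) (∷-injectiveʳ e)
  modify-injective f-inj (suc i) {x ∷ xs} {y ∷ ys} e =
    cong₂ _∷_ (∷-injectiveˡ e) (modify-injective f-inj i (∷-injectiveʳ e))
  modify-injective f-inj zero    {[]}     {_ ∷ _}  ()
  modify-injective f-inj (suc _) {[]}     {_ ∷ _}  ()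
  modify-injective f-inj zero    {_ ∷ _}  {[]}     ()
  modify-injective f-inj (suc _) {_ ∷ _}  {[]}     ()

  modify-++ : ∀ xs y ys → modify (length xs) (xs ++ y ∷ ys) ≡ xs ++ f y ∷ ys
  modify-++ []       y ys = ≡.refl
  modify-++ (x ∷ xs) y ys = cong (x ∷_) (modify-++ xs y ys)

growLast : ℕ → Row → Row
growLast x []           = []
growLast x (s ∷ [])     = (s ++ [ x ]) ∷ []
growLast x (s ∷ s' ∷ r) = s ∷ growLast x (s' ∷ r)

length-growLast : ∀ x r → length (growLast x r) ≡ length r
length-growLast x []           = ≡.refl
length-growLast x (s ∷ [])     = ≡.refl
length-growLast x (s ∷ s' ∷ r) = cong suc (length-growLast x (s' ∷ r))

growLast-injective : ∀ x {r r'} → growLast x r ≡ growLast x r' → r ≡ r'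
growLast-injective x {r} {r'} e = go r r' (≡.trans (sym (length-growLast x r)) (≡.trans (cong length e) (length-growLast x r'))) e
  where
  go : ∀ r r' → length r ≡ length r' → growLast x r ≡ growLast x r' → r ≡ r'
  go []           []             _ _ = ≡.refl
  go (s ∷ [])     (s' ∷ [])      _ e = cong [_] (∷ʳ-injectiveˡ s s' (∷-injectiveˡ e))
  go (s ∷ t ∷ r)  (s' ∷ t' ∷ r') l e =
    cong₂ _∷_ (∷-injectiveˡ e) (go (t ∷ r) (t' ∷ r') (suc-injective l) (∷-injectiveʳ e))

growLast-∷ʳ : ∀ x r S → growLast x (r ++ [ S ]) ≡ r ++ [ S ++ [ x ] ]
growLast-∷ʳ x []          S = ≡.refl
growLast-∷ʳ x (s ∷ [])    S = ≡.refl
growLast-∷ʳ x (s ∷ t ∷ r) S = cong (s ∷_) (growLast-∷ʳ x (t ∷ r) S)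

-- The code is listed from right to left. The first entry found that is at least `p` is thus the
-- last such position of the word, and the number of entries from there to the end of the list is
-- its 1-based index; 0 means that there is none.
bound : List ℕ → ℕ → ℕ
bound []      p = 0
bound (c ∷ ρ) p = if c <ᵇ p then bound ρ p else suc (length ρ)

bound-≤ : ∀ {c p} ρ → p ≤ c → bound (c ∷ ρ) p ≡ suc (length ρ)
bound-≤ ρ p≤c rewrite ≥⇒<ᵇ-false p≤c = ≡.refl

bound-> : ∀ {c p} ρ → c < p → bound (c ∷ ρ) p ≡ bound ρ p
bound-> ρ c<p rewrite <⇒<ᵇ-true c<p = ≡.refl

bound≤length : ∀ ρ p → bound ρ p ≤ length ρ
bound≤length []      p = z≤n
bound≤length (c ∷ ρ) p with c <ᵇ p
... | true  = m≤n⇒m≤1+n (bound≤length ρ p)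
... | false = ≤-refl

bound-replace : ∀ ρ₂ {c d ρ₁ p} → c < p → d < p → bound (ρ₂ ++ c ∷ ρ₁) p ≡ bound (ρ₂ ++ d ∷ ρ₁) p
bound-replace []       {ρ₁ = ρ₁} c<p d<p = ≡.trans (bound-> ρ₁ c<p) (sym (bound-> ρ₁ d<p))
bound-replace (e ∷ ρ₂) {c} {d} {ρ₁} {p} c<p d<p with e <ᵇ p
... | true  = bound-replace ρ₂ c<p d<p
... | false = cong suc (≡.trans (length-++ ρ₂) (sym (length-++ ρ₂)))

split-map : ∀ (T : Filling) l₁ {m l₂} → map length T ≡ l₁ ++ m ∷ l₂ →
  Σ Filling λ T₁ → Σ Row λ r → Σ Filling λ T₂ →
  T ≡ T₁ ++ r ∷ T₂ × map length T₁ ≡ l₁ × length r ≡ m × map length T₂ ≡ l₂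
split-map (r ∷ T) []       e = [] , r , T , ≡.refl , ≡.refl , ∷-injectiveˡ e , ∷-injectiveʳ e
split-map (r ∷ T) (_ ∷ l₁) e =
  let T₁ , r' , T₂ , e₀ , e₁ , er , e₂ = split-map T l₁ (∷-injectiveʳ e) in
  r ∷ T₁ , r' , T₂ , cong (r ∷_) e₀ , cong₂ _∷_ (∷-injectiveˡ e) e₁ , er , e₂

All-lengths : ∀ {Q : ℕ → Set} {l} {T : Filling} → map length T ≡ l → All Q l → All (λ r → Q (length r)) T
All-lengths ≡.refl q = All.map⁻ q

++-congᵐ : ∀ {T₁ r} {T₂ : Filling} {l₁ m l₂} → map length T₁ ≡ l₁ → length r ≡ m → map length T₂ ≡ l₂ →
  map length (T₁ ++ r ∷ T₂) ≡ l₁ ++ m ∷ l₂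
++-congᵐ {T₁} {r} {T₂} ≡.refl ≡.refl ≡.refl = map-++ length T₁ (r ∷ T₂)

data CornerView (R : ℕ) : Cell → Set where
  avoiding : ∀ {S} → R ∉ S → CornerView R S
  alone    : CornerView R [ R ]
  joined   : ∀ {S} → S ≢ [] → CornerView R (S ++ [ R ])

cornerView : ∀ R S → AllPairs _<_ S → All (_≤ R) S → CornerView R S
cornerView R S S↗ S≤R with initLast S
... | []       = avoiding λ ()
... | S' ∷ʳ′ y with AllPairs-++⁻ S' S↗ | y ≟ R
...   | _ , _ , S'<y | no y≢R = avoiding λ R∈ → go (∈-++⁻ S' R∈)
  where
  y<R : y < R
  y<R = ≤∧≢⇒< (All.head (All.++⁻ʳ S' S≤R)) y≢R
  go : R ∈ S' ⊎ R ∈ [ y ] → ⊥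
  go (inj₁ R∈S') = <-asym (All.head (All.lookup S'<y R∈S')) y<R
  go (inj₂ (here ≡.refl)) = y≢R ≡.refl
cornerView R _ _ _ | []       ∷ʳ′ y | _ | yes ≡.refl = alone
cornerView R _ _ _ | (s ∷ S') ∷ʳ′ y | _ | yes ≡.refl = joined {S = s ∷ S'} λ ()

-- `R` is the position of the last code entry, which is `P`. Lowering this entry changes the flag
-- only for rows of length `P`, from `R` to the previous position with an entry at least `P`.
-- `here-bound` says that this is `R - 1` whenever further rows of length `P` exist, which is just
-- what column strictness forces on the rows above the corner.
module CornerCell
  (a : ℕ) (ρ l₁ l₂ : List ℕ)
  (l₁≥ : All (suc a ≤_) l₁) (l₂≤ : All (_≤ a) l₂)
  (l↭ : l₁ ++ suc a ∷ l₂ ↭ suc a ∷ ρ)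
  (here-bound : suc a ∈ ρ → bound ρ (suc a) ≡ length ρ)
  where

  P R : ℕ
  P = suc a
  R = suc (length ρ)

  f fᵛ : ℕ → ℕ
  f  = bound (P ∷ ρ)
  fᵛ = bound (a ∷ ρ)

  rest↭ : l₁ ++ l₂ ↭ ρ
  rest↭ = drop-∷ (trans (↭-sym (↭-shift P l₁ l₂)) l↭)

  record Parts (T₁ : Filling) (r : Row) (T₂ : Filling) : Set where
    constructor parts
    field
      above≡ : map length T₁ ≡ l₁
      row≡   : length r ≡ a
      below≡ : map length T₂ ≡ l₂

    long : All (λ r' → P ≤ length r') T₁
    long = All-lengths above≡ l₁≥

    short : All (λ r' → length r' ≤ a) T₂
    short = All-lengths below≡ l₂≤

    short′ : All (λ r' → length r' ≤ length r) T₂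
    short′ = subst (λ n → All (λ r' → length r' ≤ n) T₂) (sym row≡) short

    length-row : ∀ {S} → length (r ++ [ S ]) ≡ P
    length-row = ≡.trans (length-++ r) (≡.trans (+-comm (length r) 1) (cong suc row≡))

    index≡ : length l₁ ≡ length T₁
    index≡ = ≡.trans (cong length (sym above≡)) (length-map length T₁)

    length∈ρ-above : ∀ {r'} → r' ∈ T₁ → length r' ∈ ρ
    length∈ρ-above r'∈ = ∈-resp-↭ rest↭ (∈-++⁺ˡ (subst (_ ∈_) above≡ (∈-map⁺ length r'∈)))

    length∈ρ-below : ∀ {r'} → r' ∈ T₂ → length r' ∈ ρ
    length∈ρ-below r'∈ = ∈-resp-↭ rest↭ (∈-++⁺ʳ l₁ (subst (_ ∈_) below≡ (∈-map⁺ length r'∈)))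

    open Corner T₁ r T₂ short′ public

  data Decomposed : Filling → Set where
    decomposed : ∀ {T₁ r T₂} S → Parts T₁ r T₂ → Decomposed (withCorner T₁ r S T₂)

  decompose : ∀ T → map length T ≡ l₁ ++ P ∷ l₂ → Decomposed T
  decompose T e with split-map T l₁ e
  ... | T₁ , r , T₂ , ≡.refl , e₁ , er , e₂ with initLast r
  ...   | r' ∷ʳ′ S = decomposed S (parts e₁
    (suc-injective (≡.trans (+-comm 1 _) (≡.trans (sym (length-++ r')) er))) e₂)

  module WithParts {T₁ r T₂} (π : Parts T₁ r T₂) where
    open Parts π

    flagged⁻ : ∀ {g l S} → Flagged g l (T S) →
      (All (All CellOK) T₁ × All CellOK r × CellOK S × All (All CellOK) T₂) ×
      (All (Bounded g) T₁ × All (All (_≤ g P)) r × All (_≤ g P) S × All (Bounded g) T₂)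
    flagged⁻ {g} {l} {S} F = (All.++⁻ˡ T₁ cells , All.++⁻ˡ r (row cells) , All.head (All.++⁻ʳ r (row cells)) , below cells) ,
      (All.++⁻ˡ T₁ bounded , All.++⁻ˡ r brow , All.head (All.++⁻ʳ r brow) , below bounded)
      where
      open Flagged F
      row : ∀ {Q : Row → Set} → All Q (T S) → Q (r ++ [ S ])
      row q = All.head (All.++⁻ʳ T₁ q)
      below : ∀ {Q : Row → Set} → All Q (T S) → All Q T₂
      below q = All.tail (All.++⁻ʳ T₁ q)
      brow : All (All (_≤ g P)) (r ++ [ S ])
      brow = subst (λ n → All (All (_≤ g n)) (r ++ [ S ])) length-row (row bounded)

    flagged⁺ : ∀ {g S} → All (All CellOK) T₁ → All CellOK r → CellOK S → All (All CellOK) T₂ →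
      All (Bounded g) T₁ → All (All (_≤ g P)) r → All (_≤ g P) S → All (Bounded g) T₂ →
      RowsWeak B → LeftOf S → ColsStrict B → AboveOf S → Flagged g (l₁ ++ P ∷ l₂) (T S)
    flagged⁺ {g} {S} c₁ cr cS c₂ b₁ br bS b₂ rw left cs above = flagged
      (++-congᵐ above≡ length-row below≡)
      (All.++⁺ c₁ (All.++⁺ cr (cS ∷ []) ∷ c₂))
      (All.++⁺ b₁ (subst (λ n → All (All (_≤ g n)) (r ++ [ S ])) (sym length-row) (All.++⁺ br (bS ∷ [])) ∷ b₂))
      (rowsWeak⁺ S rw left) (colsStrict⁺ S cs above)

    f-P : f P ≡ R
    f-P = bound-≤ ρ ≤-refl

    -- Each cell of a row of the same length has a cell of the corner row below it in its column,
    -- and the entries of that cell are at most `R`.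
    above-corner-row : ∀ {S r'} → Flagged f (l₁ ++ P ∷ l₂) (T S) → r' ∈ T₁ → length r' ≡ P →
      All (All (_≤ length ρ)) r'
    above-corner-row {S} {r'} F r'∈ len = All.tabulate λ s∈ → All.tabulate λ x∈ → ≤-pred (entry s∈ x∈)
      where
      open Flagged F
      entry : ∀ {s x} → s ∈ r' → x ∈ s → x < R
      entry s∈ x∈ with ∈-nth s∈ | ∈-nth r'∈
      ... | k , ek | i , ei with nth-just (r ++ [ S ]) {k} (subst (k <_) (≡.trans len (sym length-row)) (nth-< r' ek))
      ...   | s₀ , e₀ with nonempty (All.lookup (All.lookup cells (∈-++⁺ʳ T₁ (here ≡.refl))) (nth-∈ (r ++ [ S ]) e₀))
      ...     | y , y∈ = <-≤-trans
        (colsStrict (nth-< T₁ ei) (nth-at (T S) (nth-++ˡ T₁ _ ei) ek) (at-row⁺ T₁ (r ++ [ S ]) T₂ e₀) x∈ y∈)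
        (subst (y ≤_) (≡.trans (cong f length-row) f-P)
          (All.lookup (All.lookup (All.lookup bounded (∈-++⁺ʳ T₁ (here ≡.refl))) (nth-∈ (r ++ [ S ]) e₀)) y∈))

    remove : Flagged f (l₁ ++ P ∷ l₂) (T [ R ]) → Flagged fᵛ (l₁ ++ a ∷ l₂) B
    remove F = let (c₁ , cr , _ , c₂) , (b₁ , br , _ , b₂) = flagged⁻ F in flagged
      (++-congᵐ above≡ row≡ below≡)
      (All.++⁺ c₁ (cr ∷ c₂))
      (All.++⁺ (All.tabulate λ {r'} r'∈ → upper r'∈ (m≤n⇒m<n∨m≡n (All.lookup long r'∈)) (All.lookup b₁ r'∈))
        (subst (λ n → All (All (_≤ n)) r) (≡.trans f-P (sym (bound-≤ ρ (≤-reflexive row≡)))) br ∷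
         All.tabulate λ {r'} r'∈ → subst (λ n → All (All (_≤ n)) r')
           (≡.trans (bound-≤ ρ (m≤n⇒m≤1+n (All.lookup short r'∈))) (sym (bound-≤ ρ (All.lookup short r'∈))))
           (All.lookup b₂ r'∈)))
      (rowsWeak⁻ [ R ] (Flagged.rowsWeak F)) (colsStrict⁻ [ R ] (Flagged.colsStrict F))
      where
      upper : ∀ {r'} → r' ∈ T₁ → P < length r' ⊎ P ≡ length r' → Bounded f r' → Bounded fᵛ r'
      upper {r'} r'∈ (inj₁ P<) b = subst (λ n → All (All (_≤ n)) r')
        (≡.trans (bound-> ρ P<) (sym (bound-> ρ (<-trans (n<1+n a) P<)))) b
      upper {r'} r'∈ (inj₂ P≡) _ = subst (λ n → All (All (_≤ n)) r')
        (≡.trans (sym (here-bound (subst (_∈ ρ) (sym P≡) (length∈ρ-above r'∈))))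
          (≡.trans (sym (bound-> ρ (n<1+n a))) (cong fᵛ P≡)))
        (above-corner-row F r'∈ (sym P≡))

    fᵛ-above : ∀ {r'} → r' ∈ T₁ → fᵛ (length r') ≡ bound ρ (length r')
    fᵛ-above r'∈ = bound-> ρ (All.lookup long r'∈)

    fᵛ≤f : ∀ {r'} → r' ∈ T₁ → fᵛ (length r') ≤ f (length r')
    fᵛ≤f {r'} r'∈ with m≤n⇒m<n∨m≡n (All.lookup long r'∈)
    ... | inj₁ P< = ≤-reflexive (≡.trans (fᵛ-above r'∈) (sym (bound-> ρ P<)))
    ... | inj₂ P≡ = ≤-trans (≤-reflexive (fᵛ-above r'∈)) (≤-trans (bound≤length ρ (length r'))
      (≤-trans (n≤1+n _) (≤-reflexive (≡.trans (sym f-P) (cong f P≡)))))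

    restore : Flagged fᵛ (l₁ ++ a ∷ l₂) B → Flagged f (l₁ ++ P ∷ l₂) (T [ R ])
    restore F = flagged⁺ (All.++⁻ˡ T₁ cells) (All.head c₂) ((λ ()) , ([] ∷ []) , (s≤s z≤n ∷ [])) (All.tail c₂)
      (All.tabulate λ {r'} r'∈ → All.map (All.map (λ x≤ → ≤-trans x≤ (fᵛ≤f r'∈))) (All.lookup b₁ r'∈))
      (subst (λ n → All (All (_≤ n)) r) (sym f-P) br)
      (≤-reflexive (sym f-P) ∷ [])
      (All.tabulate λ {r'} r'∈ → subst (λ n → All (All (_≤ n)) r')
        (≡.trans (bound-≤ ρ (All.lookup short r'∈)) (sym (bound-≤ ρ (m≤n⇒m≤1+n (All.lookup short r'∈)))))
        (All.lookup (All.tail b₂) r'∈))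
      rowsWeak (λ where e x∈ (here ≡.refl) → All.lookup (All.lookup br (nth-∈ r e)) x∈)
      colsStrict (λ where i< e x∈ (here ≡.refl) → above i< e x∈)
      where
      open Flagged F
      c₂ = All.++⁻ʳ T₁ cells
      b₁ = All.++⁻ˡ T₁ bounded
      b₂ = All.++⁻ʳ T₁ bounded
      br : All (All (_≤ R)) r
      br = subst (λ n → All (All (_≤ n)) r) (bound-≤ ρ (≤-reflexive row≡)) (All.head b₂)
      above : ∀ {i s x} → i < length T₁ → at B i (length r) ≡ just s → x ∈ s → x < R
      above i< e x∈ with at-above T₁ r T₂ i< e
      ... | r' , r'∈ , e' = s≤s (≤-trans (All.lookup (All.lookup (All.lookup b₁ r'∈) (nth-∈ r' e')) x∈)
        (≤-trans (≤-reflexive (fᵛ-above r'∈)) (bound≤length ρ (length r'))))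

  decomposeᵛ : ∀ B → map length B ≡ l₁ ++ a ∷ l₂ →
    Σ Filling λ T₁ → Σ Row λ r → Σ Filling λ T₂ → B ≡ T₁ ++ r ∷ T₂ × Parts T₁ r T₂
  decomposeᵛ B e = let T₁ , r , T₂ , e₀ , e₁ , er , e₂ = split-map B l₁ e in
    T₁ , r , T₂ , e₀ , parts e₁ er e₂

  addCorner : Filling → Filling
  addCorner = modify (_++ [ [ R ] ]) (length l₁)

  addCorner≡ : ∀ {T₁ r T₂} → Parts T₁ r T₂ → addCorner (T₁ ++ r ∷ T₂) ≡ withCorner T₁ r [ R ] T₂
  addCorner≡ {T₁} {r} {T₂} π = ≡.trans
    (cong (λ n → modify (_++ [ [ R ] ]) n (T₁ ++ r ∷ T₂)) (Parts.index≡ π)) (modify-++ _ T₁ r T₂)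

  addCorner-injective : ∀ {T U} → addCorner T ≡ addCorner U → T ≡ U
  addCorner-injective = modify-injective (_++ [ [ R ] ]) (λ {x} {y} e → ++-cancelʳ [ [ R ] ] x y e) (length l₁)

  Added : ℕ → Filling → Set
  Added j = Image addCorner (Later (FlaggedOfSize fᵛ (l₁ ++ a ∷ l₂)) j)

  added⇒ : ∀ j T → Added j T → FlaggedOfSize f (l₁ ++ P ∷ l₂) j T
  added⇒ (suc j) T (B , (F , e) , ≡.refl) with decomposeᵛ B (Flagged.shape≡ F)
  ... | T₁ , r , T₂ , ≡.refl , π rewrite addCorner≡ π =
    WithParts.restore π F , ≡.trans (size-corner r [ R ] T₂ T₁) (cong suc e)

  ⇒added : ∀ j {T₁ r T₂} (π : Parts T₁ r T₂) →
    FlaggedOfSize f (l₁ ++ P ∷ l₂) j (withCorner T₁ r [ R ] T₂) → Added j (withCorner T₁ r [ R ] T₂)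
  ⇒added j {T₁} {r} {T₂} π (F , e) with ≡.trans (sym (size-corner r [ R ] T₂ T₁)) e
  ... | ≡.refl = T₁ ++ r ∷ T₂ , (WithParts.remove π F , ≡.refl) , sym (addCorner≡ π)

  added-corner : ∀ {j T} → Added j T → at T (length l₁) a ≡ just [ R ]
  added-corner {suc j} (B , (F , e) , ≡.refl) with decomposeᵛ B (Flagged.shape≡ F)
  ... | T₁ , r , T₂ , ≡.refl , π rewrite addCorner≡ π =
    ≡.subst₂ (λ i k → at (withCorner T₁ r [ R ] T₂) i k ≡ just [ R ]) (sym (Parts.index≡ π)) (Parts.row≡ π)
      (at-corner r [ R ] T₂ T₁)

  counted-added : ∀ {N} → Counted (FlaggedOfSize fᵛ (l₁ ++ a ∷ l₂)) N → Counted Added (shift N)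
  counted-added c = Counted-map addCorner addCorner-injective (Counted-shift c)

  -- All rows have length at least `P` here, and there are `R` of them, the corner being in the
  -- last. Along a strict column of positive integers the i-th row has entries at least i, so those
  -- of the corner are at least `R`, while its flag is `R`.
  module OnlyCorner (ρ≥ : All (P ≤_) ρ) where

    l₂-empty : l₂ ≡ []
    l₂-empty = go l₂ l₂≤ (All.++⁻ʳ l₁ (All-resp-↭ (↭-sym rest↭) ρ≥))
      where
      go : ∀ l → All (_≤ a) l → All (P ≤_) l → l ≡ []
      go []      _          _          = ≡.refl
      go (d ∷ l) (d≤a ∷ _) (P≤d ∷ _) = ⊥-elim (<⇒≱ P≤d d≤a)

    length-l₁ : length l₁ ≡ length ρ
    length-l₁ = ≡.trans (cong length (sym (≡.trans (cong (l₁ ++_) l₂-empty) (++-identityʳ l₁)))) (↭-length rest↭)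

    column-grows : ∀ {T₁ r T₂} (π : Parts T₁ r T₂) {S} → Flagged f (l₁ ++ P ∷ l₂) (withCorner T₁ r S T₂) →
      ∀ i {s} → i ≤ length T₁ → at (withCorner T₁ r S T₂) i a ≡ just s → ∀ {x} → x ∈ s → suc i ≤ x
    column-grows {T₁} {r} {T₂} π {S} F zero _ e x∈ = let r' , r'∈ , s∈ = at-∈ (withCorner T₁ r S T₂) e in
      All.lookup (proj₂ (proj₂ (All.lookup (All.lookup (Flagged.cells F) r'∈) s∈))) x∈
    column-grows {T₁} {r} {T₂} π {S} F (suc i) i<n e x∈ with nth-just T₁ {i} i<n
    ... | r' , er with nth-just r' {a} (All.lookup (Parts.long π) (nth-∈ T₁ er))
    ...   | s' , es with nonempty (All.lookup (All.lookup (Flagged.cells F) (∈-++⁺ˡ (nth-∈ T₁ er))) (nth-∈ r' es))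
    ...     | y , y∈ = ≤-trans (s≤s (column-grows π F i (<⇒≤ i<n) e' y∈)) (Flagged.colsStrict F (n<1+n i) e' e y∈ x∈)
      where
      e' : at (withCorner T₁ r S T₂) i a ≡ just s'
      e' = nth-at (withCorner T₁ r S T₂) (nth-++ˡ T₁ _ er) es

    only : ∀ j T → FlaggedOfSize f (l₁ ++ P ∷ l₂) j T → Added j T
    only j T (F , e) with decompose T (Flagged.shape≡ F)
    ... | decomposed {T₁} {r} {T₂} S π = go S F e (proj₁ (proj₂ cS)) (proj₁ cS) S≥R bS
      where
      cS = proj₁ (proj₂ (proj₂ (proj₁ (WithParts.flagged⁻ π F))))
      bS : All (_≤ R) S
      bS = subst (λ n → All (_≤ n) S) (WithParts.f-P π) (proj₁ (proj₂ (proj₂ (proj₂ (WithParts.flagged⁻ π F)))))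
      S≥R : All (R ≤_) S
      S≥R = All.tabulate λ x∈ → subst (λ n → suc n ≤ _) (≡.trans (sym (Parts.index≡ π)) length-l₁)
        (column-grows π F (length T₁) ≤-refl
          (subst (λ k → at (withCorner T₁ r S T₂) (length T₁) k ≡ just S) (Parts.row≡ π) (at-corner r S T₂ T₁)) x∈)
      go : ∀ S → Flagged f (l₁ ++ P ∷ l₂) (withCorner T₁ r S T₂) → size (withCorner T₁ r S T₂) ≡ j →
        AllPairs _<_ S → S ≢ [] → All (R ≤_) S → All (_≤ R) S → Added j (withCorner T₁ r S T₂)
      go []          _ _ _ S≢[] _ _ = ⊥-elim (S≢[] ≡.refl)
      go (x ∷ [])    F e _ _ (R≤x ∷ _) (x≤R ∷ _) with ≤-antisym R≤x x≤R
      ... | ≡.refl = ⇒added j π (F , e)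
      go (x ∷ y ∷ S) _ _ ((x<y ∷ _) ∷ _) _ (R≤x ∷ _) (_ ∷ y≤R ∷ _) = ⊥-elim (<⇒≱ x<y (≤-trans y≤R R≤x))

    counted : ∀ {N} → Counted (FlaggedOfSize fᵛ (l₁ ++ a ∷ l₂)) N → Counted (FlaggedOfSize f (l₁ ++ P ∷ l₂)) (shift N)
    counted c = Counted-⇔ added⇒ only (counted-added c)

module MoveCell
  {a b : ℕ} (ρ₂ : List ℕ) {ρ₁ l₁ l₂ : List ℕ}
  (ρ₂≥ : All (suc a ≤_) ρ₂) (b≤a : b ≤ a) (gap : All (λ d → d ≤ b ⊎ suc a < d) ρ₁)
  (l₁≥ : All (suc a ≤_) l₁) (l₂≤ : All (_≤ a) l₂)
  (l↭ : l₁ ++ suc a ∷ l₂ ↭ suc a ∷ ρ₂ ++ b ∷ ρ₁)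
  where

  private
    ρ : List ℕ
    ρ = ρ₂ ++ b ∷ ρ₁

  b<P : b < suc a
  b<P = s≤s b≤a

  -- By the gap, `suc a` can occur only in `ρ₂`. All entries of `ρ₂` are at least `suc a`, so
  -- already the first of them is found by `bound`.
  here-bound : suc a ∈ ρ → bound ρ (suc a) ≡ length ρ
  here-bound P∈ with ∈-++⁻ ρ₂ P∈
  ... | inj₂ (here P≡b) = ⊥-elim (<-irrefl (sym P≡b) b<P)
  ... | inj₂ (there P∈ρ₁) with All.lookup gap P∈ρ₁
  ...   | inj₁ P≤b = ⊥-elim (<⇒≱ b<P P≤b)
  ...   | inj₂ P<P = ⊥-elim (<-irrefl ≡.refl P<P)
  here-bound P∈ | inj₁ P∈ρ₂ = go ρ₂ ρ₂≥ P∈ρ₂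
    where
    go : ∀ ρ₂ → All (suc a ≤_) ρ₂ → suc a ∈ ρ₂ → bound (ρ₂ ++ b ∷ ρ₁) (suc a) ≡ length (ρ₂ ++ b ∷ ρ₁)
    go (c ∷ ρ₂) (P≤c ∷ _) _ = bound-≤ (ρ₂ ++ b ∷ ρ₁) P≤c

  open CornerCell a ρ l₁ l₂ l₁≥ l₂≤ l↭ here-bound public

  private
    l : List ℕ
    l = l₁ ++ P ∷ l₂

  fˢ : ℕ → ℕ
  fˢ = bound (b ∷ ρ₂ ++ P ∷ ρ₁)

  length-swap : length (ρ₂ ++ P ∷ ρ₁) ≡ length ρ
  length-swap = ≡.trans (length-++ ρ₂) (sym (length-++ ρ₂))

  fˢ-small : ∀ {p} → p ≤ b → fˢ p ≡ R
  fˢ-small p≤b = ≡.trans (bound-≤ (ρ₂ ++ P ∷ ρ₁) p≤b) (cong suc length-swap)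

  fˢ-large : ∀ {p} → P < p → fˢ p ≡ f p
  fˢ-large P<p = ≡.trans (bound-> (ρ₂ ++ P ∷ ρ₁) (<-trans b<P P<p))
    (≡.trans (bound-replace ρ₂ P<p (<-trans b<P P<p)) (sym (bound-> ρ P<p)))

  fˢ-P : fˢ P ≡ length ρ
  fˢ-P = ≡.trans (bound-> (ρ₂ ++ P ∷ ρ₁) b<P) (≡.trans (go ρ₂ ρ₂≥) length-swap)
    where
    go : ∀ ρ₂ → All (P ≤_) ρ₂ → bound (ρ₂ ++ P ∷ ρ₁) P ≡ length (ρ₂ ++ P ∷ ρ₁)
    go []       _         = bound-≤ ρ₁ ≤-refl
    go (c ∷ ρ₂) (P≤c ∷ _) = bound-≤ (ρ₂ ++ P ∷ ρ₁) P≤c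

  fˢ≤f : ∀ p → fˢ p ≤ f p
  fˢ≤f p with p ≤? P
  ... | yes p≤P = ≤-trans (bound≤length (b ∷ ρ₂ ++ P ∷ ρ₁) p)
    (≤-reflexive (≡.trans (cong suc length-swap) (sym (bound-≤ ρ p≤P))))
  ... | no p≰P  = ≤-reflexive (fˢ-large (≰⇒> p≰P))

  -- At lengths from `b + 1` to `a` the flag `fˢ` is smaller than `f`, but by the gap no row has
  -- such a length.
  small-part : ∀ {p} → p ∈ ρ → p ≤ a → p ≤ b
  small-part p∈ p≤a with ∈-++⁻ ρ₂ p∈
  ... | inj₁ p∈ρ₂          = ⊥-elim (<⇒≱ (All.lookup ρ₂≥ p∈ρ₂) p≤a)
  ... | inj₂ (here ≡.refl) = ≤-refl
  ... | inj₂ (there p∈ρ₁) with All.lookup gap p∈ρ₁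
  ...   | inj₁ p≤b = p≤b
  ...   | inj₂ P<p = ⊥-elim (<⇒≱ P<p (m≤n⇒m≤1+n p≤a))

  module _ {T₁ r T₂} (π : Parts T₁ r T₂) where
    open Parts π
    open WithParts π

    raise : ∀ {T} → Flagged fˢ l T → Flagged f l T
    raise F = record
      { shape≡ = shape≡ ; cells = cells ; rowsWeak = rowsWeak ; colsStrict = colsStrict
      ; bounded = All.map (All.map (All.map (λ x≤ → ≤-trans x≤ (fˢ≤f _)))) bounded
      }
      where open Flagged F

    corner-small : ∀ {S} → Flagged fˢ l (T S) → All (_≤ length ρ) S
    corner-small {S} F = subst (λ n → All (_≤ n) S) fˢ-P (proj₁ (proj₂ (proj₂ (proj₂ (flagged⁻ F)))))

    -- If `R` is missing, the corner is bounded by `R - 1`, and so are the cells to its left; rows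
    -- of the same length above are bounded by column strictness in any case. On all other rows of
    -- the shape `fˢ` and `f` agree.
    lower : ∀ {S} → Flagged f l (T S) → R ∉ S → Flagged fˢ l (T S)
    lower {S} F R∉S = let (c₁ , cr , cS , c₂) , (b₁ , br , bS , b₂) = flagged⁻ F in
      flagged⁺ c₁ cr cS c₂
        (All.tabulate λ {r'} r'∈ → upper r'∈ (m≤n⇒m<n∨m≡n (All.lookup long r'∈)) (All.lookup b₁ r'∈))
        (subst (λ n → All (All (_≤ n)) r) (sym fˢ-P) (All.tabulate λ s∈ → All.tabulate λ x∈ → rowEntry cS bS s∈ x∈))
        (subst (λ n → All (_≤ n) S) (sym fˢ-P) (All.tabulate (cornerEntry bS)))
        (All.tabulate λ {r'} r'∈ → subst (λ n → All (All (_≤ n)) r')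
          (≡.trans (bound-≤ ρ (m≤n⇒m≤1+n (All.lookup short r'∈)))
            (sym (fˢ-small (small-part (length∈ρ-below r'∈) (All.lookup short r'∈)))))
          (All.lookup b₂ r'∈))
        (rowsWeak⁻ S (Flagged.rowsWeak F)) (leftOf S (Flagged.rowsWeak F))
        (colsStrict⁻ S (Flagged.colsStrict F)) (aboveOf S (Flagged.colsStrict F))
      where
      upper : ∀ {r'} → r' ∈ T₁ → P < length r' ⊎ P ≡ length r' → Bounded f r' → Bounded fˢ r'
      upper {r'} r'∈ (inj₁ P<) b = subst (λ n → All (All (_≤ n)) r') (sym (fˢ-large P<)) b
      upper {r'} r'∈ (inj₂ P≡) _ = subst (λ n → All (All (_≤ n)) r')
        (≡.trans (sym fˢ-P) (cong fˢ P≡)) (above-corner-row F r'∈ (sym P≡))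
      cornerEntry : All (_≤ f P) S → ∀ {y} → y ∈ S → y ≤ length ρ
      cornerEntry bS y∈ = ≤-pred (≤∧≢⇒< (subst (_ ≤_) f-P (All.lookup bS y∈)) (λ where ≡.refl → R∉S y∈))
      rowEntry : CellOK S → All (_≤ f P) S → ∀ {s x} → s ∈ r → x ∈ s → x ≤ length ρ
      rowEntry cS bS s∈ x∈ with nonempty cS | ∈-nth s∈
      ... | y , y∈ | k , e = ≤-trans (leftOf S (Flagged.rowsWeak F) e x∈ y∈) (cornerEntry bS y∈)

    join : ∀ {S} → Flagged fˢ l (T S) → Flagged f l (T (S ++ [ R ]))
    join {S} Fˢ = let F = raise Fˢ ; (c₁ , cr , cS , c₂) , (b₁ , br , bS , b₂) = flagged⁻ F ; y , y∈ = nonempty cS in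
      flagged⁺ c₁ cr
        ( (λ e → case-empty S e)
        , AllPairs.++⁺ (proj₁ (proj₂ cS)) ([] ∷ []) (All.map (λ y≤ → s≤s y≤ ∷ []) (corner-small Fˢ))
        , All.++⁺ (proj₂ (proj₂ cS)) (s≤s z≤n ∷ []))
        c₂ b₁ br (All.++⁺ bS (≤-reflexive (sym f-P) ∷ [])) b₂
        (rowsWeak⁻ S (Flagged.rowsWeak F))
        (λ e x∈ z∈ → left F br e x∈ (∈-++⁻ S z∈))
        (colsStrict⁻ S (Flagged.colsStrict F))
        (λ i< e x∈ z∈ → above F y∈ (All.lookup bS y∈) i< e x∈ (∈-++⁻ S z∈))
      where
      case-empty : ∀ S → S ++ [ R ] ≢ []
      case-empty []      ()
      case-empty (_ ∷ _) ()
      left : Flagged f l (T S) → All (All (_≤ f P)) r → ∀ {k s x z} → nth r k ≡ just s → x ∈ s → z ∈ S ⊎ z ∈ [ R ] → x ≤ z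
      left F br e x∈ (inj₁ z∈)            = leftOf S (Flagged.rowsWeak F) e x∈ z∈
      left F br e x∈ (inj₂ (here ≡.refl)) = subst (_ ≤_) f-P (All.lookup (All.lookup br (nth-∈ r e)) x∈)
      above : Flagged f l (T S) → ∀ {y} → y ∈ S → y ≤ f P → ∀ {i s x z} → i < length T₁ → at B i (length r) ≡ just s →
        x ∈ s → z ∈ S ⊎ z ∈ [ R ] → x < z
      above F y∈ y≤ i< e x∈ (inj₁ z∈)            = aboveOf S (Flagged.colsStrict F) i< e x∈ z∈
      above F y∈ y≤ i< e x∈ (inj₂ (here ≡.refl)) =
        <-≤-trans (aboveOf S (Flagged.colsStrict F) i< e x∈ y∈) (subst (_ ≤_) f-P y≤)

    unjoin : ∀ {S} → S ≢ [] → Flagged f l (T (S ++ [ R ])) → Flagged fˢ l (T S)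
    unjoin {S} S≢[] F = let (c₁ , cr , cS , c₂) , (b₁ , br , bS , b₂) = flagged⁻ F ; S↗ , _ , S<R = AllPairs-++⁻ S (proj₁ (proj₂ cS)) in
      lower (flagged⁺ c₁ cr (S≢[] , S↗ , All.++⁻ˡ S (proj₂ (proj₂ cS))) c₂ b₁ br (All.++⁻ˡ S bS) b₂
        (rowsWeak⁻ (S ++ [ R ]) (Flagged.rowsWeak F))
        (λ e x∈ z∈ → leftOf (S ++ [ R ]) (Flagged.rowsWeak F) e x∈ (∈-++⁺ˡ z∈))
        (colsStrict⁻ (S ++ [ R ]) (Flagged.colsStrict F))
        (λ i< e x∈ z∈ → aboveOf (S ++ [ R ]) (Flagged.colsStrict F) i< e x∈ (∈-++⁺ˡ z∈)))
        (λ R∈S → <-irrefl ≡.refl (All.head (All.lookup S<R R∈S)))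

  joinCorner : Filling → Filling
  joinCorner = modify (growLast R) (length l₁)

  joinCorner≡ : ∀ {T₁ r T₂} (π : Parts T₁ r T₂) S →
    joinCorner (withCorner T₁ r S T₂) ≡ withCorner T₁ r (S ++ [ R ]) T₂
  joinCorner≡ {T₁} {r} {T₂} π S = ≡.trans
    (cong (λ n → modify (growLast R) n (withCorner T₁ r S T₂)) (Parts.index≡ π))
    (≡.trans (modify-++ _ T₁ (r ++ [ S ]) T₂) (cong (λ r' → T₁ ++ r' ∷ T₂) (growLast-∷ʳ R r S)))

  Joined : ℕ → Filling → Set
  Joined j = Image joinCorner (Later (FlaggedOfSize fˢ l) j)

  Lowered : ℕ → Filling → Set
  Lowered = FlaggedOfSize fˢ l

  size-joined : ∀ T₁ r T₂ S → size (withCorner T₁ r (S ++ [ R ]) T₂) ≡ suc (size (withCorner T₁ r S T₂))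
  size-joined T₁ r T₂ S = ≡.trans (size-corner r (S ++ [ R ]) T₂ T₁)
    (≡.trans (cong (_+ size (T₁ ++ r ∷ T₂)) (≡.trans (length-++ S) (+-comm (length S) 1)))
      (cong suc (sym (size-corner r S T₂ T₁))))

  corner-at : ∀ {T₁ r T₂} (π : Parts T₁ r T₂) S → at (withCorner T₁ r S T₂) (length l₁) a ≡ just S
  corner-at {T₁} {r} {T₂} π S =
    ≡.subst₂ (λ i k → at (withCorner T₁ r S T₂) i k ≡ just S) (sym (Parts.index≡ π)) (Parts.row≡ π)
      (at-corner r S T₂ T₁)

  joined⇒ : ∀ j T → Joined j T → FlaggedOfSize f l j T
  joined⇒ (suc j) T (U , (F , e) , ≡.refl) with decompose U (Flagged.shape≡ F)
  ... | decomposed {T₁} {r} {T₂} S π rewrite joinCorner≡ π S = join π F , ≡.trans (size-joined T₁ r T₂ S) (cong suc e)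

  ⇒joined : ∀ j {T₁ r T₂} (π : Parts T₁ r T₂) S → S ≢ [] →
    FlaggedOfSize f l j (withCorner T₁ r (S ++ [ R ]) T₂) → Joined j (withCorner T₁ r (S ++ [ R ]) T₂)
  ⇒joined j {T₁} {r} {T₂} π S S≢[] (F , e) with ≡.trans (sym (size-joined T₁ r T₂ S)) e
  ... | ≡.refl = withCorner T₁ r S T₂ , (unjoin π S≢[] F , ≡.refl) , sym (joinCorner≡ π S)

  Cases : ℕ → Filling → Set
  Cases j T = Added j T ⊎ (Lowered j T ⊎ Joined j T)

  cases⇒ : ∀ j T → Cases j T → FlaggedOfSize f l j T
  cases⇒ j T (inj₁ x)              = added⇒ j T x
  cases⇒ j T (inj₂ (inj₁ (F , e))) with decompose T (Flagged.shape≡ F)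
  ... | decomposed S π = raise π F , e
  cases⇒ j T (inj₂ (inj₂ x))       = joined⇒ j T x

  ⇒cases : ∀ j T → FlaggedOfSize f l j T → Cases j T
  ⇒cases j T (F , e) with decompose T (Flagged.shape≡ F)
  ... | decomposed {T₁} {r} {T₂} S π = go (cornerView R S (proj₁ (proj₂ cS)) bS) F e
    where
    cS = proj₁ (proj₂ (proj₂ (proj₁ (WithParts.flagged⁻ π F))))
    bS : All (_≤ R) S
    bS = subst (λ n → All (_≤ n) S) (WithParts.f-P π) (proj₁ (proj₂ (proj₂ (proj₂ (WithParts.flagged⁻ π F)))))
    go : ∀ {S} → CornerView R S → Flagged f l (withCorner T₁ r S T₂) → size (withCorner T₁ r S T₂) ≡ j →
      Cases j (withCorner T₁ r S T₂)
    go (avoiding R∉S)     F e = inj₂ (inj₁ (lower π F R∉S , e))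
    go alone              F e = inj₁ (⇒added j π (F , e))
    go (joined {S} S≢[]) F e = inj₂ (inj₂ (⇒joined j π S S≢[] (F , e)))

  lowered-corner : ∀ {j T} → Lowered j T → ∃ λ S → at T (length l₁) a ≡ just S × R ∉ S
  lowered-corner {T = T} (F , e) with decompose T (Flagged.shape≡ F)
  ... | decomposed S π = S , corner-at π S , λ R∈S → <-irrefl ≡.refl (All.lookup (corner-small π F) R∈S)

  joined-corner : ∀ {j T} → Joined j T → ∃ λ S → at T (length l₁) a ≡ just (S ++ [ R ]) × S ≢ []
  joined-corner {suc j} (U , (F , e) , ≡.refl) with decompose U (Flagged.shape≡ F)
  ... | decomposed S π rewrite joinCorner≡ π S = S , corner-at π (S ++ [ R ]) ,
    proj₁ (proj₁ (proj₂ (proj₂ (proj₁ (WithParts.flagged⁻ π F)))))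

  lowered-joined : ∀ j T → Lowered j T → Joined j T → ⊥
  lowered-joined j T p q with lowered-corner p | joined-corner {j} q
  ... | S , e , R∉S | S' , e' , _ = R∉S (subst (R ∈_) (just-injective (≡.trans (sym e') e)) (∈-++⁺ʳ S' (here ≡.refl)))

  added-others : ∀ j T → Added j T → Lowered j T ⊎ Joined j T → ⊥
  added-others j T p (inj₁ q) with added-corner {j} p | lowered-corner q
  ... | e | S , e' , R∉S = R∉S (subst (R ∈_) (just-injective (≡.trans (sym e) e')) (here ≡.refl))
  added-others j T p (inj₂ q) with added-corner {j} p | joined-corner {j} q
  ... | e | []    , e' , S≢[] = S≢[] ≡.refl
  ... | e | s ∷ S , e' , _ with ∷-injectiveʳ (just-injective (≡.trans (sym e) e'))
  ...   | q′ = empty S q′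
    where
    empty : ∀ S → [] ≡ S ++ [ R ] → ⊥
    empty []      ()
    empty (_ ∷ _) ()

  counted : ∀ {N M} → Counted (FlaggedOfSize fᵛ (l₁ ++ a ∷ l₂)) N → Counted (FlaggedOfSize fˢ l) M →
    Counted (FlaggedOfSize f l) (λ j → shift N j + (M j + shift M j))
  counted c d = Counted-⇔ cases⇒ ⇒cases (Counted-+ added-others (counted-added c)
    (Counted-+ lowered-joined d
      (Counted-map joinCorner (modify-injective (growLast R) (growLast-injective R) (length l₁)) (Counted-shift d))))

-- Counting flagged tableaux along the transition tree.

Descending : List ℕ → Set
Descending = AllPairs _≥_

record SplitAt (P : ℕ) (l : List ℕ) : Set where
  constructor splitAt
  field
    {l₁ l₂} : List ℕ
    split≡  : l ≡ l₁ ++ P ∷ l₂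
    above   : All (P ≤_) l₁
    below   : All (_< P) l₂

-- The last occurrence of `P` is taken: its row then ends in a corner of the shape, and shortening
-- it by one leaves a partition.
split-descending : ∀ {P l} → Descending l → P ∈ l → SplitAt P l
split-descending {P} {x ∷ l} (x≥l ∷ l↘) P∈ with _∈?_ _≟_ P l
... | yes P∈l = let splitAt e a b = split-descending l↘ P∈l in
  splitAt (cong (x ∷_) e) (All.lookup x≥l P∈l ∷ a) b
... | no P∉l with P∈
...   | there P∈l   = ⊥-elim (P∉l P∈l)
...   | here ≡.refl = splitAt ≡.refl [] (All.tabulate λ d∈ → ≤∧≢⇒< (All.lookup x≥l d∈) (λ where ≡.refl → P∉l d∈))

descending-lower : ∀ l₁ {P a l₂} → a ≤ P → All (_≤ a) l₂ → Descending (l₁ ++ P ∷ l₂) → Descending (l₁ ++ a ∷ l₂)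
descending-lower l₁ a≤P l₂≤ d with AllPairs-++⁻ l₁ d
... | d₁ , (_ ∷ d₂) , cross = AllPairs.++⁺ d₁ (l₂≤ ∷ d₂) (All.map (λ where (P≤ ∷ r) → ≤-trans a≤P P≤ ∷ r) cross)

-- Zero code entries are kept as rows of length 0, so that the row lengths are a rearrangement of
-- the code. Such rows have no cells, hence the two flags need to agree at positive lengths only.
module EmptyRow (f f' : ℕ → ℕ) (agree : ∀ p → f (suc p) ≡ f' (suc p)) (l₁ : List ℕ) where

  addRow⇒ : ∀ j T → Image (_++ [ [] ]) (FlaggedOfSize f l₁ j) T → FlaggedOfSize f' (l₁ ++ [ 0 ]) j T
  addRow⇒ j _ (T , (F , e) , ≡.refl) = flagged
    (≡.trans (map-++ length T [ [] ]) (cong (_++ [ 0 ]) shape≡))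
    (All.++⁺ cells ([] ∷ []))
    (All.++⁺ (All.map bounded⁺ bounded) ([] ∷ []))
    (λ k<k' e e' → rowsWeak k<k' (at⁻ T e) (at⁻ T e'))
    (λ i<i' e e' → colsStrict i<i' (at⁻ T e) (at⁻ T e'))
    , ≡.trans (size-++ T [ [] ]) (≡.trans (+-identityʳ _) e)
    where
    open Flagged F
    at⁻ : ∀ T {i k s} → at (T ++ [ [] ]) i k ≡ just s → at T i k ≡ just s
    at⁻ []      {zero}  {zero}  ()
    at⁻ []      {zero}  {suc k} ()
    at⁻ []      {suc i} ()
    at⁻ (r ∷ T) {zero}  e = e
    at⁻ (r ∷ T) {suc i} e = at⁻ T e
    bounded⁺ : ∀ {r} → Bounded f r → Bounded f' r
    bounded⁺ {[]}    [] = []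
    bounded⁺ {s ∷ r} b  = subst (λ m → All (All (_≤ m)) (s ∷ r)) (agree (length r)) b

  ⇒addRow : ∀ j T → FlaggedOfSize f' (l₁ ++ [ 0 ]) j T → Image (_++ [ [] ]) (FlaggedOfSize f l₁ j) T
  ⇒addRow j T (F , e) with split-map T l₁ (Flagged.shape≡ F)
  ... | T₁ , [] , [] , ≡.refl , e₁ , _ , _ = T₁ , (flagged e₁ (All.++⁻ˡ T₁ cells)
      (All.map bounded⁻ (All.++⁻ˡ T₁ bounded))
      (λ k<k' e e' → rowsWeak k<k' (at⁺ T₁ e) (at⁺ T₁ e'))
      (λ i<i' e e' → colsStrict i<i' (at⁺ T₁ e) (at⁺ T₁ e'))
    , ≡.trans (sym (≡.trans (size-++ T₁ [ [] ]) (+-identityʳ _))) e) , ≡.refl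
    where
    open Flagged F
    at⁺ : ∀ T {i k s} → at T i k ≡ just s → at (T ++ [ [] ]) i k ≡ just s
    at⁺ (r ∷ T) {zero}  e = e
    at⁺ (r ∷ T) {suc i} e = at⁺ T e
    bounded⁻ : ∀ {r} → Bounded f' r → Bounded f r
    bounded⁻ {[]}    [] = []
    bounded⁻ {s ∷ r} b  = subst (λ m → All (All (_≤ m)) (s ∷ r)) (sym (agree (length r))) b

  counted : ∀ {N} → Counted (FlaggedOfSize f l₁) N → Counted (FlaggedOfSize f' (l₁ ++ [ 0 ])) N
  counted c = Counted-⇔ addRow⇒ ⇒addRow (Counted-map (_++ [ [] ]) (λ {x} {y} e → ++-cancelʳ [ [] ] x y e) c)

  counted⁻ : ∀ {N} → Counted (FlaggedOfSize f' (l₁ ++ [ 0 ])) N → Counted (FlaggedOfSize f l₁) N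
  counted⁻ = Counted-preimage (_++ [ [] ]) (take (length l₁))
    (λ j T p → let F , _ = p in ≡.trans (cong (λ m → take m (T ++ [ [] ])) (≡.trans (cong length (sym (Flagged.shape≡ F))) (length-map length T))) (take-length T))
    (λ j T p → addRow⇒ j _ (T , p , ≡.refl)) ⇒addRow
    where
    take-length : ∀ (T : Filling) {U} → take (length T) (T ++ U) ≡ T
    take-length []      = ≡.refl
    take-length (r ∷ T) = cong (r ∷_) (take-length T)

no-rows : ∀ {f T} → Flagged f [] T → T ≡ []
no-rows {T = []}    F = ≡.refl
no-rows {T = _ ∷ _} F with Flagged.shape≡ F
... | ()

counted-empty : Counted (FlaggedOfSize (bound []) []) [0]
counted-empty zero    = [ [] ] , record
  { unique   = [] ∷ []
  ; sound    = λ where _ (here ≡.refl) → flagged ≡.refl [] [] (λ _ ()) (λ _ ()) , ≡.refl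
  ; complete = λ T p → here (no-rows (proj₁ p))
  } , ≡.refl
counted-empty (suc j) = [] , Enumerates-∅ impossible , ≡.refl
  where
  impossible : ∀ T → ¬ FlaggedOfSize (bound []) [] (suc j) T
  impossible T (F , e) with no-rows F
  impossible _ (F , ()) | ≡.refl

∈-shape : ∀ {c : ℕ} {ρ l} → l ↭ c ∷ ρ → c ∈ l
∈-shape l↭ = ∈-resp-↭ (↭-sym l↭) (here ≡.refl)

-- In `move`, the branch for v lowers the part at the corner. The code of w' is a rearrangement of
-- that of w, so its branch keeps the shape and changes only the flag.
countTableaux : ∀ {ρ} (τ : Transition ρ) {l} → Descending l → l ↭ ρ →
  Counted (FlaggedOfSize (bound ρ) l) (tableaux τ)
countTableaux done l↘ l↭ with ↭-empty-inv l↭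
... | ≡.refl = counted-empty
countTableaux (drop0 {ρ} τ) l↘ l↭ with split-descending l↘ (∈-shape l↭)
... | splitAt {l₁} {[]} ≡.refl _ _ = EmptyRow.counted (bound ρ) (bound (0 ∷ ρ)) (λ _ → ≡.refl) l₁
  (countTableaux τ (proj₁ (AllPairs-++⁻ l₁ l↘)) (subst (_↭ ρ) (++-identityʳ l₁) (drop-∷ (trans (↭-sym (↭-shift 0 l₁ [])) l↭))))
... | splitAt {l₂ = _ ∷ _} _ _ (() ∷ _)
countTableaux (corner {a} {ρ} ρ≥ τ) l↘ l↭ with split-descending l↘ (∈-shape l↭)
... | splitAt {l₁} {l₂} ≡.refl l₁≥ l₂< =
  OnlyCorner.counted ρ≥ (countTableaux τ (descending-lower l₁ (n≤1+n a) l₂≤ l↘) (trans (↭-shift a l₁ l₂) (prep a rest↭)))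
  where
  l₂≤ : All (_≤ a) l₂
  l₂≤ = All.map ≤-pred l₂<
  here-bound : ∀ {ρ} → All (suc a ≤_) ρ → bound ρ (suc a) ≡ length ρ
  here-bound []              = ≡.refl
  here-bound {_ ∷ ρ} (P≤c ∷ _) = bound-≤ ρ P≤c
  open CornerCell a ρ l₁ l₂ l₁≥ l₂≤ l↭ (λ _ → here-bound ρ≥)
countTableaux (move {a} {b} ρ₂ {ρ₁} ρ₂≥ b≤a gap τ τ') l↘ l↭ with split-descending l↘ (∈-shape l↭)
... | splitAt {l₁} {l₂} ≡.refl l₁≥ l₂< = counted
  (countTableaux τ (descending-lower l₁ (n≤1+n a) l₂≤ l↘) (trans (↭-shift a l₁ l₂) (prep a rest↭)))
  (countTableaux τ' l↘ (trans l↭ swapped))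
  where
  l₂≤ : All (_≤ a) l₂
  l₂≤ = All.map ≤-pred l₂<
  open MoveCell ρ₂ ρ₂≥ b≤a gap l₁≥ l₂≤ l↭
  swapped : suc a ∷ ρ₂ ++ b ∷ ρ₁ ↭ b ∷ ρ₂ ++ suc a ∷ ρ₁
  swapped = trans (prep (suc a) (↭-shift b ρ₂ ρ₁)) (trans (swap (suc a) b refl) (prep b (↭-sym (↭-shift (suc a) ρ₂ ρ₁))))

-- 0-Hecke words

sortAt : ℕ → List ℕ → List ℕ
sortAt zero    (x ∷ y ∷ l) = (x ⊔ y) ∷ (x ⊓ y) ∷ l
sortAt (suc k) (x ∷ l)     = x ∷ sortAt k l
sortAt _       l           = l

-- `_≈H_` may pass through words with arbitrary indices, so every index has to act. Indices beyond
-- the word act trivially, and so does 0; the braid relation between 0 and 1 then becomes the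
-- idempotence of 1.
letter : ℕ → List ℕ → List ℕ
letter zero    l = l
letter (suc k) l = sortAt k l

-- The 0-Hecke monoid acts on words by sorting adjacent letters in descending order.
act : List ℕ → List ℕ → List ℕ
act []      l = l
act (i ∷ a) l = act a (letter i l)

act-++ : ∀ a b l → act (a ++ b) l ≡ act b (act a l)
act-++ []      b l = ≡.refl
act-++ (i ∷ a) b l = act-++ a b (letter i l)

sortAt-idem : ∀ k l → sortAt k (sortAt k l) ≡ sortAt k l
sortAt-idem zero    []          = ≡.refl
sortAt-idem zero    (x ∷ [])    = ≡.refl
sortAt-idem zero    (x ∷ y ∷ l) = cong₂ (λ a b → a ∷ b ∷ l)
  (m≥n⇒m⊔n≡m x⊓y≤x⊔y) (m≥n⇒m⊓n≡n x⊓y≤x⊔y)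
  where
  x⊓y≤x⊔y : x ⊓ y ≤ x ⊔ y
  x⊓y≤x⊔y = ≤-trans (m⊓n≤m x y) (m≤m⊔n x y)
sortAt-idem (suc k) []      = ≡.refl
sortAt-idem (suc k) (x ∷ l) = cong (x ∷_) (sortAt-idem k l)

-- Both sides sort three adjacent letters in descending order; the two expressions for the middle
-- letter agree because minimum distributes over maximum.
sortAt-braid : ∀ k l → sortAt k (sortAt (suc k) (sortAt k l)) ≡ sortAt (suc k) (sortAt k (sortAt (suc k) l))
sortAt-braid zero []       = ≡.refl
sortAt-braid zero (x ∷ []) = ≡.refl
sortAt-braid zero (x ∷ y ∷ []) = sortAt-idem 0 (x ∷ y ∷ [])
sortAt-braid zero (x ∷ y ∷ z ∷ l) = cong₂ _∷_ max (cong₂ (λ a b → a ∷ b ∷ l) mid min)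
  where
  open ≡-Reasoning
  max : (x ⊔ y) ⊔ ((x ⊓ y) ⊔ z) ≡ x ⊔ (y ⊔ z)
  max = begin
    (x ⊔ y) ⊔ ((x ⊓ y) ⊔ z) ≡⟨ ⊔-assoc (x ⊔ y) (x ⊓ y) z ⟨
    ((x ⊔ y) ⊔ (x ⊓ y)) ⊔ z ≡⟨ cong (_⊔ z) (m≥n⇒m⊔n≡m (≤-trans (m⊓n≤m x y) (m≤m⊔n x y))) ⟩
    (x ⊔ y) ⊔ z             ≡⟨ ⊔-assoc x y z ⟩
    x ⊔ (y ⊔ z)             ∎
  mid : (x ⊔ y) ⊓ ((x ⊓ y) ⊔ z) ≡ (x ⊓ (y ⊔ z)) ⊔ (y ⊓ z)
  mid = begin
    (x ⊔ y) ⊓ ((x ⊓ y) ⊔ z)             ≡⟨ ⊓-distribˡ-⊔ (x ⊔ y) (x ⊓ y) z ⟩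
    ((x ⊔ y) ⊓ (x ⊓ y)) ⊔ ((x ⊔ y) ⊓ z)
      ≡⟨ cong₂ _⊔_ (m≥n⇒m⊓n≡n (≤-trans (m⊓n≤m x y) (m≤m⊔n x y))) (⊓-distribʳ-⊔ z x y) ⟩
    (x ⊓ y) ⊔ ((x ⊓ z) ⊔ (y ⊓ z))       ≡⟨ ⊔-assoc (x ⊓ y) (x ⊓ z) (y ⊓ z) ⟨
    ((x ⊓ y) ⊔ (x ⊓ z)) ⊔ (y ⊓ z)       ≡⟨ cong (_⊔ (y ⊓ z)) (⊓-distribˡ-⊔ x y z) ⟨
    (x ⊓ (y ⊔ z)) ⊔ (y ⊓ z)             ∎
  min : (x ⊓ y) ⊓ z ≡ (x ⊓ (y ⊔ z)) ⊓ (y ⊓ z)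
  min = begin
    (x ⊓ y) ⊓ z             ≡⟨ ⊓-assoc x y z ⟩
    x ⊓ (y ⊓ z)             ≡⟨ cong (x ⊓_) (m≥n⇒m⊓n≡n (≤-trans (m⊓n≤m y z) (m≤m⊔n y z))) ⟨
    x ⊓ ((y ⊔ z) ⊓ (y ⊓ z)) ≡⟨ ⊓-assoc x (y ⊔ z) (y ⊓ z) ⟨
    (x ⊓ (y ⊔ z)) ⊓ (y ⊓ z) ∎
sortAt-braid (suc k) []      = ≡.refl
sortAt-braid (suc k) (x ∷ l) = cong (x ∷_) (sortAt-braid k l)

sortAt-comm : ∀ i j l → suc i < j → sortAt j (sortAt i l) ≡ sortAt i (sortAt j l)
sortAt-comm zero    (suc (suc j)) []          _ = ≡.refl
sortAt-comm zero    (suc (suc j)) (x ∷ [])    _ = ≡.refl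
sortAt-comm zero    (suc (suc j)) (x ∷ y ∷ l) _ = ≡.refl
sortAt-comm zero    (suc zero)    l (s≤s ())
sortAt-comm (suc i) (suc j)       []          _ = ≡.refl
sortAt-comm (suc i) (suc j)       (x ∷ l) (s≤s h) = cong (x ∷_) (sortAt-comm i j l h)

act-relation : ∀ {a b} → HeckeRel a b → ∀ l → act a l ≡ act b l
act-relation (idem zero)             l = ≡.refl
act-relation (idem (suc k))          l = sortAt-idem k l
act-relation (braid zero)            l = sym (sortAt-idem 0 l)
act-relation (braid (suc k))         l = sortAt-braid k l
act-relation (comm zero j _)         l = ≡.refl
act-relation (comm (suc i) (suc j) (s≤s h)) l = sortAt-comm i j l h

act-≈ : ∀ {a b} → a ≈H b → ∀ l → act a l ≡ act b l
act-≈ ≈refl          l = ≡.refl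
act-≈ (≈sym p)       l = sym (act-≈ p l)
act-≈ (≈trans p q)   l = ≡.trans (act-≈ p l) (act-≈ q l)
act-≈ (≈step u v {a} {b} r) l = begin
  act (u ++ a ++ v) l ≡⟨ ≡.trans (act-++ u (a ++ v) l) (act-++ a v (act u l)) ⟩
  act v (act a (act u l)) ≡⟨ cong (act v) (act-relation r (act u l)) ⟩
  act v (act b (act u l)) ≡⟨ ≡.trans (act-++ u (b ++ v) l) (act-++ b v (act u l)) ⟨
  act (u ++ b ++ v) l ∎
  where open ≡-Reasoning

≈H-setoid : Setoid _ _
≈H-setoid = record
  { Carrier       = List ℕ
  ; _≈_           = _≈H_
  ; isEquivalence = record { refl = ≈refl ; sym = ≈sym ; trans = ≈trans }
  }

module ≈H-Reasoning where
  open import Relation.Binary.Reasoning.Setoid ≈H-setoid public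

≡⇒≈H : ∀ {a b} → a ≡ b → a ≈H b
≡⇒≈H ≡.refl = ≈refl

≈H-++ˡ : ∀ p {a b} → a ≈H b → (p ++ a) ≈H (p ++ b)
≈H-++ˡ p ≈refl         = ≈refl
≈H-++ˡ p (≈sym e)      = ≈sym (≈H-++ˡ p e)
≈H-++ˡ p (≈trans e e') = ≈trans (≈H-++ˡ p e) (≈H-++ˡ p e')
≈H-++ˡ p (≈step u v {a} {b} r) = ≡.subst₂ _≈H_ (++-assoc p u (a ++ v)) (++-assoc p u (b ++ v)) (≈step (p ++ u) v r)

≈H-++ʳ : ∀ q {a b} → a ≈H b → (a ++ q) ≈H (b ++ q)
≈H-++ʳ q ≈refl         = ≈refl
≈H-++ʳ q (≈sym e)      = ≈sym (≈H-++ʳ q e)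
≈H-++ʳ q (≈trans e e') = ≈trans (≈H-++ʳ q e) (≈H-++ʳ q e')
≈H-++ʳ q (≈step u v {a} {b} r) = ≡.subst₂ _≈H_ (assoc a) (assoc b) (≈step u (v ++ q) r)
  where
  assoc : ∀ a → u ++ a ++ v ++ q ≡ (u ++ a ++ v) ++ q
  assoc a = sym (≡.trans (++-assoc u (a ++ v) q) (cong (u ++_) (++-assoc a v q)))

map-relation : ∀ {a b} → HeckeRel a b → HeckeRel (map suc a) (map suc b)
map-relation (idem i)     = idem (suc i)
map-relation (braid i)    = braid (suc i)
map-relation (comm i j h) = comm (suc i) (suc j) (s≤s h)

≈H-map : ∀ {a b} → a ≈H b → map suc a ≈H map suc b
≈H-map ≈refl         = ≈refl
≈H-map (≈sym e)      = ≈sym (≈H-map e)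
≈H-map (≈trans e e') = ≈trans (≈H-map e) (≈H-map e')
≈H-map (≈step u v {a} {b} r) = ≡.subst₂ _≈H_ (push a) (push b) (≈step (map suc u) (map suc v) (map-relation r))
  where
  push : ∀ a → map suc u ++ map suc a ++ map suc v ≡ map suc (u ++ a ++ v)
  push a = sym (≡.trans (map-++ suc u (a ++ v)) (cong (map suc u ++_) (map-++ suc a v)))

relation : ∀ {a b} v → HeckeRel a b → (a ++ v) ≈H (b ++ v)
relation v r = ≈step [] v r

down : ℕ → List ℕ
down zero    = []
down (suc c) = suc c ∷ down c

-- The reduced word read off from the Lehmer code.
normalForm : List ℕ → List ℕ
normalForm []       = []
normalForm (c ∷ cs) = down c ++ map suc (normalForm cs)

commute-past : ∀ x u → All (λ y → suc y < x) u → (x ∷ u) ≈H (u ++ [ x ])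
commute-past x []      []       = ≈refl
commute-past x (y ∷ u) (h ∷ hs) = ≈trans (≈sym (relation u (comm y x h))) (≈H-++ˡ [ y ] (commute-past x u hs))

commute-past′ : ∀ x u → All (λ y → suc x < y) u → (u ++ [ x ]) ≈H (x ∷ u)
commute-past′ x []      []       = ≈refl
commute-past′ x (y ∷ u) (h ∷ hs) = ≈trans (≈H-++ˡ [ y ] (commute-past′ x u hs)) (≈sym (relation u (comm x y h)))

down-≤ : ∀ c → All (_≤ c) (down c)
down-≤ zero    = []
down-≤ (suc c) = ≤-refl ∷ All.map m≤n⇒m≤1+n (down-≤ c)

down-≥1 : ∀ c → All (1 ≤_) (down c)
down-≥1 zero    = []
down-≥1 (suc c) = s≤s z≤n ∷ down-≥1 c

normalForm-≥1 : ∀ cs → All (1 ≤_) (normalForm cs)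
normalForm-≥1 []       = []
normalForm-≥1 (c ∷ cs) = All.++⁺ (down-≥1 c) (All.map⁺ (All.map (λ _ → s≤s z≤n) (normalForm-≥1 cs)))

-- The letter j+1 commutes with the larger letters of the run until it meets j+2. The braid relation
-- turns (j+1)(j+2)(j+1) into (j+2)(j+1)(j+2), and the last of these letters commutes with the rest
-- of the run.
letter-down : ∀ j m → suc j < m → (suc j ∷ down m) ≈H (down m ++ [ suc (suc j) ])
letter-down j (suc m) (s≤s j<m) with m≤n⇒m<n∨m≡n j<m
letter-down j (suc m) (s≤s j<m) | inj₁ sj<m = ≈trans (relation (down m) (comm (suc j) (suc m) (s≤s sj<m)))
  (≈H-++ˡ [ suc m ] (letter-down j m sj<m))
letter-down j (suc .(suc j)) (s≤s j<m) | inj₂ ≡.refl = ≈trans (relation (down j) (braid (suc j)))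
  (≈H-++ˡ (suc (suc j) ∷ suc j ∷ []) (commute-past (suc (suc j)) (down j) (All.map (λ y≤j → s≤s (s≤s y≤j)) (down-≤ j))))

down-down : ∀ c m → c < m → (down c ++ down m) ≈H (down m ++ map suc (down c))
down-down zero    m _    = ≡⇒≈H (sym (++-identityʳ (down m)))
down-down (suc c) m sc<m = begin
  suc c ∷ down c ++ down m                    ≈⟨ ≈H-++ˡ [ suc c ] (down-down c m (<-trans (n<1+n c) sc<m)) ⟩
  (suc c ∷ down m) ++ map suc (down c)        ≈⟨ ≈H-++ʳ (map suc (down c)) (letter-down c m sc<m) ⟩
  (down m ++ [ suc (suc c) ]) ++ map suc (down c) ≡⟨ ++-assoc (down m) [ suc (suc c) ] (map suc (down c)) ⟩
  down m ++ map suc (down (suc c))            ∎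
  where open ≈H-Reasoning

down-suc : ∀ c → map suc (down c) ++ [ 1 ] ≡ down (suc c)
down-suc zero    = ≡.refl
down-suc (suc c) = cong (suc (suc c) ∷_) (down-suc c)

-- The code of a word and of the word with the letters k and k+1 (ascending) swapped.
data Ascent : ℕ → List ℕ → List ℕ → Set where
  here  : ∀ {c d cs} → c ≤ d → Ascent 0 (c ∷ d ∷ cs) (suc d ∷ c ∷ cs)
  there : ∀ {k c cs cs'} → Ascent k cs cs' → Ascent (suc k) (c ∷ cs) (c ∷ cs')

-- In the base case the new letter 1 commutes with the twice shifted tail and completes the shifted
-- run of `d` to `down (suc d)`. The run of `c` is then moved across by `down-down`, which is where
-- `c ≤ d` is used.
normalForm-ascent : ∀ {k cs cs'} → Ascent k cs cs' → (normalForm cs ∷ʳ suc k) ≈H normalForm cs'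
normalForm-ascent (here {c} {d} {cs} c≤d) = begin
  (down c ++ map suc (down d ++ map suc N)) ++ [ 1 ]
    ≡⟨ ≡.trans (cong (λ u → (down c ++ u) ++ [ 1 ]) (map-++ suc (down d) (map suc N)))
        (≡.trans (cong (_++ [ 1 ]) (sym (++-assoc (down c) (map suc (down d)) N″))) (++-assoc (down c ++ map suc (down d)) N″ [ 1 ])) ⟩
  (down c ++ map suc (down d)) ++ (N″ ++ [ 1 ])
    ≈⟨ ≈H-++ˡ (down c ++ map suc (down d)) (commute-past′ 1 N″
        (All.map⁺ (All.map⁺ (All.map (λ 1≤y → s≤s (s≤s 1≤y)) (normalForm-≥1 cs))))) ⟩
  (down c ++ map suc (down d)) ++ ([ 1 ] ++ N″)
    ≡⟨ ≡.trans (sym (++-assoc (down c ++ map suc (down d)) [ 1 ] N″))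
        (cong (_++ N″) (≡.trans (++-assoc (down c) (map suc (down d)) [ 1 ]) (cong (down c ++_) (down-suc d)))) ⟩
  (down c ++ down (suc d)) ++ N″
    ≈⟨ ≈H-++ʳ N″ (down-down c (suc d) (s≤s c≤d)) ⟩
  (down (suc d) ++ map suc (down c)) ++ N″
    ≡⟨ ≡.trans (++-assoc (down (suc d)) (map suc (down c)) N″) (cong (down (suc d) ++_) (sym (map-++ suc (down c) (map suc N)))) ⟩
  down (suc d) ++ map suc (down c ++ map suc N) ∎
  where
  open ≈H-Reasoning
  N = normalForm cs
  N″ = map suc (map suc N)
normalForm-ascent (there {k} {c} {cs} {cs'} a) = begin
  (down c ++ map suc (normalForm cs)) ++ [ suc (suc k) ] ≡⟨ ++-assoc (down c) _ _ ⟩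
  down c ++ (map suc (normalForm cs) ++ [ suc (suc k) ]) ≡⟨ cong (down c ++_) (map-++ suc (normalForm cs) [ suc k ]) ⟨
  down c ++ map suc (normalForm cs ∷ʳ suc k)             ≈⟨ ≈H-++ˡ (down c) (≈H-map (normalForm-ascent a)) ⟩
  down c ++ map suc (normalForm cs')                     ∎
  where open ≈H-Reasoning

normalForm-descent : ∀ {k cs cs'} → Ascent k cs cs' → (normalForm cs' ∷ʳ suc k) ≈H normalForm cs'
normalForm-descent {k} {cs} {cs'} a = begin
  normalForm cs' ++ [ suc k ]                 ≈⟨ ≈H-++ʳ [ suc k ] (normalForm-ascent a) ⟨
  (normalForm cs ++ [ suc k ]) ++ [ suc k ]   ≡⟨ ++-assoc (normalForm cs) _ _ ⟩
  normalForm cs ++ (suc k ∷ suc k ∷ [])       ≈⟨ ≈H-++ˡ (normalForm cs) (relation [] (idem (suc k))) ⟩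
  normalForm cs ++ [ suc k ]                  ≈⟨ normalForm-ascent a ⟩
  normalForm cs'                              ∎
  where open ≈H-Reasoning

lehmer : List ℕ → List ℕ
lehmer []      = []
lehmer (x ∷ l) = smaller x l ∷ lehmer l

swapAt : ℕ → List ℕ → List ℕ
swapAt zero    (x ∷ y ∷ l) = y ∷ x ∷ l
swapAt (suc k) (x ∷ l)     = x ∷ swapAt k l
swapAt _       l           = l

data Descent : ℕ → List ℕ → Set where
  here  : ∀ {x y l} → y < x → Descent 0 (x ∷ y ∷ l)
  there : ∀ {k x l} → Descent k l → Descent (suc k) (x ∷ l)

swapAt-↭ : ∀ k l → swapAt k l ↭ l
swapAt-↭ zero    []          = refl
swapAt-↭ zero    (x ∷ [])    = refl
swapAt-↭ zero    (x ∷ y ∷ l) = swap y x refl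
swapAt-↭ (suc k) []          = refl
swapAt-↭ (suc k) (x ∷ l)     = prep x (swapAt-↭ k l)

swapAt-involutive : ∀ k l → swapAt k (swapAt k l) ≡ l
swapAt-involutive zero    []          = ≡.refl
swapAt-involutive zero    (x ∷ [])    = ≡.refl
swapAt-involutive zero    (x ∷ y ∷ l) = ≡.refl
swapAt-involutive (suc k) []          = ≡.refl
swapAt-involutive (suc k) (x ∷ l)     = cong (x ∷_) (swapAt-involutive k l)

descent-or-ascent : ∀ k l → Unique l → suc k < length l → Descent k l ⊎ Descent k (swapAt k l)
descent-or-ascent zero (x ∷ y ∷ l) ((x≢y ∷ _) ∷ _) _ with <-cmp x y
... | tri< x<y _ _ = inj₂ (here x<y)
... | tri≈ _ x≡y _ = ⊥-elim (x≢y x≡y)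
... | tri> _ _ y<x = inj₁ (here y<x)
descent-or-ascent zero (x ∷ []) _ (s≤s ())
descent-or-ascent (suc k) (x ∷ l) (_ ∷ u) (s≤s h) with descent-or-ascent k l u h
... | inj₁ d = inj₁ (there d)
... | inj₂ d = inj₂ (there d)

sortAt-descent : ∀ {k l} → Descent k l → sortAt k l ≡ l
sortAt-descent (here {l = l} y<x) = cong₂ (λ a b → a ∷ b ∷ l) (m≥n⇒m⊔n≡m (<⇒≤ y<x)) (m≥n⇒m⊓n≡n (<⇒≤ y<x))
sortAt-descent (there {x = x} d)  = cong (x ∷_) (sortAt-descent d)

sortAt-swapAt : ∀ {k l} → Descent k l → sortAt k (swapAt k l) ≡ l
sortAt-swapAt (here {l = l} y<x) = cong₂ (λ a b → a ∷ b ∷ l) (m≤n⇒m⊔n≡n (<⇒≤ y<x)) (m≤n⇒m⊓n≡m (<⇒≤ y<x))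
sortAt-swapAt (there {x = x} d)  = cong (x ∷_) (sortAt-swapAt d)

descent-< : ∀ {k l} → Descent k l → suc k < length l
descent-< (here _)  = s≤s (s≤s z≤n)
descent-< (there d) = s≤s (descent-< d)

lehmer-ascent : ∀ {k l} → Descent k l → Ascent k (lehmer (swapAt k l)) (lehmer l)
lehmer-ascent (here {x} {y} {l} y<x) = ≡.subst₂ (λ c d → Ascent 0 (c ∷ smaller x l ∷ lehmer l) (d ∷ smaller y l ∷ lehmer l))
  (sym (smaller-≥ l (<⇒≤ y<x))) (sym (smaller-< l y<x)) (here (smaller-mono l (<⇒≤ y<x)))
lehmer-ascent (there {k} {x} {l} d) = subst (λ c → Ascent (suc k) (c ∷ lehmer (swapAt k l)) (smaller x l ∷ lehmer l))
  (sym (count-↭ {P = _<ᵇ x} (swapAt-↭ k l))) (there (lehmer-ascent d))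

sum-ascent : ∀ {k cs cs'} → Ascent k cs cs' → sum cs' ≡ suc (sum cs)
sum-ascent (here {c} {d} {cs} _) = cong suc (≡.trans (sym (+-assoc d c (sum cs))) (≡.trans (cong (_+ sum cs) (+-comm d c)) (+-assoc c d (sum cs))))
sum-ascent (there {c = c} a)     = ≡.trans (cong (c +_) (sum-ascent a)) (+-suc c _)

atDescents : ℕ → (List ℕ → List (List ℕ)) → List ℕ → List (List ℕ)
atDescents k W []      = []
atDescents k W (x ∷ t) = first t ++ atDescents (suc k) (λ u → W (x ∷ u)) t
  where
  first : List ℕ → List (List ℕ)
  first []      = []
  first (y ∷ t) = if y <ᵇ x then map (_∷ʳ suc k) (W (x ∷ y ∷ t) ++ W (y ∷ x ∷ t)) else []

-- The recursion is that of `heckeSum`, with lists of words in place of their weights, so the two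
-- agree by induction on the length.
heckeWords : ℕ → List ℕ → List (List ℕ)
heckeWords zero    l = if Right.sorted l then [ [] ] else []
heckeWords (suc L) l = atDescents 0 (heckeWords L) l

∈-atDescents⁻ : ∀ k W l {a} → a ∈ atDescents k W l →
  ∃ λ i → ∃ λ b → Descent i l × a ≡ b ∷ʳ suc (k + i) × (b ∈ W l ⊎ b ∈ W (swapAt i l))
∈-atDescents⁻ k W (x ∷ [])    ()
∈-atDescents⁻ k W (x ∷ y ∷ t) {a} a∈
  with y <ᵇ x in e | (λ (a∈ : a ∈ atDescents (suc k) (λ u → W (x ∷ u)) (y ∷ t)) → ∈-atDescents⁻ (suc k) (λ u → W (x ∷ u)) (y ∷ t) a∈)
... | false | later = let i , b , d , a≡ , b∈ = later a∈ in
  suc i , b , there d , ≡.trans a≡ (cong (λ n → b ∷ʳ suc n) (sym (+-suc k i))) , b∈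
... | true | later with ∈-++⁻ (map (_∷ʳ suc k) (W (x ∷ y ∷ t) ++ W (y ∷ x ∷ t))) a∈
...   | inj₂ a∈′ = let i , b , d , a≡ , b∈ = later a∈′ in
  suc i , b , there d , ≡.trans a≡ (cong (λ n → b ∷ʳ suc n) (sym (+-suc k i))) , b∈
...   | inj₁ a∈′ with ∈-map⁻ (_∷ʳ suc k) a∈′
...     | b , b∈ , a≡ = 0 , b , here (<ᵇ-true⇒< e) , ≡.trans a≡ (cong (λ n → b ∷ʳ suc n) (sym (+-identityʳ k))) , ∈-++⁻ (W (x ∷ y ∷ t)) b∈

∈-atDescents⁺ : ∀ k W l {i b} → Descent i l → b ∈ W l ⊎ b ∈ W (swapAt i l) → (b ∷ʳ suc (k + i)) ∈ atDescents k W l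
∈-atDescents⁺ k W (x ∷ y ∷ t) {b = b} (here y<x) b∈ rewrite <⇒<ᵇ-true y<x | +-identityʳ k =
  ∈-++⁺ˡ (∈-map⁺ (_∷ʳ suc k) (join b∈))
  where
  join : b ∈ W (x ∷ y ∷ t) ⊎ b ∈ W (y ∷ x ∷ t) → b ∈ W (x ∷ y ∷ t) ++ W (y ∷ x ∷ t)
  join (inj₁ p) = ∈-++⁺ˡ p
  join (inj₂ p) = ∈-++⁺ʳ (W (x ∷ y ∷ t)) p
∈-atDescents⁺ k W (x ∷ l) {suc i} {b} (there d) b∈ = ∈-++⁺ʳ _
  (subst (λ n → (b ∷ʳ suc n) ∈ atDescents (suc k) (λ u → W (x ∷ u)) l) (sym (+-suc k i))
    (∈-atDescents⁺ (suc k) (λ u → W (x ∷ u)) l d b∈))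

atDescents-unique : ∀ k W l → (∀ l' → l' ↭ l → Unique (W l')) →
  (∀ {i} → Descent i l → ∀ {a} → a ∈ W l → a ∈ W (swapAt i l) → ⊥) → Unique (atDescents k W l)
atDescents-unique k W []          _ _ = []
atDescents-unique k W (x ∷ [])    _ _ = []
atDescents-unique k W (x ∷ y ∷ t) u disjoint
  with y <ᵇ x in e
     | atDescents-unique (suc k) (λ u → W (x ∷ u)) (y ∷ t) (λ l' p → u (x ∷ l') (prep x p)) (λ d → disjoint (there d))
... | false | later = later
... | true  | later = Unique.++⁺
  (Unique.map⁺ (λ {a} {b} → ∷ʳ-injectiveˡ a b) (Unique.++⁺ (u _ refl) (u _ (swap y x refl))
    (λ where (p , q) → disjoint (here (<ᵇ-true⇒< e)) p q)))
  later
  (λ where (p , q) → different p q)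
  where
  different : ∀ {a} → a ∈ map (_∷ʳ suc k) (W (x ∷ y ∷ t) ++ W (y ∷ x ∷ t)) →
    a ∈ atDescents (suc k) (λ u → W (x ∷ u)) (y ∷ t) → ⊥
  different p q with ∈-map⁻ (_∷ʳ suc k) p | ∈-atDescents⁻ (suc k) (λ u → W (x ∷ u)) (y ∷ t) q
  ... | b , _ , ≡.refl | i , b' , _ , e' , _ = <-irrefl (suc-injective (∷ʳ-injectiveʳ b b' e')) (s≤s (m≤m+n k i))

weight : (ℕ → ℕ) → List ℕ → ℕ
weight w a = product (map w a)

weight-∷ʳ : ∀ w a i → weight w (a ∷ʳ i) ≡ w i * weight w a
weight-∷ʳ w a i = ≡.trans (cong product (map-++ w a [ i ])) (≡.trans (product-++ (map w a) [ w i ])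
  (≡.trans (cong (weight w a *_) (*-identityʳ (w i))) (*-comm (weight w a) (w i))))

weights : (ℕ → ℕ) → List (List ℕ) → ℕ
weights w as = sum (map (weight w) as)

weights-++ : ∀ w as bs → weights w (as ++ bs) ≡ weights w as + weights w bs
weights-++ w as bs = ≡.trans (cong sum (map-++ (weight w) as bs)) (sum-++ (map (weight w) as) _)

weights-∷ʳ : ∀ w i as → weights w (map (_∷ʳ i) as) ≡ w i * weights w as
weights-∷ʳ w i []       = sym (*-zeroʳ (w i))
weights-∷ʳ w i (a ∷ as) = ≡.trans (cong₂ _+_ (weight-∷ʳ w a i) (weights-∷ʳ w i as)) (sym (*-distribˡ-+ (w i) _ _))

weights-atDescents : ∀ w k W l →
  weights w (atDescents k W l) ≡ Right.descents (λ i → w (suc (k + i))) (λ u → weights w (W u)) l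
weights-atDescents w k W [] = ≡.refl
weights-atDescents w k W (x ∷ []) = sym (≡.trans (+-identityʳ _)
  (≡.trans (cong (w (suc (k + 0)) *_) (Right.atDescent-[-] x)) (*-zeroʳ (w (suc (k + 0))))))
weights-atDescents w k W (x ∷ y ∷ t) with y <ᵇ x in e | weights-atDescents w (suc k) (λ u → W (x ∷ u)) (y ∷ t)
... | false | later = cong₂ _+_
  (sym (≡.trans (cong (w (suc (k + 0)) *_) (Right.atDescent-no t e)) (*-zeroʳ (w (suc (k + 0))))))
  (≡.trans later
    (Right.descents-weights _ (y ∷ t) (λ i → cong (w ∘ suc) (sym (+-suc k i)))))
... | true  | later = ≡.trans (weights-++ w (map (_∷ʳ suc k) here-words) (atDescents (suc k) (λ u → W (x ∷ u)) (y ∷ t))) (cong₂ _+_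
  (≡.trans (weights-∷ʳ w (suc k) here-words) (cong₂ _*_ (cong (w ∘ suc) (sym (+-identityʳ k)))
    (≡.trans (weights-++ w (W (x ∷ y ∷ t)) (W (y ∷ x ∷ t))) (sym (Right.atDescent-yes {λ u → weights w (W u)} t e)))))
  (≡.trans later
    (Right.descents-weights _ (y ∷ t) (λ i → cong (w ∘ suc) (sym (+-suc k i))))))
  where
  here-words : List (List ℕ)
  here-words = W (x ∷ y ∷ t) ++ W (y ∷ x ∷ t)

weights-heckeWords : ∀ w L l → weights w (heckeWords L l) ≡ heckeSum (w ∘ suc) L l
weights-heckeWords w zero l with Right.sorted l
... | true  = ≡.refl
... | false = ≡.refl
weights-heckeWords w (suc L) l = ≡.trans (weights-atDescents w 0 (heckeWords L) l)
  (Right.descents-cong (w ∘ suc) l (λ q _ → weights-heckeWords w L q))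

increasing-↭ : ∀ {xs ys} → AllPairs _<_ xs → AllPairs _<_ ys → xs ↭ ys → xs ≡ ys
increasing-↭ {[]}     {ys}     _ _ p = sym (↭-empty-inv (↭-sym p))
increasing-↭ {x ∷ xs} {[]}     _ _ p with () ← ↭-empty-inv p
increasing-↭ {x ∷ xs} {y ∷ ys} (x<xs ∷ xs↗) (y<ys ∷ ys↗) p
  with ∈-resp-↭ p (here ≡.refl) | ∈-resp-↭ (↭-sym p) (here ≡.refl)
... | there x∈ys | there y∈xs = ⊥-elim (<-asym (All.lookup y<ys x∈ys) (All.lookup x<xs y∈xs))
... | here ≡.refl | _          = cong (x ∷_) (increasing-↭ xs↗ ys↗ (drop-∷ p))
... | there _ | here ≡.refl    = cong (x ∷_) (increasing-↭ xs↗ ys↗ (drop-∷ p))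

sorted-increasing : ∀ l → Right.sorted l ≡ true → Unique l → AllPairs _<_ l
sorted-increasing []          _ _ = []
sorted-increasing (x ∷ [])    _ _ = [] ∷ []
sorted-increasing (x ∷ y ∷ l) e ((x≢y ∷ x∉) ∷ u) with sorted-increasing (y ∷ l) (Right.sorted-∷⁻ x (y ∷ l) e) u
... | y<l ∷ l↗ = (x<y ∷ All.map (<-trans x<y) y<l) ∷ y<l ∷ l↗
  where
  x<y : x < y
  x<y = ≤∧≢⇒< (<ᵇ-false⇒≥ (Right.sorted-head x y l e)) x≢y

upTo-increasing : ∀ n → AllPairs _<_ (upTo n)
upTo-increasing n = AllPairs.applyUpTo⁺₁ id n (λ i<j _ → i<j)

module _ (n : ℕ) where

  one : List ℕ
  one = upTo n

  -- The last two components serve different purposes. The action on the identity separates the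
  -- words of different permutations and so excludes duplicates in the enumeration; the normal form
  -- supplies the congruence demanded by `HeckeWord`.
  sound-words : ∀ L l → l ↭ one → ∀ {a} → a ∈ heckeWords L l →
    length a ≡ L × Letters n a × act a one ≡ l × (a ≈H normalForm (lehmer l))
  sound-words zero l l↭ a∈ with Right.sorted l in e
  sound-words zero l l↭ (here ≡.refl) | true
    with increasing-↭ (sorted-increasing l e (Unique-resp-↭ (↭-sym l↭) (Unique.upTo⁺ n))) (upTo-increasing n) l↭
  ... | ≡.refl = ≡.refl , [] , ≡.refl , ≡⇒≈H (sym (nf≡[] one (upTo-increasing n)))
    where
    nf≡[] : ∀ l → AllPairs _<_ l → normalForm (lehmer l) ≡ []
    nf≡[] []      _          = ≡.refl
    nf≡[] (x ∷ l) (x<l ∷ l↗) rewrite smaller-none (All.map <⇒≤ x<l) | nf≡[] l l↗ = ≡.refl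
  sound-words (suc L) l l↭ a∈ with ∈-atDescents⁻ 0 (heckeWords L) l a∈
  ... | i , b , d , ≡.refl , inj₁ b∈ with sound-words L l l↭ b∈
  ...   | ≡.refl , let-b , act-b , b≈ =
    ≡.trans (length-++ b) (+-comm (length b) 1) ,
    All.++⁺ let-b ((s≤s z≤n , subst (suc (suc i) ≤_) (≡.trans (↭-length l↭) (length-applyUpTo id n)) (descent-< d)) ∷ []) ,
    ≡.trans (act-++ b [ suc i ] one) (≡.trans (cong (sortAt i) act-b) (sortAt-descent d)) ,
    ≈trans (≈H-++ʳ [ suc i ] b≈) (normalForm-descent (lehmer-ascent d))
  sound-words (suc L) l l↭ a∈ | i , b , d , ≡.refl , inj₂ b∈ with sound-words L (swapAt i l) (trans (swapAt-↭ i l) l↭) b∈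
  ...   | ≡.refl , let-b , act-b , b≈ =
    ≡.trans (length-++ b) (+-comm (length b) 1) ,
    All.++⁺ let-b ((s≤s z≤n , subst (suc (suc i) ≤_) (≡.trans (↭-length l↭) (length-applyUpTo id n)) (descent-< d)) ∷ []) ,
    ≡.trans (act-++ b [ suc i ] one) (≡.trans (cong (sortAt i) act-b) (sortAt-swapAt d)) ,
    ≈trans (≈H-++ʳ [ suc i ] b≈) (normalForm-ascent (lehmer-ascent d))

  heckeWords-unique : ∀ L l → l ↭ one → Unique (heckeWords L l)
  heckeWords-unique zero    l l↭ with Right.sorted l
  ... | true  = [] ∷ []
  ... | false = []
  heckeWords-unique (suc L) l l↭ = atDescents-unique 0 (heckeWords L) l
    (λ l' p → heckeWords-unique L l' (trans p l↭))
    (λ {i} d a∈ a∈′ → no-fixed d (≡.trans (sym (proj₁ (proj₂ (proj₂ (sound-words L l l↭ a∈)))))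
      (proj₁ (proj₂ (proj₂ (sound-words L (swapAt i l) (trans (swapAt-↭ i l) l↭) a∈′))))))
    where
    no-fixed : ∀ {i l} → Descent i l → l ≡ swapAt i l → ⊥
    no-fixed (here y<x) e = <-irrefl (sym (∷-injectiveˡ e)) y<x
    no-fixed (there d)  e = no-fixed d (∷-injectiveʳ e)

  act-↭ : ∀ a l → act a l ↭ l
  act-↭ []            l = refl
  act-↭ (zero ∷ a)    l = act-↭ a l
  act-↭ (suc k ∷ a)   l = trans (act-↭ a (sortAt k l)) (sortAt-↭ k l)
    where
    sortAt-↭ : ∀ k l → sortAt k l ↭ l
    sortAt-↭ zero    []          = refl
    sortAt-↭ zero    (x ∷ [])    = refl
    sortAt-↭ zero    (x ∷ y ∷ l) with ≤-total x y
    ... | inj₁ x≤y rewrite m≤n⇒m⊔n≡n x≤y | m≤n⇒m⊓n≡m x≤y = swap y x refl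
    ... | inj₂ y≤x rewrite m≥n⇒m⊔n≡m y≤x | m≥n⇒m⊓n≡n y≤x = refl
    sortAt-↭ (suc k) []          = refl
    sortAt-↭ (suc k) (x ∷ l)     = prep x (sortAt-↭ k l)

  -- The last letter of a word either meets a descent and changes nothing, or sorts an ascent, in
  -- which case the remaining word belongs to the permutation with these two letters exchanged.
  -- These are the two sources in `atDescents`.
  complete-words : ∀ a → Letters n a → a ∈ heckeWords (length a) (act a one)
  complete-words a = go (reverseView a)
    where
    go : ∀ {a} → Reverse a → Letters n a → a ∈ heckeWords (length a) (act a one)
    go [] _ rewrite sorted-↗ one (upTo-increasing n) = here ≡.refl
    go (b ∶ rb ∶ʳ zero) ls with () ← proj₁ (All.head (All.++⁻ʳ b ls))
    go (b ∶ rb ∶ʳ suc i) ls =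
      ≡.subst₂ (λ m l → (b ∷ʳ suc i) ∈ heckeWords m l) (sym (≡.trans (length-++ b) (+-comm (length b) 1))) (sym (act-++ b [ suc i ] one))
        (step (descent-or-ascent i l (Unique-resp-↭ (↭-sym (act-↭ b one)) (Unique.upTo⁺ n))
          (subst (suc (suc i) ≤_) (sym (≡.trans (↭-length (act-↭ b one)) (length-applyUpTo id n))) (proj₂ (All.head (All.++⁻ʳ b ls))))))
      where
      l = act b one
      b∈ : b ∈ heckeWords (length b) l
      b∈ = go rb (All.++⁻ˡ b ls)
      step : Descent i l ⊎ Descent i (swapAt i l) → (b ∷ʳ suc i) ∈ heckeWords (suc (length b)) (sortAt i l)
      step (inj₁ d) = subst (λ m → (b ∷ʳ suc i) ∈ heckeWords (suc (length b)) m) (sym (sortAt-descent d))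
        (∈-atDescents⁺ 0 (heckeWords (length b)) l d (inj₁ b∈))
      step (inj₂ d) = subst (λ m → (b ∷ʳ suc i) ∈ heckeWords (suc (length b)) m)
        (sym (≡.trans (cong (sortAt i) (sym (swapAt-involutive i l))) (sortAt-swapAt d)))
        (∈-atDescents⁺ 0 (heckeWords (length b)) (swapAt i l) d
          (inj₂ (subst (λ m → b ∈ heckeWords (length b) m) (sym (swapAt-involutive i l)) b∈)))

sAct-suc : ∀ i k → sAct (suc (suc i)) (suc k) ≡ suc (sAct (suc i) k)
sAct-suc i k with k ≡ᵇ i
... | true = ≡.refl
... | false with k ≡ᵇ suc i
...   | true  = ≡.refl
...   | false = ≡.refl

applyUpTo-cong : ∀ {f g : ℕ → ℕ} n → (∀ k → f k ≡ g k) → applyUpTo f n ≡ applyUpTo g n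
applyUpTo-cong zero    e = ≡.refl
applyUpTo-cong (suc n) e = cong₂ _∷_ (e 0) (applyUpTo-cong n (e ∘ suc))

swapAt-applyUpTo : ∀ k n f → suc k < n → swapAt k (applyUpTo f n) ≡ applyUpTo (f ∘ sAct (suc k)) n
swapAt-applyUpTo zero    (suc (suc n)) f _       = ≡.refl
swapAt-applyUpTo zero    (suc zero)    f (s≤s ())
swapAt-applyUpTo (suc k) (suc n)       f (s≤s h) = cong (f 0 ∷_) (≡.trans
  (swapAt-applyUpTo k n (f ∘ suc) h) (applyUpTo-cong n (λ j → cong f (sym (sAct-suc k j)))))

wordAct-∷ʳ : ∀ r i k → wordAct (r ∷ʳ i) k ≡ wordAct r (sAct i k)
wordAct-∷ʳ []      i k = ≡.refl
wordAct-∷ʳ (j ∷ r) i k = cong (sAct j) (wordAct-∷ʳ r i k)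

-- Each letter changes the number of inversions by one, so a word with as many letters as
-- inversions only ever sorts in ascending order.
reduced-act : ∀ n r → Letters n r → applyUpTo (wordAct r) n ↭ upTo n ×
  sum (lehmer (applyUpTo (wordAct r) n)) ≤ length r ×
  (sum (lehmer (applyUpTo (wordAct r) n)) ≡ length r → act r (upTo n) ≡ applyUpTo (wordAct r) n)
reduced-act n r = go (reverseView r)
  where
  inversions-upTo : ∀ l → AllPairs _<_ l → sum (lehmer l) ≡ 0
  inversions-upTo []      _          = ≡.refl
  inversions-upTo (x ∷ l) (x<l ∷ l↗) = cong₂ _+_ (smaller-none (All.map <⇒≤ x<l)) (inversions-upTo l l↗)
  go : ∀ {r} → Reverse r → Letters n r → applyUpTo (wordAct r) n ↭ upTo n ×
    sum (lehmer (applyUpTo (wordAct r) n)) ≤ length r ×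
    (sum (lehmer (applyUpTo (wordAct r) n)) ≡ length r → act r (upTo n) ≡ applyUpTo (wordAct r) n)
  go [] _ = refl , ≤-reflexive (inversions-upTo (upTo n) (upTo-increasing n)) , λ _ → ≡.refl
  go (r ∶ rv ∶ʳ zero) ls with () ← proj₁ (All.head (All.++⁻ʳ r ls))
  go (r ∶ rv ∶ʳ suc i) ls with go rv (All.++⁻ˡ r ls)
  ... | l↭ , inv≤ , act≡ = ≡.subst₂
    (λ m k → m ↭ upTo n × sum (lehmer m) ≤ k × (sum (lehmer m) ≡ k → act (r ∷ʳ suc i) (upTo n) ≡ m))
    (sym next) (sym (≡.trans (length-++ r) (+-comm (length r) 1)))
    (trans (swapAt-↭ i l) l↭ , step)
    where
    l = applyUpTo (wordAct r) n
    i<n : suc i < n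
    i<n = proj₂ (All.head (All.++⁻ʳ r ls))
    next : applyUpTo (wordAct (r ∷ʳ suc i)) n ≡ swapAt i l
    next = ≡.trans (applyUpTo-cong n (wordAct-∷ʳ r (suc i))) (sym (swapAt-applyUpTo i n (wordAct r) i<n))
    step : sum (lehmer (swapAt i l)) ≤ suc (length r) ×
      (sum (lehmer (swapAt i l)) ≡ suc (length r) → act (r ∷ʳ suc i) (upTo n) ≡ swapAt i l)
    step with descent-or-ascent i l (Unique-resp-↭ (↭-sym l↭) (Unique.upTo⁺ n))
               (subst (suc i <_) (sym (length-applyUpTo (wordAct r) n)) i<n)
    ... | inj₁ d = ≤-trans (<⇒≤ fewer) (≤-trans inv≤ (n≤1+n _)) , λ e → ⊥-elim (<⇒≱ (≤-trans fewer inv≤) (≤-trans (n≤1+n _) (≤-reflexive (sym e))))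
      where
      fewer : sum (lehmer (swapAt i l)) < sum (lehmer l)
      fewer = ≤-reflexive (sym (sum-ascent (lehmer-ascent d)))
    ... | inj₂ d = ≤-trans (≤-reflexive more) (s≤s inv≤) , λ e → ≡.trans (act-++ r [ suc i ] (upTo n))
        (≡.trans (cong (sortAt i) (act≡ (suc-injective (≡.trans (sym more) e))))
        (≡.trans (cong (sortAt i) (sym (swapAt-involutive i l))) (sortAt-swapAt d)))
      where
      more : sum (lehmer (swapAt i l)) ≡ suc (sum (lehmer l))
      more = ≡.trans (sum-ascent (lehmer-ascent d)) (cong (λ m → suc (sum (lehmer m))) (swapAt-involutive i l))

≡ᵇ-refl : ∀ k → (k ≡ᵇ k) ≡ true
≡ᵇ-refl zero    = ≡.refl
≡ᵇ-refl (suc k) = ≡ᵇ-refl k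

≢⇒≡ᵇ-false : ∀ {k j} → k ≢ j → (k ≡ᵇ j) ≡ false
≢⇒≡ᵇ-false {k} {j} k≢j with k ≡ᵇ j in e
... | false = ≡.refl
... | true  = ⊥-elim (k≢j (≡ᵇ⇒≡ k j (subst Bool.T (sym e) tt)))

sAct-left : ∀ i → sAct (suc i) i ≡ suc i
sAct-left i rewrite ≡ᵇ-refl i = ≡.refl

sAct-right : ∀ i → sAct (suc i) (suc i) ≡ i
sAct-right i rewrite ≢⇒≡ᵇ-false {suc i} {i} 1+n≢n | ≡ᵇ-refl i = ≡.refl

sAct-other : ∀ {i k} → k ≢ i → k ≢ suc i → sAct (suc i) k ≡ k
sAct-other {i} {k} p q rewrite ≢⇒≡ᵇ-false p | ≢⇒≡ᵇ-false q = ≡.refl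

wordAct-++ : ∀ a b k → wordAct (a ++ b) k ≡ wordAct a (wordAct b k)
wordAct-++ []      b k = ≡.refl
wordAct-++ (i ∷ a) b k = cong (sAct i) (wordAct-++ a b k)

down-zero : ∀ c → wordAct (down c) 0 ≡ c
down-zero zero    = ≡.refl
down-zero (suc c) = ≡.trans (cong (sAct (suc c)) (down-zero c)) (sAct-left c)

down-≥ : ∀ c {z} → c ≤ z → wordAct (down c) (suc z) ≡ suc z
down-≥ zero    _   = ≡.refl
down-≥ (suc c) {z} c<z = ≡.trans (cong (sAct (suc c)) (down-≥ c (<⇒≤ c<z)))
  (sAct-other {c} {suc z} (λ where ≡.refl → <⇒≱ c<z (n≤1+n _)) (λ where ≡.refl → <-irrefl ≡.refl c<z))

down-< : ∀ c {z} → z < c → wordAct (down c) (suc z) ≡ z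
down-< (suc c) {z} (s≤s z≤c) with m≤n⇒m<n∨m≡n z≤c
... | inj₁ z<c    = ≡.trans (cong (sAct (suc c)) (down-< c z<c))
  (sAct-other (λ where ≡.refl → <-irrefl ≡.refl z<c) (λ where ≡.refl → <⇒≱ z<c (n≤1+n _)))
... | inj₂ ≡.refl = ≡.trans (cong (sAct (suc c)) (down-≥ c ≤-refl)) (sAct-right c)

wordAct-map-zero : ∀ a → All (1 ≤_) a → wordAct (map suc a) 0 ≡ 0
wordAct-map-zero []          _        = ≡.refl
wordAct-map-zero (suc i ∷ a) (_ ∷ hs) = cong (sAct (suc (suc i))) (wordAct-map-zero a hs)

wordAct-map-suc : ∀ a k → All (1 ≤_) a → wordAct (map suc a) (suc k) ≡ suc (wordAct a k)
wordAct-map-suc []          k _        = ≡.refl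
wordAct-map-suc (suc i ∷ a) k (_ ∷ hs) = ≡.trans
  (cong (sAct (suc (suc i))) (wordAct-map-suc a k hs)) (sAct-suc i (wordAct a k))

map-local : ∀ {f g : ℕ → ℕ} l → (∀ {y} → y ∈ l → f y ≡ g y) → map f l ≡ map g l
map-local []      e = ≡.refl
map-local (x ∷ l) e = cong₂ _∷_ (e (here ≡.refl)) (map-local l (e ∘ there))

-- The run of `c` inserts the rank of `x`: it sends 0 to `c` and, among the ranks of the other
-- letters, raises exactly those that are at least `c` by one.
normalForm-ranks : ∀ l → Unique l →
  applyUpTo (wordAct (normalForm (lehmer l))) (length l) ≡ map (λ y → smaller y l) l
normalForm-ranks []      _          = ≡.refl
normalForm-ranks (x ∷ l) (x∉l ∷ u) = cong₂ _∷_
  (≡.trans (wordAct-++ (down c) (map suc N) 0) (≡.trans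
    (cong (wordAct (down c)) (wordAct-map-zero N (normalForm-≥1 (lehmer l))))
    (≡.trans (down-zero c) (sym (smaller-≥ {x} l ≤-refl)))))
  (begin
    applyUpTo (λ k → wordAct (down c ++ map suc N) (suc k)) (length l)
      ≡⟨ applyUpTo-cong (length l) (λ k → ≡.trans (wordAct-++ (down c) (map suc N) (suc k))
           (cong (wordAct (down c)) (wordAct-map-suc N k (normalForm-≥1 (lehmer l))))) ⟩
    applyUpTo (λ k → g (wordAct N k)) (length l)
      ≡⟨ map-applyUpTo (wordAct N) g (length l) ⟨
    map g (applyUpTo (wordAct N) (length l))
      ≡⟨ cong (map g) (normalForm-ranks l u) ⟩
    map g (map (λ y → smaller y l) l)
      ≡⟨ map-∘ l ⟨
    map (λ y → g (smaller y l)) l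
      ≡⟨ map-local l insert-rank ⟩
    map (λ y → smaller y (x ∷ l)) l ∎)
  where
  open ≡-Reasoning
  c = smaller x l
  N = normalForm (lehmer l)
  g : ℕ → ℕ
  g z = wordAct (down c) (suc z)
  smaller-strict : ∀ l {x y} → y ∈ l → y < x → smaller y l < smaller x l
  smaller-strict (z ∷ l) {x} (here ≡.refl) y<x rewrite smaller-< l y<x | smaller-≥ {z} l ≤-refl =
    s≤s (smaller-mono l (<⇒≤ y<x))
  smaller-strict (z ∷ l) {x} {y} (there y∈l) y<x with z <? y
  ... | yes z<y rewrite smaller-< l z<y | smaller-< l (<-trans z<y y<x) = s≤s (smaller-strict l y∈l y<x)
  ... | no z≮y rewrite smaller-≥ l (≮⇒≥ z≮y) = ≤-trans (smaller-strict l y∈l y<x) (count-∷-≥ {P = _<ᵇ x} z l)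
  insert-rank : ∀ {y} → y ∈ l → g (smaller y l) ≡ smaller y (x ∷ l)
  insert-rank {y} y∈l with <-cmp x y
  ... | tri< x<y _ _ = ≡.trans (down-≥ c (smaller-mono l (<⇒≤ x<y))) (sym (smaller-< l x<y))
  ... | tri≈ _ x≡y _ = ⊥-elim (All.lookup x∉l y∈l x≡y)
  ... | tri> _ _ y<x = ≡.trans (down-< c (smaller-strict l y∈l y<x)) (sym (smaller-≥ l (<⇒≤ y<x)))

count-map : ∀ {A B : Set} {P : B → Bool} (f : A → B) xs → count P (map f xs) ≡ count (P ∘ f) xs
count-map f []       = ≡.refl
count-map {P = P} f (x ∷ xs) with P (f x)
... | true  = cong suc (count-map f xs)
... | false = count-map f xs

smaller-upTo : ∀ n y → y ≤ n → smaller y (upTo n) ≡ y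
smaller-upTo n       zero    _         = smaller-none {0} {upTo n} (All.tabulate (λ _ → z≤n))
smaller-upTo (suc n) (suc y) (s≤s y≤n) = cong suc (≡.trans (cong (smaller (suc y)) (sym (map-upTo suc n)))
  (≡.trans (count-map suc (upTo n)) (smaller-upTo n y y≤n)))

module OneLine {n : ℕ} (w : Permutation′ n) where

  oneLine : List ℕ
  oneLine = map (val w) (allFin n)

  val-injective : ∀ {i j} → val w i ≡ val w j → i ≡ j
  val-injective e = ≡.trans (sym (inverseˡ w)) (≡.trans (cong (w ⟨$⟩ˡ_) (toℕ-injective e)) (inverseˡ w))

  oneLine-unique : Unique oneLine
  oneLine-unique = Unique.map⁺ val-injective (Unique.allFin⁺ n)

  oneLine-↭ : oneLine ↭ upTo n
  oneLine-↭ = ∼bag⇒↭ (unique∧set⇒bag oneLine-unique (Unique.upTo⁺ n) (mk⇔ to from))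
    where
    to : ∀ {y} → y ∈ oneLine → y ∈ upTo n
    to y∈ with ∈-map⁻ (val w) y∈
    ... | i , _ , ≡.refl = ∈-upTo⁺ (toℕ<n (w ⟨$⟩ʳ i))
    from : ∀ {y} → y ∈ upTo n → y ∈ oneLine
    from {y} y∈ = subst (_∈ oneLine) (≡.trans (cong toℕ (inverseʳ w)) (toℕ-fromℕ< (∈-upTo⁻ y∈)))
      (∈-map⁺ (val w) (∈-allFin (w ⟨$⟩ˡ fromℕ< (∈-upTo⁻ y∈))))

  allFin-increasing : AllPairs (λ i j → toℕ i < toℕ j) (allFin n)
  allFin-increasing = AllPairs.tabulate⁺-< (λ i<j → i<j)

  codeList : List ℕ
  codeList = map (code w) (allFin n)

  lehmer-oneLine : lehmer oneLine ≡ codeList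
  lehmer-oneLine = go [] (allFin n) allFin-increasing
    where
    later : Fin n → Fin n → Bool
    later i j = (toℕ i <ᵇ toℕ j) ∧ (val w j <ᵇ val w i)
    go : ∀ pre is → AllPairs (λ i j → toℕ i < toℕ j) (pre ++ is) →
      lehmer (map (val w) is) ≡ map (λ i → count (later i) (pre ++ is)) is
    go pre []       _   = ≡.refl
    go pre (i ∷ is) inc = cong₂ _∷_ head≡
      (subst (λ js → lehmer (map (val w) is) ≡ map (λ i → count (later i) js) is) (++-assoc pre [ i ] is)
        (go (pre ++ [ i ]) is (subst (AllPairs _) (sym (++-assoc pre [ i ] is)) inc)))
      where
      pre<i : ∀ pre → AllPairs (λ i j → toℕ i < toℕ j) (pre ++ i ∷ is) → All (λ j → toℕ j < toℕ i) pre × All (λ j → toℕ i < toℕ j) is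
      pre<i []        (i< ∷ _)  = [] , i<
      pre<i (j ∷ pre) (j< ∷ ps) = let a , b = pre<i pre ps in (All.head (All.++⁻ʳ pre j<) ∷ a) , b
      not-later : ∀ {j} → toℕ j ≤ toℕ i → later i j ≡ false
      not-later j≤i rewrite ≥⇒<ᵇ-false j≤i = ≡.refl
      count-later : ∀ is → All (λ j → toℕ i < toℕ j) is → count (later i) is ≡ count (λ j → val w j <ᵇ val w i) is
      count-later []       []         = ≡.refl
      count-later (j ∷ is) (i<j ∷ i<) with toℕ i <ᵇ toℕ j in e
      ... | false = true≢false (<⇒<ᵇ-true i<j) e
      ... | true with val w j <ᵇ val w i
      ...   | true  = cong suc (count-later is i<)
      ...   | false = count-later is i<
      head≡ : smaller (val w i) (map (val w) is) ≡ count (later i) (pre ++ i ∷ is)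
      head≡ = let pre< , i< = pre<i pre inc in sym (begin
        count (later i) (pre ++ i ∷ is)                 ≡⟨ count-++ pre (i ∷ is) ⟩
        count (later i) pre + count (later i) (i ∷ is)
          ≡⟨ cong₂ _+_ (count-none (All.map (λ j<i → not-later (<⇒≤ j<i)) pre<)) (count-no is (not-later {i} ≤-refl)) ⟩
        count (later i) is                              ≡⟨ count-later is i< ⟩
        count (λ j → val w j <ᵇ val w i) is             ≡⟨ count-map (val w) is ⟨
        smaller (val w i) (map (val w) is)              ∎)
        where open ≡-Reasoning

  length-oneLine : length oneLine ≡ n
  length-oneLine = ≡.trans (↭-length oneLine-↭) (length-applyUpTo id n)

-- The flag

bit : Bool → ℕ
bit b = if b then 1 else 0

-- Tool for the two inequalities between diagonals below: each position is counted at most as often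
-- on the left as on the right.
count-≤ : ∀ {A : Set} {P Q P' Q' : A → Bool} xs → (∀ x → bit (P x) + bit (Q x) ≤ bit (P' x) + bit (Q' x)) →
  count P xs + count Q xs ≤ count P' xs + count Q' xs
count-≤ []       h = z≤n
count-≤ {P = P} {Q} {P'} {Q'} (x ∷ xs) h = begin
  count P (x ∷ xs) + count Q (x ∷ xs) ≡⟨ cong₂ _+_ (count-∷ {P = P} x xs) (count-∷ {P = Q} x xs) ⟩
  (bit (P x) + count P xs) + (bit (Q x) + count Q xs) ≡⟨ +-swap-middle (bit (P x)) _ _ _ ⟩
  (bit (P x) + bit (Q x)) + (count P xs + count Q xs) ≤⟨ +-mono-≤ (h x) (count-≤ xs h) ⟩
  (bit (P' x) + bit (Q' x)) + (count P' xs + count Q' xs) ≡⟨ +-swap-middle (bit (P' x)) _ _ _ ⟩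
  (bit (P' x) + count P' xs) + (bit (Q' x) + count Q' xs) ≡⟨ cong₂ _+_ (count-∷ {P = P'} x xs) (count-∷ {P = Q'} x xs) ⟨
  count P' (x ∷ xs) + count Q' (x ∷ xs) ∎
  where open ≤-Reasoning

count-strict : ∀ {A : Set} {P Q : A → Bool} xs {y} → (∀ x → P x ≡ true → Q x ≡ true) →
  y ∈ xs → P y ≡ false → Q y ≡ true → count P xs < count Q xs
count-strict {P = P} {Q} (x ∷ xs) h (here ≡.refl) p q rewrite p | q = s≤s (count-mono xs (λ x _ → h x))
count-strict {P = P} {Q} (x ∷ xs) h (there y∈) p q with P x in e | Q x in e'
... | true  | true  = s≤s (count-strict xs h y∈ p q)
... | true  | false = true≢false (h x e) e'
... | false | true  = m≤n⇒m≤1+n (count-strict xs h y∈ p q)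
... | false | false = count-strict xs h y∈ p q

any-true⁻ : ∀ {A : Set} (P : A → Bool) xs → any P xs ≡ true → ∃ λ x → x ∈ xs × P x ≡ true
any-true⁻ P (x ∷ xs) e with P x in p
... | true  = x , here ≡.refl , p
... | false = let y , y∈ , q = any-true⁻ P xs e in y , there y∈ , q

any-true⁺ : ∀ {A : Set} (P : A → Bool) {xs x} → x ∈ xs → P x ≡ true → any P xs ≡ true
any-true⁺ P {x ∷ xs} (here ≡.refl) p rewrite p = ≡.refl
any-true⁺ P {x ∷ xs} (there x∈)   p with P x
... | true  = ≡.refl
... | false = any-true⁺ P x∈ p

≤ᵇ-true⇒≤ : ∀ {a b} → (a ≤ᵇ b) ≡ true → a ≤ b
≤ᵇ-true⇒≤ {a} {b} e = ≤ᵇ⇒≤ a b (subst Bool.T (sym e) tt)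

≤⇒≤ᵇ-true : ∀ {a b} → a ≤ b → (a ≤ᵇ b) ≡ true
≤⇒≤ᵇ-true {a} {b} a≤b with a ≤ᵇ b | ≤⇒≤ᵇ a≤b
... | true | _ = ≡.refl

max-≥ : ∀ (g : ℕ → ℕ) {l k} → k ∈ l → g k ≤ foldr _⊔_ 0 (map g l)
max-≥ g {k ∷ l} (here ≡.refl) = m≤m⊔n _ _
max-≥ g {j ∷ l} (there k∈)    = ≤-trans (max-≥ g k∈) (m≤n⊔m (g j) _)

max-≤ : ∀ (g : ℕ → ℕ) l {m} → (∀ {k} → k ∈ l → g k ≤ m) → foldr _⊔_ 0 (map g l) ≤ m
max-≤ g []      h = z≤n
max-≤ g (k ∷ l) h = ⊔-lub (h (here ≡.refl)) (max-≤ g l (h ∘ there))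

argmax : ∀ {A : Set} (f : A → ℕ) (P : A → Bool) xs →
  All (λ y → P y ≡ false) xs ⊎
  (∃ λ x → P x ≡ true × (∀ {y} → y ∈ xs → P y ≡ true → f y ≤ f x))
argmax f P [] = inj₁ []
argmax f P (x ∷ xs) with P x in p | argmax f P xs
... | false | inj₁ none = inj₁ (p ∷ none)
... | true  | inj₁ none = inj₂ (x , p , λ where
    (here ≡.refl) q → ≤-refl
    (there z∈)    q → true≢false q (All.lookup none z∈))
... | false | inj₂ (y , py , my) = inj₂ (y , py , λ where
    (here ≡.refl) q → true≢false q p
    (there z∈)    q → my z∈ q)
... | true  | inj₂ (y , py , my) with ≤-total (f x) (f y)
...   | inj₁ fx≤fy = inj₂ (y , py , λ where
    (here ≡.refl) q → fx≤fy
    (there z∈)    q → my z∈ q)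
...   | inj₂ fy≤fx = inj₂ (x , p , λ where
    (here ≡.refl) q → ≤-refl
    (there z∈)    q → ≤-trans (my z∈ q) fy≤fx)

last-split : ∀ {A : Set} (f : A → ℕ) p xs → All (λ j → f j < p) xs ⊎
  (Σ (List A) λ pre → Σ A λ r → Σ (List A) λ post → xs ≡ pre ++ r ∷ post × p ≤ f r × All (λ j → f j < p) post)
last-split f p [] = inj₁ []
last-split f p (x ∷ xs) with last-split f p xs
... | inj₂ (pre , r , post , e , p≤ , post<) = inj₂ (x ∷ pre , r , post , cong (x ∷_) e , p≤ , post<)
... | inj₁ xs< with p ≤? f x
...   | yes p≤ = inj₂ ([] , x , xs , ≡.refl , p≤ , xs<)
...   | no p≰  = inj₁ (≰⇒> p≰ ∷ xs<)

bound-skip : ∀ zs {x p} ρ → All (_< p) zs → p ≤ x → bound (zs ++ x ∷ ρ) p ≡ suc (length ρ)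
bound-skip []       ρ _          p≤x = bound-≤ ρ p≤x
bound-skip (z ∷ zs) {x} ρ (z<p ∷ zs<) p≤x = ≡.trans (bound-> (zs ++ x ∷ ρ) z<p) (bound-skip zs ρ zs< p≤x)

All-reverse : ∀ {Q : ℕ → Set} xs → All Q xs → All Q (reverse xs)
All-reverse []       _        = []
All-reverse {Q} (x ∷ xs) (q ∷ qs) = subst (All Q) (sym (unfold-reverse x xs)) (All.++⁺ (All-reverse xs qs) (q ∷ []))

module Flag {n : ℕ} (w : Permutation′ n) where
  open OneLine w

  private
    N : List (Fin n)
    N = allFin n
    c : Fin n → ℕ
    c = code w
    later : Fin n → Fin n → Bool
    later i j = (toℕ i <ᵇ toℕ j) ∧ (val w j <ᵇ val w i)

  later⁺ : ∀ {i j} → toℕ i < toℕ j → val w j < val w i → later i j ≡ true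
  later⁺ i<j v rewrite <⇒<ᵇ-true i<j = <⇒<ᵇ-true v

  later⁻ : ∀ {i j} → later i j ≡ true → toℕ i < toℕ j × val w j < val w i
  later⁻ {i} {j} e with toℕ i <ᵇ toℕ j in p
  ... | true = <ᵇ-true⇒< p , <ᵇ-true⇒< e

  later-no : ∀ {i j} → toℕ j ≤ toℕ i → later i j ≡ false
  later-no j≤i rewrite ≥⇒<ᵇ-false j≤i = ≡.refl

  map-toℕ-allFin : ∀ n → map toℕ (allFin n) ≡ upTo n
  map-toℕ-allFin n = ≡.trans (map-tabulate id toℕ) (go n (λ k → k))
    where
    go : ∀ n f → tabulate {n = n} (λ i → f (toℕ i)) ≡ applyUpTo f n
    go zero    f = ≡.refl
    go (suc n) f = cong (f 0 ∷_) (go n (f ∘ suc))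

  count-position : ∀ m → m ≤ n → count (λ j → toℕ j <ᵇ m) N ≡ m
  count-position m m≤n = ≡.trans (sym (count-map toℕ N))
    (≡.trans (cong (smaller m) (map-toℕ-allFin n)) (smaller-upTo n m m≤n))

  count-value : ∀ m → m ≤ n → count (λ j → val w j <ᵇ m) N ≡ m
  count-value m m≤n = ≡.trans (sym (count-map (val w) N))
    (≡.trans (count-↭ oneLine-↭) (smaller-upTo n m m≤n))

  atLeast : ℕ → Fin n → Bool
  atLeast p j = p <ᵇ suc (c j)

  inD⁺ : ∀ {i j d} → val w d ≡ toℕ j → toℕ j < val w i → toℕ i < toℕ d → inD w i j ≡ true
  inD⁺ {i} {j} {d} e p q rewrite <⇒<ᵇ-true p = <⇒<ᵇ-true (subst (λ d → toℕ i < toℕ d)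
    (≡.trans (sym (inverseˡ w)) (cong (w ⟨$⟩ˡ_) (toℕ-injective e))) q)

  inD⁻ : ∀ {i j} → inD w i j ≡ true → toℕ j < val w i × toℕ i < toℕ (w ⟨$⟩ˡ j)
  inD⁻ {i} {j} e with toℕ j <ᵇ val w i in p
  ... | true = <ᵇ-true⇒< p , <ᵇ-true⇒< e

  inMu⁺ : ∀ {r col i j} → inD w i j ≡ true → r ≤ toℕ i → col ≤ toℕ j → inMu w r col ≡ true
  inMu⁺ {r} {col} {i} {j} d r≤ col≤ = any-true⁺ _ (∈-cartesianProduct⁺ (∈-allFin i) (∈-allFin j)) box
    where
    box : (inD w i j ∧ (r ≤ᵇ toℕ i) ∧ (col ≤ᵇ toℕ j)) ≡ true
    box rewrite d | ≤⇒≤ᵇ-true r≤ = ≤⇒≤ᵇ-true col≤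

  inMu⁻ : ∀ {r col} → inMu w r col ≡ true → ∃ λ i → ∃ λ j → inD w i j ≡ true × r ≤ toℕ i × col ≤ toℕ j
  inMu⁻ {r} {col} e with any-true⁻ _ (cartesianProduct N N) e
  ... | (i , j) , _ , p with inD w i j in d | r ≤ᵇ toℕ i in q
  ...   | true | true = i , j , d , ≤ᵇ-true⇒≤ q , ≤ᵇ-true⇒≤ p

  record LastRow (p : ℕ) : Set where
    field
      r        : Fin n
      p≤       : p ≤ c r
      after    : ∀ j → toℕ r < toℕ j → c j < p
      bound≡   : bound (reverse codeList) p ≡ suc (toℕ r)

  lastRow : ∀ {p i} → p ≤ c i → LastRow p
  lastRow {p} {i} p≤ci with last-split c p N
  ... | inj₁ all< = ⊥-elim (<⇒≱ (All.lookup all< (∈-allFin i)) p≤ci)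
  ... | inj₂ (pre , r , post , e , p≤ , post<) = record
    { r = r ; p≤ = p≤ ; after = after
    ; bound≡ = begin
        bound (reverse codeList) p
          ≡⟨ cong (λ l → bound (reverse (map c l)) p) e ⟩
        bound (reverse (map c (pre ++ r ∷ post))) p
          ≡⟨ cong (λ l → bound (reverse l) p) (map-++ c pre (r ∷ post)) ⟩
        bound (reverse (map c pre ++ c r ∷ map c post)) p
          ≡⟨ cong (λ l → bound l p) (≡.trans (reverse-++ (map c pre) (c r ∷ map c post))
               (≡.trans (cong (_++ reverse (map c pre)) (unfold-reverse (c r) (map c post)))
                 (++-assoc (reverse (map c post)) [ c r ] _))) ⟩
        bound (reverse (map c post) ++ c r ∷ reverse (map c pre)) p
          ≡⟨ bound-skip (reverse (map c post)) _ (All-reverse (map c post) (All.map⁺ post<)) p≤ ⟩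
        suc (length (reverse (map c pre)))
          ≡⟨ cong suc (≡.trans (length-reverse (map c pre)) (≡.trans (length-map c pre) (sym position))) ⟩
        suc (toℕ r) ∎
    }
    where
    open ≡-Reasoning
    positions : map toℕ pre ++ toℕ r ∷ map toℕ post ≡ upTo n
    positions = ≡.trans (sym (map-++ toℕ pre (r ∷ post))) (≡.trans (cong (map toℕ) (sym e)) (map-toℕ-allFin n))
    nth-applyUpTo : ∀ xs {y ys} f m → xs ++ y ∷ ys ≡ applyUpTo f m → y ≡ f (length xs)
    nth-applyUpTo []       f (suc m) e = ∷-injectiveˡ e
    nth-applyUpTo (x ∷ xs) f (suc m) e = nth-applyUpTo xs (f ∘ suc) m (∷-injectiveʳ e)
    position : toℕ r ≡ length pre
    position = ≡.trans (nth-applyUpTo (map toℕ pre) id n positions) (length-map toℕ pre)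
    increasing : AllPairs (λ i j → toℕ i < toℕ j) (pre ++ r ∷ post)
    increasing = subst (AllPairs _) e allFin-increasing
    pre< : ∀ pre → AllPairs (λ i j → toℕ i < toℕ j) (pre ++ r ∷ post) → ∀ {j} → j ∈ pre → toℕ j < toℕ r
    pre< (x ∷ pre) (x< ∷ _)  (here ≡.refl) = All.head (All.++⁻ʳ pre x<)
    pre< (x ∷ pre) (_ ∷ inc) (there j∈)    = pre< pre inc j∈
    after : ∀ j → toℕ r < toℕ j → c j < p
    after j r<j with ∈-++⁻ pre (subst (j ∈_) e (∈-allFin j))
    ... | inj₁ j∈              = ⊥-elim (<-asym (pre< pre increasing j∈) r<j)
    ... | inj₂ (here ≡.refl)   = ⊥-elim (<-irrefl ≡.refl r<j)
    ... | inj₂ (there j∈)      = All.lookup post< j∈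

  module WithLastRow {p : ℕ} (p≥1 : 1 ≤ p) (L : LastRow p) where
    open LastRow L

    K : ℕ
    K = count (atLeast p) N

    position< : ∀ (i : Fin n) → suc (toℕ i) ≤ n
    position< i = toℕ<n i

    -- When `p` is a part, `K` is the index of the last row of length `p`, and the inequality places
    -- the last box in row `r` of the diagram on the diagonal of that row or to its right. If
    -- `j ≤ r` has a letter above `val w d`, then every letter counted by the code of `r` is at most
    -- `val w d` and is counted for `j` as well; so the code of `j` is at least `p`.
    rightmost : ∃ λ col → inD w r col ≡ true × suc (toℕ r) + p ≤ suc (toℕ col) + K
    rightmost with argmax (val w) (later r) N
    ... | inj₁ none = ⊥-elim (<⇒≱ p≥1 (≤-trans p≤ (≤-reflexive (count-none none))))
    ... | inj₂ (d , ld , max) = w ⟨$⟩ʳ d , inD⁺ {d = d} ≡.refl (proj₂ (later⁻ ld)) (proj₁ (later⁻ ld)) , (begin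
      suc (toℕ r) + p                                                 ≤⟨ +-monoʳ-≤ (suc (toℕ r)) p≤ ⟩
      suc (toℕ r) + c r                                               ≡⟨ cong (_+ c r) (count-position (suc (toℕ r)) (position< r)) ⟨
      count (λ j → toℕ j <ᵇ suc (toℕ r)) N + count (later r) N        ≤⟨ count-≤ N pointwise ⟩
      count (λ j → val w j <ᵇ suc (val w d)) N + count (atLeast p) N  ≡⟨ cong (_+ K) (count-value (suc (val w d)) (toℕ<n (w ⟨$⟩ʳ d))) ⟩
      suc (val w d) + K                                               ∎)
      where
      open ≤-Reasoning
      larger-code : ∀ {j} → toℕ j ≤ toℕ r → val w d < val w j → c r ≤ c j
      larger-code {j} j≤r v< = count-mono {P = later r} {later j} N λ i i∈ e →
        later⁺ {j} {i} (≤-<-trans j≤r (proj₁ (later⁻ e))) (≤-<-trans (max i∈ e) v<)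
      pointwise : ∀ j → bit (toℕ j <ᵇ suc (toℕ r)) + bit (later r j) ≤ bit (val w j <ᵇ suc (val w d)) + bit (atLeast p j)
      pointwise j with toℕ j ≤? toℕ r
      ... | yes j≤r rewrite <⇒<ᵇ-true (s≤s j≤r) | later-no {r} {j} j≤r with val w j ≤? val w d
      ...   | yes v≤ rewrite <⇒<ᵇ-true (s≤s v≤) = s≤s z≤n
      ...   | no v≰ rewrite <⇒<ᵇ-true (s≤s (≤-trans p≤ (larger-code j≤r (≰⇒> v≰)))) = m≤n+m 1 (bit (val w j <ᵇ suc (val w d)))
      pointwise j | no j≰r rewrite ≥⇒<ᵇ-false {toℕ j} {suc (toℕ r)} (≰⇒> j≰r) with later r j in e
      ... | false = z≤n
      ... | true rewrite <⇒<ᵇ-true (s≤s (max (∈-allFin j) e)) = s≤s z≤n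

    module _ (vex : Vexillary w) {i : Fin n} (ci≡p : c i ≡ p) where

      i≤r : toℕ i ≤ toℕ r
      i≤r with toℕ i ≤? toℕ r
      ... | yes i≤r = i≤r
      ... | no i≰r  = ⊥-elim (<-irrefl ci≡p (after i (≰⇒> i≰r)))

      module _ {a b : Fin n} (inD-ab : inD w a b ≡ true) (r<a : toℕ r < toℕ a) where

        d : Fin n
        d = w ⟨$⟩ˡ b

        val-d : val w d ≡ toℕ b
        val-d = cong toℕ (inverseʳ w)

        b<a : toℕ b < val w a
        b<a = proj₁ (inD⁻ inD-ab)

        a<d : toℕ a < toℕ d
        a<d = proj₂ (inD⁻ inD-ab)

        -- A smaller letter to the right of `j` cannot stand before `a`, as with `j`, `a` and `d` it
        -- would form a 2143. Hence all that is counted for `j` is counted for `a`, which counts `d`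
        -- in addition, and the code of `a` is already below `p`.
        small-code : ∀ {j} → toℕ j ≤ toℕ r → val w j ≤ toℕ b → c j < p
        small-code {j} j≤r v≤ = <-trans (count-strict N sub (∈-allFin d)
            (later-d-no) (later⁺ {a} {d} a<d (subst (_< val w a) (sym val-d) b<a))) (after a r<a)
          where
          v< : val w j < toℕ b
          v< = ≤∧≢⇒< v≤ λ e → <⇒≱ (<-trans r<a a<d)
            (subst (λ k → toℕ k ≤ toℕ r) (val-injective (≡.trans e (sym val-d))) j≤r)
          later-d-no : later j d ≡ false
          later-d-no with later j d in e
          ... | false = ≡.refl
          ... | true  = ⊥-elim (<-asym v< (subst (_< val w j) val-d (proj₂ (later⁻ e))))
          sub : ∀ k → later j k ≡ true → later a k ≡ true
          sub k e with later⁻ {j} {k} e | <-cmp (toℕ k) (toℕ a)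
          ... | j<k , vk<vj | tri> _ _ a<k = later⁺ {a} {k} a<k (<-trans vk<vj (<-trans v< b<a))
          ... | j<k , vk<vj | tri≈ _ k≡a _ = ⊥-elim (<-asym b<a (subst (λ k → val w k < toℕ b) (toℕ-injective k≡a) (<-trans vk<vj v<)))
          ... | j<k , vk<vj | tri< k<a _ _ = ⊥-elim (vex (j , k , a , d , j<k , k<a , a<d , vk<vj ,
            subst (val w j <_) (sym val-d) v< , subst (_< val w a) (sym val-d) b<a))

        b<i : toℕ b < val w i
        b<i with val w i ≤? toℕ b
        ... | yes v≤ = ⊥-elim (<-irrefl ci≡p (small-code i≤r v≤))
        ... | no v≰  = ≰⇒> v≰

        -- The opposite inequality, for a box of the diagram below row `r`. By `small-code`, a
        -- position up to `r` is counted at most once on the left. A position after `r` has code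
        -- below `p`, and if its letter is at most `b`, it is counted by the code of `i`, which is
        -- `p`.
        column-bound : suc (toℕ b) + K ≤ suc (toℕ r) + p
        column-bound = begin
          suc (toℕ b) + K                                                ≡⟨ cong (_+ K) (count-value (suc (toℕ b)) (toℕ<n b)) ⟨
          count (λ j → val w j <ᵇ suc (toℕ b)) N + count (atLeast p) N   ≤⟨ count-≤ N pointwise ⟩
          count (λ j → toℕ j <ᵇ suc (toℕ r)) N + count (later i) N       ≡⟨ cong₂ _+_ (count-position (suc (toℕ r)) (position< r)) ci≡p ⟩
          suc (toℕ r) + p                                                ∎
          where
          open ≤-Reasoning
          bit≤1 : ∀ b → bit b ≤ 1
          bit≤1 true  = ≤-refl
          bit≤1 false = z≤n
          pointwise : ∀ j → bit (val w j <ᵇ suc (toℕ b)) + bit (atLeast p j) ≤ bit (toℕ j <ᵇ suc (toℕ r)) + bit (later i j)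
          pointwise j with toℕ j ≤? toℕ r
          ... | yes j≤r rewrite <⇒<ᵇ-true (s≤s j≤r) with val w j ≤? toℕ b
          ...   | yes v≤ rewrite <⇒<ᵇ-true (s≤s v≤) | ≥⇒<ᵇ-false {p} {suc (c j)} (small-code j≤r v≤) = s≤s z≤n
          ...   | no v≰ rewrite ≥⇒<ᵇ-false {val w j} {suc (toℕ b)} (≰⇒> v≰) = ≤-trans (bit≤1 (atLeast p j)) (s≤s z≤n)
          pointwise j | no j≰r rewrite ≥⇒<ᵇ-false {p} {suc (c j)} (after j (≰⇒> j≰r)) with val w j ≤? toℕ b
          ...   | no v≰ rewrite ≥⇒<ᵇ-false {val w j} {suc (toℕ b)} (≰⇒> v≰) = z≤n
          ...   | yes v≤ rewrite <⇒<ᵇ-true (s≤s v≤) | later⁺ {i} {j} (≤-<-trans i≤r (≰⇒> j≰r)) (≤-<-trans v≤ b<i) =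
            m≤n+m 1 (bit (toℕ j <ᵇ suc (toℕ r)))

    K≤ : K ≤ suc (toℕ r)
    K≤ = ≤-trans (count-mono {P = atLeast p} {λ j → toℕ j <ᵇ suc (toℕ r)} N inside)
      (≤-reflexive (count-position (suc (toℕ r)) (position< r)))
      where
      inside : ∀ j → j ∈ N → atLeast p j ≡ true → (toℕ j <ᵇ suc (toℕ r)) ≡ true
      inside j _ e with toℕ j ≤? toℕ r
      ... | yes j≤r = <⇒<ᵇ-true (s≤s j≤r)
      ... | no j≰r  = ⊥-elim (<⇒≱ (after j (≰⇒> j≰r)) (≤-pred (<ᵇ-true⇒< e)))

-- A box of μ in a row below `r` is northwest of a box of the diagram below `r`, and `column-bound`
-- keeps the latter strictly to the left of the column in which the diagonal meets the former's row.
phi-upper : ∀ {n} (w : Permutation′ n) {p k i} (p≥1 : 1 ≤ p) (L : Flag.LastRow w p) →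
  Flag.WithLastRow.K w p≥1 L ≡ suc k → Vexillary w → code w i ≡ p →
  phiRow w k p ≤ suc (toℕ (Flag.LastRow.r L))
phi-upper {n} w {suc p} {k} p≥1 L K≡ vex ci≡p = max-≤ g (upTo n) (λ {r'} _ → bounded r')
  where
  open Flag w
  open LastRow L
  open WithLastRow p≥1 L
  g : ℕ → ℕ
  g r' = if (k ≤ᵇ r' + p) ∧ inMu w r' (r' + p ∸ k) then suc r' else 0
  bounded : ∀ r' → g r' ≤ suc (toℕ r)
  bounded r' with (k ≤ᵇ r' + p) ∧ inMu w r' (r' + p ∸ k) in e
  ... | false = z≤n
  ... | true with r' ≤? toℕ r
  ...   | yes r'≤r = s≤s r'≤r
  ...   | no r'≰r with inMu⁻ {r'} {r' + p ∸ k} (∧-conicalʳ (k ≤ᵇ r' + p) _ e)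
  ...     | a , b , d , r'≤a , col≤b = ⊥-elim (r'≰r (+-cancelʳ-≤ p r' (toℕ r) (begin
    r' + p    ≤⟨ ≤-trans (m≤n+m∸n (r' + p) k) (+-monoʳ-≤ k col≤b) ⟩
    k + toℕ b ≡⟨ +-comm k (toℕ b) ⟩
    toℕ b + k ≤⟨ ≤-pred (≤-pred (≡.subst₂ _≤_
                   (≡.trans (cong (suc (toℕ b) +_) K≡) (cong suc (+-suc (toℕ b) k))) (cong suc (+-suc (toℕ r) p))
                   (column-bound vex ci≡p d (<-≤-trans (≰⇒> r'≰r) r'≤a)))) ⟩
    toℕ r + p ∎)))
    where
    open ≤-Reasoning

-- The diagonal for row `k'` meets row `r - (k - k')` in the same column in which the diagonal for
-- row `k` meets row `r`. That box is northwest of the last diagram box in row `r`, hence in μ.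
phi-lower : ∀ {n} (w : Permutation′ n) {p k k'} (p≥1 : 1 ≤ p) (L : Flag.LastRow w p) →
  Flag.WithLastRow.K w p≥1 L ≡ suc k → k' ≤ k →
  suc (toℕ (Flag.LastRow.r L)) ∸ (k ∸ k') ≤ phiRow w k' p
phi-lower {n} w {suc p} {k} {k'} p≥1 L K≡ k'≤k = begin
  suc (toℕ r) ∸ (k ∸ k') ≡⟨ +-∸-assoc 1 t≤r ⟩
  suc r'                 ≡⟨ cong (λ b → if b then suc r' else 0) box ⟨
  g r'                   ≤⟨ max-≥ g (∈-upTo⁺ (≤-<-trans (m∸n≤m (toℕ r) (k ∸ k')) (toℕ<n r))) ⟩
  phiRow w k' (suc p)    ∎
  where
  open ≤-Reasoning
  open Flag w
  open LastRow L
  open WithLastRow p≥1 L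
  g : ℕ → ℕ
  g r' = if (k' ≤ᵇ r' + p) ∧ inMu w r' (r' + p ∸ k') then suc r' else 0
  k≤r : k ≤ toℕ r
  k≤r = ≤-pred (subst (_≤ suc (toℕ r)) K≡ K≤)
  t≤r : k ∸ k' ≤ toℕ r
  t≤r = ≤-trans (m∸n≤m k k') k≤r
  r' : ℕ
  r' = toℕ r ∸ (k ∸ k')
  k'≤r' : k' ≤ r'
  k'≤r' = subst (_≤ r') (m∸[m∸n]≡n k'≤k) (∸-monoˡ-≤ (k ∸ k') k≤r)
  r'+k : r' + k ≡ toℕ r + k'
  r'+k = ≡.trans (cong (r' +_) (sym (m∸n+n≡m k'≤k))) (≡.trans (sym (+-assoc r' (k ∸ k') k')) (cong (_+ k') (m∸n+n≡m t≤r)))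
  col = proj₁ rightmost
  column : r' + p ∸ k' ≤ toℕ col
  column = m≤n+o⇒m∸n≤o (r' + p) k' (+-cancelʳ-≤ k (r' + p) (k' + toℕ col) (begin
    r' + p + k            ≡⟨ solve 3 (λ a b c → a :+ b :+ c := a :+ c :+ b) ≡.refl r' p k ⟩
    r' + k + p            ≡⟨ cong (_+ p) r'+k ⟩
    toℕ r + k' + p        ≡⟨ solve 3 (λ a b c → a :+ b :+ c := b :+ (a :+ c)) ≡.refl (toℕ r) k' p ⟩
    k' + (toℕ r + p)      ≤⟨ +-monoʳ-≤ k' (≤-pred (≤-pred (≡.subst₂ _≤_ (cong suc (+-suc (toℕ r) p))
                              (≡.trans (cong (suc (toℕ col) +_) K≡) (cong suc (+-suc (toℕ col) k))) (proj₂ (proj₂ rightmost))))) ⟩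
    k' + (toℕ col + k)    ≡⟨ +-assoc k' (toℕ col) k ⟨
    k' + toℕ col + k      ∎))
    where open +-*-Solver
  box : ((k' ≤ᵇ r' + p) ∧ inMu w r' (r' + p ∸ k')) ≡ true
  box rewrite ≤⇒≤ᵇ-true (≤-trans k'≤r' (m≤m+n r' p)) = inMu⁺ (proj₁ (proj₂ rightmost)) (m∸n≤m (toℕ r) (k ∸ k')) column

-- The shape as the sorted code, and the comparison of the two flags.

insertDesc-↭ : ∀ a bs → insertDesc a bs ↭ a ∷ bs
insertDesc-↭ a []       = refl
insertDesc-↭ a (b ∷ bs) with b ≤ᵇ a
... | true  = refl
... | false = trans (prep b (insertDesc-↭ a bs)) (swap b a refl)

sortDesc-↭ : ∀ as → sortDesc as ↭ as
sortDesc-↭ []       = refl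
sortDesc-↭ (a ∷ as) = trans (insertDesc-↭ a (sortDesc as)) (prep a (sortDesc-↭ as))

insertDesc-descending : ∀ a {bs} → Descending bs → Descending (insertDesc a bs)
insertDesc-descending a {[]}     _          = [] ∷ []
insertDesc-descending a {b ∷ bs} (b≥ ∷ bs↘) with b ≤ᵇ a in e
... | true  = (b≤a ∷ All.map (λ b≥c → ≤-trans b≥c b≤a) b≥) ∷ b≥ ∷ bs↘
  where
  b≤a : b ≤ a
  b≤a = ≤ᵇ-true⇒≤ e
... | false = All-resp-↭ (↭-sym (insertDesc-↭ a bs)) (a≤b ∷ b≥) ∷ insertDesc-descending a bs↘
  where
  a≤b : a ≤ b
  a≤b with ≤-total a b
  ... | inj₁ a≤b = a≤b
  ... | inj₂ b≤a = true≢false (≤⇒≤ᵇ-true b≤a) e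

sortDesc-descending : ∀ as → Descending (sortDesc as)
sortDesc-descending []       = []
sortDesc-descending (a ∷ as) = insertDesc-descending a (sortDesc-descending as)

zeros : ℕ → List ℕ
zeros m = replicate m 0

restore-zeros : ∀ as → ∃ λ m → filterᵇ (λ c → 0 <ᵇ c) as ++ zeros m ↭ as
restore-zeros []           = 0 , refl
restore-zeros (zero ∷ as)  = let m , p = restore-zeros as in suc m , trans (↭-shift 0 (filterᵇ (λ c → 0 <ᵇ c) as) (zeros m)) (prep 0 p)
restore-zeros (suc a ∷ as) = let m , p = restore-zeros as in m , prep (suc a) p

atLeastᵇ : ℕ → ℕ → Bool
atLeastᵇ p c = p <ᵇ suc c

nth-descending-≥ : ∀ {l p i q} → Descending l → nth l i ≡ just q → i < count (atLeastᵇ p) l → p ≤ q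
nth-descending-≥ {x ∷ l} {p} {i} _ e i< with p ≤? x
nth-descending-≥ {x ∷ l} {p} {zero}  _        ≡.refl _  | yes p≤x = p≤x
nth-descending-≥ {x ∷ l} {p} {suc i} (_ ∷ l↘) e i< | yes p≤x rewrite <⇒<ᵇ-true (s≤s p≤x) =
  nth-descending-≥ l↘ e (≤-pred i<)
nth-descending-≥ {x ∷ l} {p} {i} (x≥ ∷ _) e i< | no p≰x = ⊥-elim (<⇒≱ i<
  (≤-trans (≤-reflexive (count-none {P = atLeastᵇ p} (≥⇒<ᵇ-false (≰⇒> p≰x) ∷ All.map (λ x≥y → ≥⇒<ᵇ-false (≤-<-trans x≥y (≰⇒> p≰x))) x≥))) z≤n))

nth-descending-≤ : ∀ {l i j q q'} → Descending l → i ≤ j → nth l i ≡ just q → nth l j ≡ just q' → q' ≤ q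
nth-descending-≤ {x ∷ l} {zero}  {zero}  _        _         ≡.refl ≡.refl = ≤-refl
nth-descending-≤ {x ∷ l} {zero}  {suc j} (x≥ ∷ _) _         ≡.refl e'     = All.lookup x≥ (nth-∈ l e')
nth-descending-≤ {x ∷ l} {suc i} {suc j} (_ ∷ l↘) (s≤s i≤j) e      e'     = nth-descending-≤ l↘ i≤j e e'

nth-count : ∀ {l p i} → Descending l → nth l i ≡ just p → i < count (atLeastᵇ p) l
nth-count {x ∷ l} {.x} {zero}  _         ≡.refl rewrite <⇒<ᵇ-true (n<1+n x) = s≤s z≤n
nth-count {x ∷ l} {p}  {suc i} (x≥ ∷ l↘) e rewrite <⇒<ᵇ-true (s≤s (All.lookup x≥ (nth-∈ l e))) = s≤s (nth-count l↘ e)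

count-≤-length : ∀ {A : Set} (P : A → Bool) xs → count P xs ≤ length xs
count-≤-length P []       = z≤n
count-≤-length P (x ∷ xs) with P x
... | true  = s≤s (count-≤-length P xs)
... | false = m≤n⇒m≤1+n (count-≤-length P xs)

nth-map⁺ : ∀ {A B : Set} (f : A → B) xs {i x} → nth xs i ≡ just x → nth (map f xs) i ≡ just (f x)
nth-map⁺ f (x ∷ xs) {zero}  ≡.refl = ≡.refl
nth-map⁺ f (x ∷ xs) {suc i} e      = nth-map⁺ f xs e

nth-map⁻ : ∀ {A B : Set} (f : A → B) xs {i y} → nth (map f xs) i ≡ just y → ∃ λ x → nth xs i ≡ just x × f x ≡ y
nth-map⁻ f (x ∷ xs) {zero}  e = x , ≡.refl , just-injective e
nth-map⁻ f (x ∷ xs) {suc i} e = nth-map⁻ f xs e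

nth-phis : ∀ {n} (w : Permutation′ n) k ps {i p} → nth ps i ≡ just p → nth (phisFrom w k ps) i ≡ just (phiRow w (k + i) p)
nth-phis w k (p ∷ ps) {zero}  ≡.refl = cong (λ k → just (phiRow w k p)) (sym (+-identityʳ k))
nth-phis w k (_ ∷ ps) {suc i} {p} e  = ≡.trans (nth-phis w (suc k) ps e) (cong (λ k → just (phiRow w k p)) (sym (+-suc k i)))

cell≡at : ∀ T i k → cell T i k ≡ at T i k
cell≡at []      i       k = ≡.refl
cell≡at (r ∷ T) zero    k = ≡.refl
cell≡at (r ∷ T) (suc i) k = ≡.trans (shift-cell r T i k) (cell≡at T i k)
  where
  shift-cell : ∀ r T i k → cell (r ∷ T) (suc i) k ≡ cell T i k
  shift-cell r T i k with nth T i
  ... | nothing = ≡.refl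
  ... | just _  = ≡.refl

column-chain : ∀ {T col} → ColsStrict T → All (All CellOK) T → ∀ t i →
  (∀ j → i ≤ j → j ≤ i + t → ∃ λ s → at T j col ≡ just s) → ∀ {s} → at T i col ≡ just s → ∀ {x} → x ∈ s →
  ∃ λ s' → ∃ λ y → at T (i + t) col ≡ just s' × y ∈ s' × x + t ≤ y
column-chain {T} {col} cs ok zero i col-full {s} e {x} x∈ =
  s , x , subst (λ i → at T i col ≡ just s) (sym (+-identityʳ i)) e , x∈ , ≤-reflexive (+-identityʳ x)
column-chain {T} {col} cs ok (suc t) i col-full {s} e {x} x∈ with col-full (suc i) (n≤1+n i) (subst (suc i ≤_) (sym (+-suc i t)) (s≤s (m≤m+n i t)))
... | s₁ , e₁ with at-nth T e₁
...   | r₁ , er , es with nonempty (All.lookup (All.lookup ok (nth-∈ T er)) (nth-∈ r₁ es))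
...     | y₁ , y₁∈ with column-chain cs ok t (suc i) (λ j i<j j≤ → col-full j (<⇒≤ i<j) (subst (j ≤_) (sym (+-suc i t)) j≤)) e₁ y₁∈
...       | s' , y , e' , y∈ , ≤y = s' , y , subst (λ m → at T m col ≡ just s') (sym (+-suc i t)) e' , y∈ ,
  ≤-trans (subst (_≤ y₁ + t) (sym (+-suc x t)) (+-monoˡ-≤ t (cs (n<1+n i) e e₁ x∈ y₁∈))) ≤y

-- Appending to the reversed code puts new positions in front of the word and so moves every nonzero
-- bound. For the zeros of 1ˣ × w this is the `x` added to the flag.
bound-append : ∀ σ zs p {m} → bound σ p ≡ suc m → bound (σ ++ zs) p ≡ length zs + suc m
bound-append (c ∷ σ) zs p {m} e with c <ᵇ p
... | true  = bound-append σ zs p e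
... | false = begin
  suc (length (σ ++ zs))      ≡⟨ cong suc (≡.trans (length-++ σ) (+-comm (length σ) (length zs))) ⟩
  suc (length zs + length σ)  ≡⟨ +-suc (length zs) (length σ) ⟨
  length zs + suc (length σ)  ≡⟨ cong (length zs +_) e ⟩
  length zs + suc m           ∎
  where open ≡-Reasoning

module SetValued {n : ℕ} (w : Permutation′ n) (vex : Vexillary w) (x : ℕ) where
  open OneLine w
  open Flag w

  ρ : List ℕ
  ρ = reverse codeList ++ reverse (zeros x)

  private
    lam φ : List ℕ
    lam = shape w
    φ   = shiftedFlag w x

  zeroParts : ℕ
  zeroParts = proj₁ (restore-zeros codeList)

  shape-↭ : lam ++ zeros zeroParts ↭ codeList
  shape-↭ = trans (++⁺ʳ (zeros zeroParts) (sortDesc-↭ _)) (proj₂ (restore-zeros codeList))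

  shape-descending : Descending lam
  shape-descending = sortDesc-descending (filterᵇ (λ c → 0 <ᵇ c) codeList)

  -- k is the last row of length p, and r is the last row of the diagram with at least p
  -- boxes.  The flags of the other rows of length p are redundant: column strictness and
  -- the flag of row k bound row i by x + (suc r ∸ (k ∸ i)).
  record Block (i p : ℕ) : Set where
    field
      k       : ℕ
      i≤k     : i ≤ k
      last    : nth lam k ≡ just p
      longer  : ∀ j → j ≤ k → ∃ λ q → nth lam j ≡ just q × p ≤ q
      r       : ℕ
      bound-ρ : bound ρ p ≡ x + suc r
      k≤r     : k ≤ r
      upper   : phiRow w k p ≤ suc r
      lower   : suc r ∸ (k ∸ i) ≤ phiRow w i p

  block : ∀ {i p} → 1 ≤ p → nth lam i ≡ just p → Block i p
  block {i} {p} p≥1 e with ∈-map⁻ (code w) (∈-resp-↭ shape-↭ (∈-++⁺ˡ (nth-∈ lam e)))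
  ... | i₀ , _ , p≡ = go (count (atLeastᵇ p) lam) ≡.refl (nth-count shape-descending e)
    where
    L : LastRow p
    L = lastRow (≤-reflexive p≡)
    open LastRow L using (bound≡) renaming (r to r₀)
    open WithLastRow p≥1 L using (K; K≤)
    K≡ : count (atLeastᵇ p) lam ≡ K
    K≡ = begin
      count (atLeastᵇ p) lam                                            ≡⟨ +-identityʳ _ ⟨
      count (atLeastᵇ p) lam + 0                                        ≡⟨ cong (count (atLeastᵇ p) lam +_) (count-none (no-zeros zeroParts)) ⟨
      count (atLeastᵇ p) lam + count (atLeastᵇ p) (zeros zeroParts)     ≡⟨ count-++ lam (zeros zeroParts) ⟨
      count (atLeastᵇ p) (lam ++ zeros zeroParts)                       ≡⟨ count-↭ shape-↭ ⟩
      count (atLeastᵇ p) codeList                                       ≡⟨ count-map (code w) (allFin n) ⟩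
      K ∎
      where
      open ≡-Reasoning
      no-zeros : ∀ m → All (λ c → atLeastᵇ p c ≡ false) (zeros m)
      no-zeros zero    = []
      no-zeros (suc m) = ≥⇒<ᵇ-false p≥1 ∷ no-zeros m
    go : ∀ m → count (atLeastᵇ p) lam ≡ m → i < m → Block i p
    go (suc k) c (s≤s i≤k) = record
      { k = k ; i≤k = i≤k ; last = last ; longer = longer ; r = toℕ r₀
      ; bound-ρ = ≡.trans (bound-append (reverse codeList) (reverse (zeros x)) p bound≡)
          (cong (_+ suc (toℕ r₀)) (≡.trans (length-reverse (zeros x)) (length-replicate x)))
      ; k≤r = ≤-pred (subst (_≤ suc (toℕ r₀)) (≡.trans (sym K≡) c) K≤)
      ; upper = phi-upper w p≥1 L (≡.trans (sym K≡) c) vex (sym p≡)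
      ; lower = phi-lower w p≥1 L (≡.trans (sym K≡) c) i≤k
      }
      where
      longer : ∀ j → j ≤ k → ∃ λ q → nth lam j ≡ just q × p ≤ q
      longer j j≤k with nth-just lam {j} (<-≤-trans (s≤s j≤k) (subst (_≤ length lam) c (count-≤-length (atLeastᵇ p) lam)))
      ... | q , e' = q , e' , nth-descending-≥ shape-descending e' (subst (j <_) (sym c) (s≤s j≤k))
      last : nth lam k ≡ just p
      last with longer k ≤-refl
      ... | q , e' , p≤q = ≡.trans e' (cong just (≤-antisym (nth-descending-≤ shape-descending i≤k e e') p≤q))

  nth-φ : ∀ {i p} → nth lam i ≡ just p → nth φ i ≡ just (x + phiRow w i p)
  nth-φ e = nth-map⁺ (x +_) (flag w) (nth-phis w 0 lam e)

  module Filled {T : Filling} (shape≡ : map length T ≡ lam) (cells : All (All CellOK) T) (cs : ColsStrict T) where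

    row-length : ∀ {i row} → nth T i ≡ just row → nth lam i ≡ just (length row)
    row-length {i} e = subst (λ l → nth l i ≡ _) shape≡ (nth-map⁺ length T e)

    block-entry : ∀ {i col row s a} → nth T i ≡ just row → nth row col ≡ just s → a ∈ s →
      (B : Block i (length row)) → ∃ λ row' → ∃ λ s' → ∃ λ b →
      nth T (Block.k B) ≡ just row' × length row' ≡ length row × s' ∈ row' × b ∈ s' × a + (Block.k B ∸ i) ≤ b
    block-entry {i} {col} {row} {s} er es a∈ B
      with column-chain cs cells (k ∸ i) i full (nth-at T er es) a∈
      where
      open Block B
      full : ∀ j → i ≤ j → j ≤ i + (k ∸ i) → ∃ λ s → at T j col ≡ just s
      full j _ j≤ with longer j (subst (j ≤_) (m+[n∸m]≡n i≤k) j≤)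
      ... | q , e , p≤q with nth-map⁻ length T (subst (λ l → nth l j ≡ just q) (sym shape≡) e)
      ...   | row' , e' , ≡.refl with nth-just row' (<-≤-trans (nth-< row es) p≤q)
      ...     | s' , e″ = s' , nth-at T e' e″
    ... | s' , b , e' , b∈ , a≤b with at-nth T (subst (λ j → at T j col ≡ just s') (m+[n∸m]≡n (Block.i≤k B)) e')
    ...   | row' , e″ , es' = row' , s' , b , e″ ,
      just-injective (≡.trans (sym (row-length e″)) (Block.last B)) , nth-∈ row' es' , b∈ , a≤b

  flagged⇒SVT : ∀ j T → FlaggedOfSize (bound ρ) lam j T → SVT lam φ j T
  flagged⇒SVT j T (F , size≡) = shape≡ , cell-condition ,
    (λ i k k' s s' k<k' e e' a b a∈ b∈ → rowsWeak k<k' (at≡ e) (at≡ e') a∈ b∈) ,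
    (λ i i' k s s' i<i' e e' a b a∈ b∈ → colsStrict i<i' (at≡ e) (at≡ e') a∈ b∈) ,
    size≡
    where
    open Flagged F
    open Filled shape≡ cells colsStrict
    at≡ : ∀ {i k s} → cell T i k ≡ just s → at T i k ≡ just s
    at≡ {i} {k} e = ≡.trans (sym (cell≡at T i k)) e
    cell-condition : ∀ i k s → cell T i k ≡ just s →
      ¬ (s ≡ []) × AllPairs _<_ s × All (1 ≤_) s × (∀ f → nth φ i ≡ just f → All (_≤ f) s)
    cell-condition i col s e with at-nth T (at≡ e)
    ... | row , er , es with All.lookup (All.lookup cells (nth-∈ T er)) (nth-∈ row es)
    ...   | s≢[] , s↗ , s≥1 = s≢[] , s↗ , s≥1 , λ f ef → All.tabulate λ a∈ →
      subst (_ ≤_) (just-injective (≡.trans (sym (nth-φ (row-length er))) ef)) (entry a∈)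
      where
      entry : ∀ {a} → a ∈ s → a ≤ x + phiRow w i (length row)
      entry {a} a∈ with block (≤-trans (s≤s z≤n) (nth-< row es)) (row-length er)
      ... | B with block-entry er es a∈ B
      ...   | row' , s' , b , er' , len , s'∈ , b∈ , a+t≤b = begin
        a                            ≤⟨ m+n≤o⇒m≤o∸n a a+t≤ ⟩
        x + suc r ∸ (k ∸ i)          ≡⟨ +-∸-assoc x (≤-trans (m∸n≤m k i) (m≤n⇒m≤1+n k≤r)) ⟩
        x + (suc r ∸ (k ∸ i))        ≤⟨ +-monoʳ-≤ x lower ⟩
        x + phiRow w i (length row)  ∎
        where
        open ≤-Reasoning
        open Block B
        a+t≤ : a + (k ∸ i) ≤ x + suc r
        a+t≤ = ≤-trans a+t≤b (≤-trans
          (All.lookup (All.lookup (All.lookup bounded (nth-∈ T er')) s'∈) b∈)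
          (≤-reflexive (≡.trans (cong (bound ρ) len) bound-ρ)))

  SVT⇒flagged : ∀ j T → SVT lam φ j T → FlaggedOfSize (bound ρ) lam j T
  SVT⇒flagged j T (shape≡ , cell-condition , rw , cs , size≡) =
    flagged shape≡ cells bounded (λ k<k' e e' x∈ y∈ → rw _ _ _ _ _ k<k' (cell≡ e) (cell≡ e') _ _ x∈ y∈) cs' , size≡
    where
    cell≡ : ∀ {i k s} → at T i k ≡ just s → cell T i k ≡ just s
    cell≡ {i} {k} e = ≡.trans (cell≡at T i k) e
    cs' : ColsStrict T
    cs' i<i' e e' x∈ y∈ = cs _ _ _ _ _ i<i' (cell≡ e) (cell≡ e') _ _ x∈ y∈
    cells : All (All CellOK) T
    cells = All.tabulate λ r∈ → All.tabulate λ s∈ → let i , er = ∈-nth r∈ ; k , es = ∈-nth s∈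
                                                        a , b , c , _ = cell-condition i k _ (cell≡ (nth-at T er es)) in a , b , c
    open Filled shape≡ cells cs'
    bounded : All (Bounded (bound ρ)) T
    bounded = All.tabulate λ {row} row∈ → All.tabulate λ {s} s∈ → All.tabulate λ {a} a∈ → entry row∈ s∈ a∈
      where
      entry : ∀ {row s a} → row ∈ T → s ∈ row → a ∈ s → a ≤ bound ρ (length row)
      entry {row} {s} {a} row∈ s∈ a∈ with ∈-nth row∈ | ∈-nth s∈
      ... | i , er | col , es with block (≤-trans (s≤s z≤n) (nth-< row es)) (row-length er)
      ...   | B with block-entry er es a∈ B
      ...     | row' , s' , b , er' , len , s'∈ , b∈ , a+t≤b with ∈-nth s'∈
      ...       | col' , es' = begin
        a                                ≤⟨ m≤m+n a (k ∸ i) ⟩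
        a + (k ∸ i)                      ≤⟨ a+t≤b ⟩
        b                                ≤⟨ All.lookup (proj₂ (proj₂ (proj₂ (cell-condition k col' s' (cell≡ (nth-at T er' es')))))
                                              _ (nth-φ (row-length er'))) b∈ ⟩
        x + phiRow w k (length row')     ≡⟨ cong (λ p → x + phiRow w k p) len ⟩
        x + phiRow w k (length row)      ≤⟨ +-monoʳ-≤ x upper ⟩
        x + suc r                        ≡⟨ bound-ρ ⟨
        bound ρ (length row)             ∎
        where
        open ≤-Reasoning
        open Block B

-- The permutation 1ˣ × w.

heckeSum-weights : ∀ {w w'} L l → (∀ k → w k ≡ w' k) → heckeSum w L l ≡ heckeSum w' L l
heckeSum-weights zero    l e = ≡.refl
heckeSum-weights {w} {w'} (suc L) l e = ≡.trans (Right.descents-weights _ l e)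
  (Right.descents-cong w' l (λ q _ → heckeSum-weights L q e))

-- A first letter below all others takes part in no descent and stays in front; it only moves the
-- other positions by one. After `x` such letters the weight `i` has become `x + i`.
heckeSum-∷ : ∀ w L y l → All (y <_) l → heckeSum w L (y ∷ l) ≡ heckeSum (w ∘ suc) L l
heckeSum-∷ w zero y [] _ = ≡.refl
heckeSum-∷ w zero y (z ∷ l) (y<z ∷ _) rewrite ≥⇒<ᵇ-false (<⇒≤ y<z) = ≡.refl
heckeSum-∷ w (suc L) y l y<l = ≡.trans
  (cong (_+ Right.descents (w ∘ suc) (λ u → heckeSum w L (y ∷ u)) l)
    (≡.trans (cong (w 0 *_) (first l y<l)) (*-zeroʳ (w 0))))
  (Right.descents-cong (w ∘ suc) l (λ q q↭l → heckeSum-∷ w L y q (All-resp-↭ (↭-sym q↭l) y<l)))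
  where
  first : ∀ l → All (y <_) l → Right.atDescent (heckeSum w L) (y ∷ l) ≡ 0
  first []      _         = Right.atDescent-[-] y
  first (z ∷ l) (y<z ∷ _) = Right.atDescent-no l (≥⇒<ᵇ-false (<⇒≤ y<z))

heckeSum-++ : ∀ w L q l → AllPairs _<_ q → All (λ y → All (y <_) l) q →
  heckeSum w L (q ++ l) ≡ heckeSum (λ k → w (length q + k)) L l
heckeSum-++ w L []      l _          _          = ≡.refl
heckeSum-++ w L (y ∷ q) l (y<q ∷ q↗) (y<l ∷ q<l) =
  ≡.trans (heckeSum-∷ w L y (q ++ l) (All.++⁺ y<q y<l)) (heckeSum-++ (w ∘ suc) L q l q↗ q<l)

module _ (x : ℕ) where

  <ᵇ-shift : ∀ a b → (x + a <ᵇ x + b) ≡ (a <ᵇ b)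
  <ᵇ-shift a b = go x
    where
    go : ∀ x → (x + a <ᵇ x + b) ≡ (a <ᵇ b)
    go zero    = ≡.refl
    go (suc x) = go x

  descents-map : ∀ w G l → Right.descents w G (map (x +_) l) ≡ Right.descents w (λ u → G (map (x +_) u)) l
  descents-map w G []      = ≡.refl
  descents-map w G (y ∷ l) = cong₂ _+_ (cong (w 0 *_) (first l)) (descents-map (w ∘ suc) (λ u → G (x + y ∷ u)) l)
    where
    first : ∀ l → Right.atDescent G (x + y ∷ map (x +_) l) ≡ Right.atDescent (λ u → G (map (x +_) u)) (y ∷ l)
    first []      = ≡.trans (Right.atDescent-[-] (x + y)) (sym (Right.atDescent-[-] y))
    first (z ∷ l) = ≡.trans (Right-atDescent-if G (x + y) (x + z) (map (x +_) l))
      (≡.trans (cong (λ b → if b then G (x + y ∷ x + z ∷ map (x +_) l) + G (x + z ∷ x + y ∷ map (x +_) l) else 0) (<ᵇ-shift z y))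
        (sym (Right-atDescent-if (λ u → G (map (x +_) u)) y z l)))

  heckeSum-map : ∀ w L l → heckeSum w L (map (x +_) l) ≡ heckeSum w L l
  heckeSum-map w zero l = cong (λ b → if b then 1 else 0) (go l)
    where
    go : ∀ l → Right.sorted (map (x +_) l) ≡ Right.sorted l
    go []          = ≡.refl
    go (y ∷ [])    = ≡.refl
    go (y ∷ z ∷ l) = cong₂ (λ b c → not b ∧ c) (<ᵇ-shift z y) (go (z ∷ l))
  heckeSum-map w (suc L) l = ≡.trans (descents-map w (heckeSum w L) l)
    (Right.descents-cong w l (λ q _ → heckeSum-map w L q))

  smaller-map : ∀ y l → smaller (x + y) (map (x +_) l) ≡ smaller y l
  smaller-map y []      = ≡.refl
  smaller-map y (z ∷ l) rewrite <ᵇ-shift z y with z <ᵇ y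
  ... | true  = cong suc (smaller-map y l)
  ... | false = smaller-map y l

  lehmer-map : ∀ l → lehmer (map (x +_) l) ≡ lehmer l
  lehmer-map []      = ≡.refl
  lehmer-map (y ∷ l) = cong₂ _∷_ (smaller-map y l) (lehmer-map l)

lehmer-++ : ∀ q l → AllPairs _<_ q → All (λ y → All (y <_) l) q → lehmer (q ++ l) ≡ zeros (length q) ++ lehmer l
lehmer-++ []      l _           _            = ≡.refl
lehmer-++ (y ∷ q) l (y<q ∷ q↗) (y<l ∷ q<l) =
  cong₂ _∷_ (smaller-none (All.map <⇒≤ (All.++⁺ y<q y<l))) (lehmer-++ q l q↗ q<l)

codeʳ-reverse : ∀ l → codeʳ (reverse l) [] ≡ reverse (lehmer l)
codeʳ-reverse []      = ≡.refl
codeʳ-reverse (y ∷ l) = begin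
  codeʳ (reverse (y ∷ l)) []         ≡⟨ cong (λ p → codeʳ p []) (unfold-reverse y l) ⟩
  codeʳ (reverse l ++ [ y ]) []      ≡⟨ codeʳ-++ (reverse l) [ y ] [] ⟩
  codeʳ (reverse l) [] ++ [ smaller y (reverse l ʳ++ []) ]
    ≡⟨ cong₂ (λ r m → r ++ [ smaller y m ]) (codeʳ-reverse l)
         (≡.trans (ʳ++-defn (reverse l)) (≡.trans (++-identityʳ _) (reverse-involutive l))) ⟩
  reverse (lehmer l) ++ [ smaller y l ] ≡⟨ unfold-reverse (smaller y l) (lehmer l) ⟨
  reverse (lehmer (y ∷ l))           ∎
  where open ≡-Reasoning

AllPairs-reverse : ∀ {A : Set} {R : A → A → Set} xs → AllPairs R xs → AllPairs (λ a b → R b a) (reverse xs)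
AllPairs-reverse []       _        = []
AllPairs-reverse {R = R} (x ∷ xs) (r ∷ rs) = subst (AllPairs (λ a b → R b a)) (sym (unfold-reverse x xs))
  (AllPairs.++⁺ (AllPairs-reverse xs rs) ([] ∷ [])
    (All-resp-↭ (↭-sym (↭-reverse xs)) (All.map (λ rxy → rxy ∷ []) r)))

module Avoidance {n : ℕ} (w : Permutation′ n) (vex : Vexillary w) (x : ℕ) where
  open OneLine w

  shifted : Fin n → ℕ
  shifted i = x + val w i

  avoids-indices : ∀ p A → AllPairs (λ i j → toℕ j < toℕ i) p → All (λ c → All (λ d → toℕ c < toℕ d) A) p →
    Avoids2143 (map shifted p) (map shifted A)
  avoids-indices []      A _          _         = tt
  avoids-indices (c ∷ p) A (p<c ∷ p↘) (c<A ∷ p<A) =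
    no-pattern , avoids-indices p (c ∷ A) p↘ (All.zipWith (λ where (b<c , b<A) → b<c ∷ b<A) (p<c , p<A))
    where
    no-pattern : ∀ {D} → D ∈ map shifted A → D < shifted c → IncreasingBelow D (map shifted p)
    no-pattern D∈ D<C with ∈-map⁻ shifted D∈
    ... | d , d∈ , ≡.refl = AllPairs.map⁺ (increasing p p↘ p<c)
      where
      increasing : ∀ p → AllPairs (λ i j → toℕ j < toℕ i) p → All (λ j → toℕ j < toℕ c) p →
        AllPairs (λ a b → shifted a < shifted d → shifted b < shifted d → shifted b < shifted a) p
      increasing []      _          _           = []
      increasing (a ∷ p) (p<a ∷ p↘) (a<c ∷ p<c) = All.map (λ {b} b<a → ordered b<a) p<a ∷ increasing p p↘ p<c
        where
        ordered : ∀ {b} → toℕ b < toℕ a → shifted a < shifted d → shifted b < shifted d → shifted b < shifted a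
        ordered {b} b<a A<D B<D with <-cmp (val w b) (val w a)
        ... | tri< vb<va _ _ = +-monoʳ-< x vb<va
        ... | tri≈ _ vb≡va _ = ⊥-elim (<-irrefl (cong toℕ (val-injective vb≡va)) b<a)
        ... | tri> _ _ va<vb = ⊥-elim (vex (b , a , c , d , b<a , a<c , All.lookup c<A d∈ ,
          va<vb , +-cancelˡ-< x _ _ B<D , +-cancelˡ-< x _ _ D<C))

  -- If a 2143 met `q`, its first letter would lie in `q`; but no letter of `q` has a smaller one to
  -- its right.
  avoids-++ : ∀ p q A → Avoids2143 p A → All (λ u → All (_< u) q) p → AllPairs (λ a b → b < a) q →
    All (λ b → All (b <_) A) q → Avoids2143 (p ++ q) A
  avoids-++ []      []      A _ _ _ _ = tt
  avoids-++ []      (C ∷ q) A _ _ (q<C ∷ q↘) (C<A ∷ q<A) =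
    (λ D∈ D<C → ⊥-elim (<-asym D<C (All.lookup C<A D∈))) ,
    avoids-++ [] q (C ∷ A) tt [] q↘ (All.zipWith (λ where (b<C , b<A) → b<C ∷ b<A) (q<C , q<A))
  avoids-++ (C ∷ p) q A (h , v) (q<C ∷ q<p) q↘ q<A =
    (λ D∈ D<C → AllPairs.++⁺ (h D∈ D<C) (AllPairs.map (λ b<a _ _ → b<a) q↘) (All.map (All.map (λ b<u _ _ → b<u)) q<p)) ,
    avoids-++ p q (C ∷ A) v q<p q↘ (All.zipWith (λ where (b<C , b<A) → b<C ∷ b<A) (q<C , q<A))

  -- The permutation 1ˣ × w.
  word : List ℕ
  word = upTo x ++ map (x +_) oneLine

  below-shifted : All (λ y → All (y <_) (map (x +_) oneLine)) (upTo x)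
  below-shifted = All.tabulate λ y∈ → All.map⁺ (All.tabulate λ {z} _ → <-≤-trans (∈-upTo⁻ y∈) (m≤m+n x z))

  word-unique : Unique word
  word-unique = Unique.++⁺ (Unique.upTo⁺ x) (Unique.map⁺ (+-cancelˡ-≡ x _ _) oneLine-unique) disjoint
    where
    disjoint : ∀ {v} → v ∈ upTo x × v ∈ map (x +_) oneLine → ⊥
    disjoint (v∈ , v∈′) = <-irrefl ≡.refl (All.lookup (All.lookup below-shifted v∈) v∈′)

  reverse-word : reverse word ≡ map shifted (reverse (allFin n)) ++ reverse (upTo x)
  reverse-word = ≡.trans (reverse-++ (upTo x) (map (x +_) oneLine)) (cong (_++ reverse (upTo x))
    (≡.trans (cong reverse (sym (map-∘ (allFin n)))) (sym (reverse-map shifted (allFin n)))))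

  word-state : State (reverse word) []
  word-state = state [] (Unique-resp-↭ (trans (↭-sym (↭-reverse word)) (subst (reverse word ↭_) (sym (++-identityʳ (reverse word))) refl)) word-unique)
    (subst (λ p → Avoids2143 p []) (sym reverse-word)
      (avoids-++ (map shifted (reverse (allFin n))) (reverse (upTo x)) []
        (avoids-indices (reverse (allFin n)) [] (AllPairs-reverse (allFin n) allFin-increasing) (All.tabulate λ _ → []))
        (All.tabulate λ u∈ → All-resp-↭ (↭-sym (↭-reverse (upTo x))) (All.tabulate λ y∈ → below y∈ u∈))
        (AllPairs-reverse (upTo x) (upTo-increasing x))
        (All.tabulate λ _ → [])))
    where
    below : ∀ {y u} → y ∈ upTo x → u ∈ map shifted (reverse (allFin n)) → y < u
    below y∈ u∈ with ∈-map⁻ shifted u∈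
    ... | i , _ , ≡.refl = <-≤-trans (∈-upTo⁻ y∈) (m≤m+n x (val w i))

  heckeSum-word : ∀ L → heckeSum suc L (reverse word ʳ++ []) ≡ heckeSum (λ k → x + suc k) L oneLine
  heckeSum-word L = begin
    heckeSum suc L (reverse word ʳ++ [])
      ≡⟨ cong (heckeSum suc L) (≡.trans (ʳ++-defn (reverse word)) (≡.trans (++-identityʳ _) (reverse-involutive word))) ⟩
    heckeSum suc L word
      ≡⟨ heckeSum-++ suc L (upTo x) (map (x +_) oneLine) (upTo-increasing x) below-shifted ⟩
    heckeSum (λ k → suc (length (upTo x) + k)) L (map (x +_) oneLine)
      ≡⟨ heckeSum-map x _ L oneLine ⟩
    heckeSum (λ k → suc (length (upTo x) + k)) L oneLine
      ≡⟨ heckeSum-weights L oneLine (λ k → ≡.trans (cong (λ m → suc (m + k)) (length-applyUpTo id x)) (sym (+-suc x k))) ⟩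
    heckeSum (λ k → x + suc k) L oneLine ∎
    where open ≡-Reasoning

  open SetValued w vex x using (ρ; zeroParts; shape-↭; shape-descending; flagged⇒SVT; SVT⇒flagged)

  code-word : codeʳ (reverse word) [] ≡ ρ
  code-word = begin
    codeʳ (reverse word) []                        ≡⟨ codeʳ-reverse word ⟩
    reverse (lehmer word)                          ≡⟨ cong reverse (lehmer-++ (upTo x) _ (upTo-increasing x) below-shifted) ⟩
    reverse (zeros (length (upTo x)) ++ lehmer (map (x +_) oneLine))
      ≡⟨ cong reverse (cong₂ (λ m l → zeros m ++ l) (length-applyUpTo id x) (≡.trans (lehmer-map x oneLine) lehmer-oneLine)) ⟩
    reverse (zeros x ++ codeList)                  ≡⟨ reverse-++ (zeros x) codeList ⟩
    reverse codeList ++ reverse (zeros x)          ∎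
    where open ≡-Reasoning

-- Removal of the zero parts, the range of summation and the final equation.

strip-zeros : ∀ {f l N} m → Counted (FlaggedOfSize f (l ++ zeros m)) N → Counted (FlaggedOfSize f l) N
strip-zeros {f} {l} {N} zero    c = subst (λ l → Counted (FlaggedOfSize f l) N) (++-identityʳ l) c
strip-zeros {f} {l} {N} (suc m) c = EmptyRow.counted⁻ f f (λ _ → ≡.refl) l
  (strip-zeros {l = l ++ [ 0 ]} m (subst (λ l → Counted (FlaggedOfSize f l) N) (sym (++-assoc l [ 0 ] (zeros m))) c))

++-zeros : ∀ m k → zeros m ++ zeros k ≡ zeros (m + k)
++-zeros zero    k = ≡.refl
++-zeros (suc m) k = cong (0 ∷_) (++-zeros m k)

zeros-descending : ∀ l m → Descending l → Descending (l ++ zeros m)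
zeros-descending l m l↘ = AllPairs.++⁺ l↘ (go m) (All.tabulate λ _ → none m)
  where
  none : ∀ m {v} → All (v ≥_) (zeros m)
  none zero    = []
  none (suc m) = z≤n ∷ none m
  go : ∀ m → Descending (zeros m)
  go zero    = []
  go (suc m) = none m ∷ go m

∑<-upTo : ∀ n f → ∑< n f ≡ sum (map f (upTo n))
∑<-upTo n f = ≡.trans (go n f) (cong sum (sym (map-upTo f n)))
  where
  go : ∀ n f → ∑< n f ≡ sum (applyUpTo f n)
  go zero    f = ≡.refl
  go (suc n) f = ≡.trans (∑<-suc n f) (cong (f 0 +_) (go n (f ∘ suc)))

∑<-zero : ∀ n f → (∀ i → i < n → f i ≡ 0) → ∑< n f ≡ 0
∑<-zero zero    f h = ≡.refl
∑<-zero (suc n) f h = cong₂ _+_ (h n ≤-refl) (∑<-zero n f (λ i i<n → h i (m≤n⇒m≤1+n i<n)))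

∑<-drop : ∀ a m f → (∀ i → i < a → f i ≡ 0) → ∑< (m + a) f ≡ ∑< m (λ t → f (a + t))
∑<-drop a zero    f h = ∑<-zero a f h
∑<-drop a (suc m) f h = cong₂ _+_ (cong f (+-comm m a)) (∑<-drop a m f h)

∑<-sumFromTo : ∀ a L g → (∀ i → i < a → g i ≡ 0) → ∑< (suc L) g ≡ sumFromTo a L g
∑<-sumFromTo a L g h with a ≤? suc L
... | yes a≤ = begin
  ∑< (suc L) g              ≡⟨ cong (λ n → ∑< n g) (m∸n+n≡m a≤) ⟨
  ∑< (suc L ∸ a + a) g      ≡⟨ ∑<-drop a (suc L ∸ a) g h ⟩
  ∑< (suc L ∸ a) (λ t → g (a + t)) ≡⟨ ∑<-upTo (suc L ∸ a) _ ⟩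
  sumFromTo a L g           ∎
  where open ≡-Reasoning
... | no a≰ rewrite m≤n⇒m∸n≡0 (<⇒≤ (≰⇒> a≰)) = ∑<-zero (suc L) g (λ i i< → h i (<-trans i< (≰⇒> a≰)))

shape-≤-size : ∀ T → All (All CellOK) T → sum (map length T) ≤ size T
shape-≤-size []      _          = z≤n
shape-≤-size (r ∷ T) (ok ∷ oks) = ≤-trans (+-mono-≤ (row r ok) (shape-≤-size T oks)) (≤-reflexive (sym (size-∷ r T)))
  where
  row : ∀ r → All CellOK r → length r ≤ sum (map length r)
  row []            _                  = z≤n
  row ([] ∷ r)      ((s≢[] , _) ∷ _)   = ⊥-elim (s≢[] ≡.refl)
  row ((_ ∷ s) ∷ r) (_ ∷ ok)           = s≤s (≤-trans (row r ok) (m≤n+m _ (length s)))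

module Main {n : ℕ} (w : Permutation′ n) (vex : Vexillary w) (x : ℕ) where
  open OneLine w
  open Avoidance w vex x
  open SetValued w vex x

  transition : Σ (Transition ρ) λ τ → ∀ L → heckeSum suc L (reverse word ʳ++ []) ≡ egf (tableaux τ) L
  transition = subst (λ ρ → Σ (Transition ρ) λ τ → ∀ L → heckeSum suc L (reverse word ʳ++ []) ≡ egf (tableaux τ) L)
    code-word (transitions (reverse word) [] word-state (<-wellFounded _))

  number : ℕ → ℕ
  number = tableaux (proj₁ transition)

  counted-SVT : Counted (SVT (shape w) (shiftedFlag w x)) number
  counted-SVT = Counted-⇔ flagged⇒SVT SVT⇒flagged (strip-zeros {l = shape w} (zeroParts + x)
    (countTableaux (proj₁ transition) (zeros-descending (shape w) (zeroParts + x) shape-descending) all-parts))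
    where
    all-parts : shape w ++ zeros (zeroParts + x) ↭ ρ
    all-parts = subst (_↭ ρ) (≡.trans (++-assoc (shape w) (zeros zeroParts) (zeros x)) (cong (shape w ++_) (++-zeros zeroParts x)))
      (++⁺ (trans shape-↭ (↭-sym (↭-reverse codeList))) (↭-sym (↭-reverse (zeros x))))

  -- The number is read off from an enumeration, and any tableau listed there would have an entry in
  -- each of its |λ| cells. This is why the sum may start at |λ|.
  number-small : ∀ j → j < sum (shape w) → number j ≡ 0
  number-small j j< with counted-SVT j
  ... | [] , _ , e = sym e
  ... | T ∷ _ , E , _ = ⊥-elim (<⇒≱ j< (subst (_≤ j) (cong sum shape≡) (subst (sum (map length T) ≤_) size≡ (shape-≤-size T cells))))
    where
    good = SVT⇒flagged j T (Enumerates.sound E T (here ≡.refl))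
    open Flagged (proj₁ good)
    size≡ : size T ≡ j
    size≡ = proj₂ good

  hecke-enumeration : ∀ L → Enumerates (HeckeWord w L) (heckeWords L oneLine)
  hecke-enumeration L = record
    { unique   = heckeWords-unique n L oneLine oneLine-↭
    ; sound    = λ a a∈ → let len , letters , _ , a≈ = sound-words n L oneLine oneLine-↭ a∈ in
        len , letters , normalForm (lehmer oneLine) , reduced , a≈
    ; complete = complete
    }
    where
    inversions≡ : sum (lehmer oneLine) ≡ inversions w
    inversions≡ = cong sum lehmer-oneLine
    length-normalForm : ∀ cs → length (normalForm cs) ≡ sum cs
    length-normalForm []       = ≡.refl
    length-normalForm (c ∷ cs) = ≡.trans (length-++ (down c)) (cong₂ _+_ (length-down c)
      (≡.trans (length-map suc (normalForm cs)) (length-normalForm cs)))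
      where
      length-down : ∀ c → length (down c) ≡ c
      length-down zero    = ≡.refl
      length-down (suc c) = cong suc (length-down c)
    letters-normalForm : ∀ l → Letters (length l) (normalForm (lehmer l))
    letters-normalForm []      = []
    letters-normalForm (y ∷ l) = All.++⁺
      (All.zipWith (λ where (1≤i , i≤c) → 1≤i , s≤s (≤-trans i≤c (count-≤-length _ l))) (down-≥1 (smaller y l) , down-≤ (smaller y l)))
      (All.map⁺ (All.map (λ where (_ , i<) → s≤s z≤n , s≤s i<) (letters-normalForm l)))
    values : applyUpTo (wordAct (normalForm (lehmer oneLine))) n ≡ oneLine
    values = ≡.trans (cong (applyUpTo (wordAct (normalForm (lehmer oneLine)))) (sym length-oneLine))
      (≡.trans (normalForm-ranks oneLine oneLine-unique) (≡.trans (map-local oneLine rank) (map-id oneLine)))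
      where
      rank : ∀ {y} → y ∈ oneLine → smaller y oneLine ≡ y
      rank {y} y∈ = ≡.trans (count-↭ oneLine-↭) (smaller-upTo n y (<⇒≤ (∈-upTo⁻ (∈-resp-↭ oneLine-↭ y∈))))
    tabulate-applyUpTo : ∀ n (f : ℕ → ℕ) → tabulate {n = n} (λ i → f (toℕ i)) ≡ applyUpTo f n
    tabulate-applyUpTo zero    f = ≡.refl
    tabulate-applyUpTo (suc n) f = cong (f 0 ∷_) (tabulate-applyUpTo n (f ∘ suc))
    oneLine-tabulate : oneLine ≡ tabulate (val w)
    oneLine-tabulate = map-tabulate id (val w)
    tabulate-injective : ∀ {n} {f g : Fin n → ℕ} → tabulate f ≡ tabulate g → ∀ i → f i ≡ g i
    tabulate-injective e Fin.zero    = ∷-injectiveˡ e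
    tabulate-injective e (Fin.suc i) = tabulate-injective (∷-injectiveʳ e) i
    reduced : Reduced w (normalForm (lehmer oneLine))
    reduced = subst (λ m → Letters m (normalForm (lehmer oneLine))) length-oneLine (letters-normalForm oneLine) ,
      tabulate-injective (≡.trans (tabulate-applyUpTo n _) (≡.trans values oneLine-tabulate)) ,
      ≡.trans (length-normalForm (lehmer oneLine)) inversions≡
    complete : ∀ a → HeckeWord w L a → a ∈ heckeWords L oneLine
    complete a (len , letters , r , (letters-r , values-r , len-r) , a≈r) =
      ≡.subst₂ (λ L l → a ∈ heckeWords L l) len act≡ (complete-words n a letters)
      where
      one-line-r : applyUpTo (wordAct r) n ≡ oneLine
      one-line-r = ≡.trans (sym (tabulate-applyUpTo n (wordAct r))) (≡.trans (tabulate-cong values-r) (sym oneLine-tabulate))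

      act≡ : act a (upTo n) ≡ oneLine
      act≡ = ≡.trans (act-≈ a≈r (upTo n)) (≡.trans
        (proj₂ (proj₂ (reduced-act n r letters-r)) (≡.trans (cong (sum ∘ lehmer) one-line-r) (≡.trans inversions≡ (sym len-r))))
        one-line-r)

  hecke-sum : ∀ L → sum (map (fkWeight x) (heckeWords L oneLine))
    ≡ sumFromTo (sum (shape w)) L (λ j → number j * j ! * S₂ L j)
  hecke-sum L = begin
    sum (map (fkWeight x) (heckeWords L oneLine))   ≡⟨ weights-heckeWords (x +_) L oneLine ⟩
    heckeSum (λ k → x + suc k) L oneLine            ≡⟨ heckeSum-word L ⟨
    heckeSum suc L (reverse word ʳ++ [])            ≡⟨ proj₂ transition L ⟩
    egf number L                                    ≡⟨ egf-Stirling L number ⟩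
    ∑< (suc L) (λ j → number j * j ! * S₂ L j)
      ≡⟨ ∑<-sumFromTo (sum (shape w)) L _ (λ j j< → cong (λ N → N * j ! * S₂ L j) (number-small j j<)) ⟩
    sumFromTo (sum (shape w)) L (λ j → number j * j ! * S₂ L j) ∎
    where open ≡-Reasoning

theorem6p7 : (n : ℕ) (w : Permutation′ n) → Vexillary w →
    (x : ℕ) → 1 ≤ x → (L : ℕ) →
    Σ (ℕ → ℕ) λ cnt →
    (∀ j → CardIs (SVT (shape w) (shiftedFlag w x) j) (cnt j)) ×
    SumOver (HeckeWord w L) (fkWeight x)
    (sumFromTo (sum (shape w)) L (λ j → cnt j * j ! * S₂ L j))
theorem6p7 n w vex x _ L = number , counted-SVT , heckeWords L oneLine , hecke-enumeration L , hecke-sum L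
  where
  open OneLine w
  open Main w vex x
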